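{- There exist absolute constants $C>0$ and $C_0>0$ such that for every prime number $p$ there exist positive integers $q$ and $a$ with $0<a<q$, $\gcd(a,q)=1$, $q\equiv 0\pmod p$ and $q\le C_0\,p^{C}$, such that all partial quotients of the continued fraction expansion of $a/q$ are bounded by $2$.
   Context: For coprime positive integers $0<a<q$, the rational number $a/q$ is uniquely represented as a regular continued fraction $$\frac{a}{q}=[0;b_1,\dots,b_s]=\cfrac{1}{b_1+\cfrac{1}{b_2+\cdots+\cfrac{1}{b_s}}},\qquad b_s\ge 2,$$ with positive integers $b_1,\dots,b_s$, called the partial quotients of $a/q$. "All partial quotients are bounded by $2$" means $b_j\le 2$ for all $1\le j\le s$. -}

module Defs where

open import Data.Integer.Base using (+_)
open import Data.List.Base using (List; []; _∷_; last)
open import Data.List.Relation.Unary.All using (All; []; _∷_)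
open import Data.Maybe.Relation.Unary.Any using (Any)
open import Data.Nat.Base using (ℕ; NonZero; _≤_)
open import Data.Rational.Base as ℚ using (ℚ; 0ℚ; 1/_; NonNegative; Positive)
open import Data.Rational.Properties
  using (normalize-pos; pos+nonNeg⇒pos; pos⇒nonZero; pos⇒nonNeg; 1/pos⇒pos)
open import Relation.Binary.PropositionalEquality.Core using (_≡_)

-- The value of [0; b₁, …, bₛ].  The value of the empty expansion, [0;], is 0,
-- so that [0; b] = 1 / (b + 0).  The positivity proofs are needed only so that
-- the reciprocals are defined.

mutual

  value : (bs : List ℕ) → All NonZero bs → ℚ
  value []       []        = 0ℚ
  value (b ∷ bs) (nz ∷ ps) = (1/ x) {{pos⇒nonZero x {{x>0}}}}
    where
    x   = completeQuotient b bs ps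
    x>0 = completeQuotient-pos b bs nz ps

  completeQuotient : (b : ℕ) (bs : List ℕ) → All NonZero bs → ℚ
  completeQuotient b bs ps = (+ b) ℚ./ 1 ℚ.+ value bs ps

  completeQuotient-pos : ∀ b bs → NonZero b → (ps : All NonZero bs) →
                         Positive (completeQuotient b bs ps)
  completeQuotient-pos b bs nz ps =
    pos+nonNeg⇒pos ((+ b) ℚ./ 1) {{normalize-pos b 1 {{_}} {{nz}}}}
                   (value bs ps) {{value-nonNeg bs ps}}

  value-nonNeg : ∀ bs ps → NonNegative (value bs ps)
  value-nonNeg []       []        = _
  value-nonNeg (b ∷ bs) (nz ∷ ps) =
    pos⇒nonNeg (value (b ∷ bs) (nz ∷ ps)) {{1/pos⇒pos x {{x>0}}}}
    where
    x   = completeQuotient b bs ps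
    x>0 = completeQuotient-pos b bs nz ps

-- bs is the list of partial quotients of a / q.  The field last≥2 also forces
-- bs to be nonempty.

record IsRegularCF (a q : ℕ) .{{_ : NonZero q}} (bs : List ℕ) : Set where
  field
    positive : All NonZero bs
    last≥2   : Any (2 ≤_) (last bs)
    equation : (+ a) ℚ./ q ≡ value bs positive

-- Let f b = [[0, 1], [1, b]].  The bottom right entry of f b₁ ⋯ f bₛ is the
-- denominator of [0; b₁, …, bₛ], so a product of f 1 and f 2 with this entry
-- divisible by p, and of size polynomial in p, has to be found.
--
-- Let A ⊆ SL₂(𝔽ₚ) be the reductions of the products of an even number of
-- factors with entries below p.  As the continued fractions with partial
-- quotients 1 and 2 form a set of dimension greater than 1/2, |A| ≥ p Kᶜ for a
-- small power K of p.  Replace A by A A A until |A A A| ≤ K |A|; since |A| ≤ p⁴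
-- this takes boundedly many steps.  By Ruzsa's triangle inequality all products
-- of boundedly many factors A and A⁻¹ now have at most Kᶜ |A| elements.  For
-- noncentral h the set X = {a h a⁻¹ : a ∈ A} lies on the quadric surface
-- det = 1, tr = tr h, and X g ∩ X g′ lies on a conic, which has at most 2p
-- points; so the union of the sets X g with g ∈ A shows that X is much smaller
-- than A. Hence the centraliser of h contains many elements of Q = A⁻¹ A,
-- provided that h is a short product of elements of A and A⁻¹.  A centraliser
-- with many elements of Q contains a noncentral one, h say, and the conjugates
-- of h by Q have the same property.  So all conjugates of a fixed centraliser
-- contain many elements of Q.  They are pairwise disjoint outside the centre,
-- and there are about p² of them, which forces |A| ≥ p³ / Kᶜ.
--
-- The number of b ∈ A with tr (m b) = 0 has a small variance as m runs over
-- all matrices.  So for such a large A it cannot vanish for all products m of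
-- the second column of an element of A and the second row of another one,
-- which gives a, b, c ∈ A such that the bottom right entry of a b c is 0.

module Submission where

-- Each f b has determinant -1, so only words of even length land in SL₂: pairs of letters are the
-- basic units. A fixed pair 2 2 at the end of the word makes the last partial quotient at least 2.
-- That boundedly many triplings suffice rests on `K` being a fixed power of p up to bounded
-- exponents: sets growing by the factor `K` pass p⁴ after a constant number `J` of steps. This is
-- what dimension above 1/2 pays for: the initial set has p times a power of p elements, and this
-- surplus must cover the powers of `K` lost in Ruzsa's inequality. The conjugates counted at the
-- end are those of `g₀` = f 1 f 1, of trace 3. Its discriminant is 5, so p must not be 2 or 5. The
-- words 1 1, 1 2 and 2 1 in `A` yield the elementary matrices `U 1#` and `L 1#`, by which all
-- conjugates in `family` are reached one step at a time. With |A| ≥ p³ / M the mixing condition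
-- |A|³ > 2 p⁸ follows from p > 2 M³, where M is a constant times a power of `K`. Primes below a
-- threshold are treated separately: there the powers of a single matrix repeat modulo p.

open import Algebra.Bundles using (Group; CommutativeRing)
open import Algebra.Core using (Op₁; Op₂)
open import Algebra.Structures using (IsGroup; IsCommutativeRing)
import Algebra.Properties.Group as GroupProperties
open import Data.List.Base
  using (List; []; _∷_; _++_; _∷ʳ_; length; map; filter; take; lookup; replicate; foldl; last;
         cartesianProduct; cartesianProductWith; deduplicate; allFin)
open import Data.List.Membership.Propositional using (_∈_; find; lose)
open import Data.List.Membership.Propositional.Properties
open import Data.List.Relation.Binary.Subset.Propositional using (_⊆_)
open import Data.List.Relation.Unary.All using (All; []; _∷_)
open import Data.List.Relation.Unary.AllPairs using ([]; _∷_)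
open import Data.List.Relation.Unary.Any using (any?; here; there; index)
open import Data.List.Relation.Unary.Unique.Propositional using (Unique)
import Data.List.Relation.Unary.Unique.Propositional.Properties as Unique
open import Data.Nat.Base using (ℕ; zero; suc; NonZero; z≤n; s≤s)
open import Data.Nat.Primality using (Prime; prime⇒nonZero)
open import Data.Product.Base using (Σ; Σ-syntax; ∃; ∃₂; ∃-syntax; _×_; _,_; proj₁; proj₂)
open import Data.Product.Properties using (≡-dec)
open import Data.Sum.Base as Sum using (_⊎_; inj₁; inj₂)
open import Function.Base using (_∘_; const; id)
open import Relation.Binary.Definitions using (DecidableEquality)
open import Relation.Binary.PropositionalEquality hiding ([_])
open import Relation.Nullary using (¬_; Dec; does; yes; no)
open import Relation.Nullary.Decidable.Core using (map′; recompute; ¬?; _×-dec_)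
open import Relation.Nullary.Negation using (contradiction)

-- Finite sums, double counting and Cauchy-Schwarz

module Counting where

  open import Data.Nat.Base
  open import Data.Nat.Properties
  open import Data.Nat.Tactic.RingSolver using (solve-∀)
  open import Data.Bool.Base using (if_then_else_)
  open import Data.List.Properties using (length-map; length-++)
  open import Level using (Level)

  private variable
    ℓ ℓ′ ℓ″ : Level
    A : Set ℓ
    B : Set ℓ′

  length-cartesianProduct : (xs : List A) (ys : List B) →
                            length (cartesianProduct xs ys) ≡ length xs * length ys
  length-cartesianProduct []       ys = refl
  length-cartesianProduct (x ∷ xs) ys = trans (length-++ (map (x ,_) ys))
    (cong₂ _+_ (length-map (x ,_) ys) (length-cartesianProduct xs ys))

  ∑ : List A → (A → ℕ) → ℕ
  ∑ []       f = 0
  ∑ (x ∷ xs) f = f x + ∑ xs f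

  𝟙 : {X : Set ℓ} → Dec X → ℕ
  𝟙 d = if does d then 1 else 0

  count : {P : A → Set ℓ} → (∀ x → Dec (P x)) → List A → ℕ
  count P? xs = ∑ xs (𝟙 ∘ P?)

  𝟙-mono : {X : Set ℓ} {Y : Set ℓ′} (X? : Dec X) (Y? : Dec Y) → (X → Y) → 𝟙 X? ≤ 𝟙 Y?
  𝟙-mono (no _)  Y?      f = z≤n
  𝟙-mono (yes _) (yes _) f = ≤-refl
  𝟙-mono (yes x) (no ¬y) f = contradiction (f x) ¬y

  𝟙-× : {X : Set ℓ} {Y : Set ℓ′} (X? : Dec X) (Y? : Dec Y) → 𝟙 X? * 𝟙 Y? ≡ 𝟙 (X? ×-dec Y?)
  𝟙-× (no _)  _       = refl
  𝟙-× (yes _) (yes _) = refl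
  𝟙-× (yes _) (no _)  = refl

  𝟙-split : {X : Set ℓ} {Y : Set ℓ′} (X? : Dec X) (Y? : Dec Y) → 𝟙 Y? ≤ 𝟙 X? + 𝟙 (¬? X? ×-dec Y?)
  𝟙-split (yes _) (yes _) = s≤s z≤n
  𝟙-split (yes _) (no _)  = z≤n
  𝟙-split (no _)  (yes _) = s≤s z≤n
  𝟙-split (no _)  (no _)  = z≤n

  ∑-cong : (xs : List A) {f g : A → ℕ} → (∀ x → f x ≡ g x) → ∑ xs f ≡ ∑ xs g
  ∑-cong []       f≗g = refl
  ∑-cong (x ∷ xs) f≗g = cong₂ _+_ (f≗g x) (∑-cong xs f≗g)

  ∑-mono : (xs : List A) {f g : A → ℕ} → (∀ {x} → x ∈ xs → f x ≤ g x) → ∑ xs f ≤ ∑ xs g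
  ∑-mono []       f≤g = z≤n
  ∑-mono (x ∷ xs) f≤g = +-mono-≤ (f≤g (here refl)) (∑-mono xs (f≤g ∘ there))

  ∑-const : (xs : List A) (k : ℕ) → ∑ xs (const k) ≡ length xs * k
  ∑-const []       k = refl
  ∑-const (x ∷ xs) k = cong (k +_) (∑-const xs k)

  ∑-+ : (xs : List A) (f g : A → ℕ) → ∑ xs (λ x → f x + g x) ≡ ∑ xs f + ∑ xs g
  ∑-+ []       f g = refl
  ∑-+ (x ∷ xs) f g = trans (cong (f x + g x +_) (∑-+ xs f g)) (+-exchange (f x) (g x) _ _)
    where
    +-exchange : ∀ a b c d → a + b + (c + d) ≡ a + c + (b + d)
    +-exchange = solve-∀

  ∑-*ˡ : (k : ℕ) (xs : List A) (f : A → ℕ) → ∑ xs (λ x → k * f x) ≡ k * ∑ xs f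
  ∑-*ˡ k []       f = sym (*-zeroʳ k)
  ∑-*ˡ k (x ∷ xs) f = trans (cong (k * f x +_) (∑-*ˡ k xs f)) (sym (*-distribˡ-+ k (f x) _))

  ∑-*ʳ : (k : ℕ) (xs : List A) (f : A → ℕ) → ∑ xs (λ x → f x * k) ≡ ∑ xs f * k
  ∑-*ʳ k xs f = trans (∑-cong xs (λ x → *-comm (f x) k)) (trans (∑-*ˡ k xs f) (*-comm k _))

  ∑-swap : (xs : List A) (ys : List B) (f : A → B → ℕ) →
           ∑ xs (λ x → ∑ ys (f x)) ≡ ∑ ys (λ y → ∑ xs (λ x → f x y))
  ∑-swap []       ys f = sym (trans (∑-const ys 0) (*-zeroʳ (length ys)))
  ∑-swap (x ∷ xs) ys f =
    trans (cong (∑ ys (f x) +_) (∑-swap xs ys f)) (sym (∑-+ ys (f x) _))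

  ∑-* : (xs : List A) (ys : List B) (f : A → ℕ) (g : B → ℕ) →
        ∑ xs f * ∑ ys g ≡ ∑ xs (λ x → ∑ ys (λ y → f x * g y))
  ∑-* xs ys f g =
    trans (sym (∑-*ʳ (∑ ys g) xs f)) (∑-cong xs (λ x → sym (∑-*ˡ (f x) ys g)))

  ∑-≤ : (xs : List A) {f : A → ℕ} {k : ℕ} → (∀ {x} → x ∈ xs → f x ≤ k) → ∑ xs f ≤ length xs * k
  ∑-≤ xs {k = k} f≤k = ≤-trans (∑-mono xs f≤k) (≤-reflexive (∑-const xs k))

  ∑-≥ : (xs : List A) {f : A → ℕ} {k : ℕ} → (∀ {x} → x ∈ xs → k ≤ f x) → length xs * k ≤ ∑ xs f
  ∑-≥ xs {k = k} k≤f = ≤-trans (≤-reflexive (sym (∑-const xs k))) (∑-mono xs k≤f)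

  2ab≤a²+b² : ∀ a b → 2 * (a * b) ≤ a * a + b * b
  2ab≤a²+b² a b with ≤-total a b
  ... | inj₁ a≤b with c , refl ← m≤n⇒∃[o]m+o≡n a≤b =
    ≤-trans (m≤m+n _ (c * c)) (≤-reflexive (eq a c))
    where
    eq : ∀ a c → 2 * (a * (a + c)) + c * c ≡ a * a + (a + c) * (a + c)
    eq = solve-∀
  ... | inj₂ b≤a with c , refl ← m≤n⇒∃[o]m+o≡n b≤a =
    ≤-trans (m≤m+n _ (c * c)) (≤-reflexive (eq b c))
    where
    eq : ∀ b c → 2 * ((b + c) * b) + c * c ≡ (b + c) * (b + c) + b * b
    eq = solve-∀

  -- Induction on the list; the new cross terms 2 a f(y) are bounded one by one by a² + f(y)².
  ∑-cauchy-schwarz : (xs : List A) (f : A → ℕ) →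
                     ∑ xs f * ∑ xs f ≤ length xs * ∑ xs (λ x → f x * f x)
  ∑-cauchy-schwarz []       f = z≤n
  ∑-cauchy-schwarz (x ∷ xs) f = begin
    (a + S) * (a + S)                       ≡⟨ eq₁ a S ⟩
    a * a + (2 * (a * S) + S * S)           ≤⟨ +-monoʳ-≤ (a * a) (+-mono-≤ cross (∑-cauchy-schwarz xs f)) ⟩
    a * a + ((l * (a * a) + T) + l * T)     ≡⟨ eq₂ a l T ⟩
    suc l * (a * a + T)                     ∎
    where
    open ≤-Reasoning
    a = f x
    S = ∑ xs f
    T = ∑ xs (λ y → f y * f y)
    l = length xs
    eq₁ : ∀ a S → (a + S) * (a + S) ≡ a * a + (2 * (a * S) + S * S)
    eq₁ = solve-∀
    eq₂ : ∀ a l T → a * a + ((l * (a * a) + T) + l * T) ≡ suc l * (a * a + T)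
    eq₂ = solve-∀
    eq₃ : ∀ a y → a * y + a * y ≡ 2 * (a * y)
    eq₃ = solve-∀
    cross : 2 * (a * S) ≤ l * (a * a) + T
    cross = begin
      2 * (a * S)                                ≡⟨ cong (2 *_) (sym (∑-*ˡ a xs f)) ⟩
      2 * ∑ xs (λ y → a * f y)                   ≡⟨ sym (∑-*ˡ 2 xs _) ⟩
      ∑ xs (λ y → 2 * (a * f y))                 ≤⟨ ∑-mono xs (λ {y} _ → 2ab≤a²+b² a (f y)) ⟩
      ∑ xs (λ y → a * a + f y * f y)             ≡⟨ ∑-+ xs _ _ ⟩
      ∑ xs (const (a * a)) + T                   ≡⟨ cong (_+ T) (∑-const xs _) ⟩
      l * (a * a) + T                            ∎

  module _ {P : A → Set ℓ} (P? : ∀ x → Dec (P x)) where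

    count≡length-filter : ∀ xs → count P? xs ≡ length (filter P? xs)
    count≡length-filter [] = refl
    count≡length-filter (x ∷ xs) with P? x
    ... | yes _ = cong suc (count≡length-filter xs)
    ... | no _  = count≡length-filter xs

    count-∃ : ∀ {xs x} → x ∈ xs → P x → 1 ≤ count P? xs
    count-∃ {x ∷ xs} (here refl) px with P? x
    ... | yes _  = s≤s z≤n
    ... | no ¬px = contradiction px ¬px
    count-∃ {y ∷ xs} (there x∈xs) px = ≤-trans (count-∃ x∈xs px) (m≤n+m _ (𝟙 (P? y)))

    count-witness : ∀ xs → 1 ≤ count P? xs → ∃ λ x → x ∈ xs × P x
    count-witness (x ∷ xs) le with P? x
    ... | yes px = x , here refl , px
    ... | no _ with y , y∈xs , py ← count-witness xs le = y , there y∈xs , py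

    count+count¬ : ∀ xs → count P? xs + count (¬? ∘ P?) xs ≡ length xs
    count+count¬ [] = refl
    count+count¬ (x ∷ xs) with P? x
    ... | yes _ = cong suc (count+count¬ xs)
    ... | no _  = trans (+-suc _ _) (cong suc (count+count¬ xs))

  count-mono : {P : A → Set ℓ} {Q : A → Set ℓ′} (P? : ∀ x → Dec (P x)) (Q? : ∀ x → Dec (Q x)) →
               ∀ xs → (∀ {x} → x ∈ xs → P x → Q x) → count P? xs ≤ count Q? xs
  count-mono P? Q? xs P⇒Q = ∑-mono xs (λ {x} x∈xs → 𝟙-mono (P? x) (Q? x) (P⇒Q x∈xs))

  module _ {A : Set ℓ} {B : Set ℓ′} {R : A → B → Set ℓ″} (R? : ∀ x y → Dec (R x y)) where

    double-count : (xs : List A) (ys : List B) →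
                   ∑ xs (λ x → count (R? x) ys) ≡ ∑ ys (λ y → count (λ x → R? x y) xs)
    double-count xs ys = ∑-swap xs ys (λ x y → 𝟙 (R? x y))

    length-≤-fibres : (xs : List A) (ys : List B) (m : ℕ) →
                      (∀ {x} → x ∈ xs → ∃ λ y → y ∈ ys × R x y) →
                      (∀ {y} → y ∈ ys → count (λ x → R? x y) xs ≤ m) →
                      length xs ≤ length ys * m
    length-≤-fibres xs ys m total fibres = begin
      length xs                              ≡⟨ sym (*-identityʳ _) ⟩
      length xs * 1                          ≤⟨ ∑-≥ xs (λ {x} x∈xs → let (y , y∈ys , r) = total x∈xs in count-∃ (R? x) y∈ys r) ⟩
      ∑ xs (λ x → count (R? x) ys)           ≡⟨ double-count xs ys ⟩
      ∑ ys (λ y → count (λ x → R? x y) xs)   ≤⟨ ∑-≤ ys fibres ⟩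
      length ys * m                          ∎
      where open ≤-Reasoning

  unique≤1 : {xs : List A} → Unique xs → (∀ {x y} → x ∈ xs → y ∈ xs → x ≡ y) → length xs ≤ 1
  unique≤1 {xs = []}         _              _  = z≤n
  unique≤1 {xs = _ ∷ []}     _              _  = ≤-refl
  unique≤1 {xs = _ ∷ _ ∷ _}  ((x≢y ∷ _) ∷ _) eq =
    contradiction (eq (here refl) (there (here refl))) x≢y

  -- "Among any three, two agree" is the form in which all bounds by 2 appear below: for the centre
  -- {1, -1}, for the roots of a quadratic equation and for an axis up to sign. It avoids naming the
  -- two elements.
  unique≤2 : {xs : List A} → Unique xs →
             (∀ {x y z} → x ∈ xs → y ∈ xs → z ∈ xs → x ≡ y ⊎ x ≡ z ⊎ y ≡ z) → length xs ≤ 2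
  unique≤2 {xs = []}             _ _ = z≤n
  unique≤2 {xs = _ ∷ []}         _ _ = s≤s z≤n
  unique≤2 {xs = _ ∷ _ ∷ []}     _ _ = ≤-refl
  unique≤2 {xs = _ ∷ _ ∷ _ ∷ _}  ((x≢y ∷ x≢z ∷ _) ∷ (y≢z ∷ _) ∷ _) eq
    with eq (here refl) (there (here refl)) (there (there (here refl)))
  ... | inj₁ x≡y        = contradiction x≡y x≢y
  ... | inj₂ (inj₁ x≡z) = contradiction x≡z x≢z
  ... | inj₂ (inj₂ y≡z) = contradiction y≡z y≢z

  module _ {P : A → Set ℓ} (P? : ∀ x → Dec (P x)) {xs : List A} (xs! : Unique xs) where

    count≤1 : (∀ {x y} → x ∈ xs → y ∈ xs → P x → P y → x ≡ y) → count P? xs ≤ 1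
    count≤1 eq = ≤-trans (≤-reflexive (count≡length-filter P? xs))
      (unique≤1 (Unique.filter⁺ P? xs!) λ x∈ y∈ →
        let (x∈xs , px) = ∈-filter⁻ P? x∈ ; (y∈xs , py) = ∈-filter⁻ P? y∈ in eq x∈xs y∈xs px py)

    count≤2 : (∀ {x y z} → x ∈ xs → y ∈ xs → z ∈ xs → P x → P y → P z → x ≡ y ⊎ x ≡ z ⊎ y ≡ z) →
              count P? xs ≤ 2
    count≤2 eq = ≤-trans (≤-reflexive (count≡length-filter P? xs))
      (unique≤2 (Unique.filter⁺ P? xs!) λ x∈ y∈ z∈ →
        let (x∈xs , px) = ∈-filter⁻ P? x∈ ; (y∈xs , py) = ∈-filter⁻ P? y∈
            (z∈xs , pz) = ∈-filter⁻ P? z∈ in eq x∈xs y∈xs z∈xs px py pz)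

  module _ {A : Set ℓ} {B : Set ℓ′} (_≟_ : DecidableEquality B) where

    length-≤-injection : {xs : List A} {ys : List B} → Unique xs → (f : A → B) →
                         (∀ {x} → x ∈ xs → f x ∈ ys) →
                         (∀ {x y} → x ∈ xs → y ∈ xs → f x ≡ f y → x ≡ y) →
                         length xs ≤ length ys
    length-≤-injection {xs} {ys} xs! f f∈ f-inj = ≤-trans
      (length-≤-fibres (λ x y → f x ≟ y) xs ys 1 (λ {x} x∈xs → f x , f∈ x∈xs , refl)
        (λ {y} _ → count≤1 (λ x → f x ≟ y) xs!
          (λ x∈ x′∈ fx≡y fx′≡y → f-inj x∈ x′∈ (trans fx≡y (sym fx′≡y)))))
      (≤-reflexive (*-identityʳ _))

  length-≤-⊆ : (_≟_ : DecidableEquality A) {xs ys : List A} → Unique xs →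
               (∀ {x} → x ∈ xs → x ∈ ys) → length xs ≤ length ys
  length-≤-⊆ _≟_ xs! xs⊆ys = length-≤-injection _≟_ xs! id xs⊆ys (λ _ _ → id)

  -- Cauchy–Schwarz for the number of g related to u, summed over u.
  module _ {U : Set ℓ} {G : Set ℓ′} {R : U → G → Set ℓ″} (R? : ∀ u g → Dec (R u g))
           {_∼_ : G → G → Set ℓ″} (_∼?_ : ∀ g g′ → Dec (g ∼ g′)) where

    second-moment : (us : List U) (gs : List G) (s c α β : ℕ) →
      (∀ {g} → g ∈ gs → s ≤ count (λ u → R? u g) us) →
      (∀ {g} → g ∈ gs → count (g ∼?_) gs ≤ c) →
      (∀ {g g′} → g ∈ gs → g′ ∈ gs → count (λ u → R? u g ×-dec R? u g′) us ≤ α) →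
      (∀ {g g′} → g ∈ gs → g′ ∈ gs → ¬ g ∼ g′ → count (λ u → R? u g ×-dec R? u g′) us ≤ β) →
      (length gs * s) * (length gs * s) ≤ length us * (length gs * (c * α + length gs * β))
    second-moment us gs s c α β each few α-bound β-bound = begin
      (length gs * s) * (length gs * s)                    ≤⟨ *-mono-≤ total total ⟩
      ∑ us r * ∑ us r                                      ≤⟨ ∑-cauchy-schwarz us r ⟩
      length us * ∑ us (λ u → r u * r u)                   ≤⟨ *-monoʳ-≤ (length us) pairs ⟩
      length us * (length gs * (c * α + length gs * β))    ∎
      where
      open ≤-Reasoning
      e : U → G → ℕ
      e u g = 𝟙 (R? u g)
      r : U → ℕ
      r u = ∑ gs (e u)
      total : length gs * s ≤ ∑ us r
      total = ≤-trans (∑-≥ gs each) (≤-reflexive (∑-swap gs us (λ g u → e u g)))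
      both : G → G → ℕ
      both g g′ = ∑ us (λ u → e u g * e u g′)
      both≡ : ∀ g g′ → both g g′ ≡ count (λ u → R? u g ×-dec R? u g′) us
      both≡ g g′ = ∑-cong us (λ u → 𝟙-× (R? u g) (R? u g′))
      both≤ : ∀ {g g′} → g ∈ gs → g′ ∈ gs → both g g′ ≤ 𝟙 (g ∼? g′) * α + β
      both≤ {g} {g′} g∈ g′∈ with g ∼? g′
      ... | yes _   = ≤-trans (≤-reflexive (both≡ g g′)) (≤-trans (α-bound g∈ g′∈)
                        (≤-trans (≤-reflexive (sym (*-identityˡ α))) (m≤m+n _ β)))
      ... | no g≁g′ = ≤-trans (≤-reflexive (both≡ g g′)) (β-bound g∈ g′∈ g≁g′)
      row : ∀ {g} → g ∈ gs → ∑ gs (both g) ≤ c * α + length gs * β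
      row {g} g∈ = begin
        ∑ gs (both g)                                         ≤⟨ ∑-mono gs (both≤ g∈) ⟩
        ∑ gs (λ g′ → 𝟙 (g ∼? g′) * α + β)                     ≡⟨ ∑-+ gs _ _ ⟩
        ∑ gs (λ g′ → 𝟙 (g ∼? g′) * α) + ∑ gs (const β)        ≡⟨ cong₂ _+_ (∑-*ʳ α gs _) (∑-const gs β) ⟩
        count (g ∼?_) gs * α + length gs * β                  ≤⟨ +-monoˡ-≤ _ (*-monoˡ-≤ α (few g∈)) ⟩
        c * α + length gs * β                                 ∎
      pairs : ∑ us (λ u → r u * r u) ≤ length gs * (c * α + length gs * β)
      pairs = begin
        ∑ us (λ u → r u * r u)
          ≡⟨ ∑-cong us (λ u → ∑-* gs gs (e u) (e u)) ⟩
        ∑ us (λ u → ∑ gs (λ g → ∑ gs (λ g′ → e u g * e u g′)))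
          ≡⟨ ∑-swap us gs _ ⟩
        ∑ gs (λ g → ∑ us (λ u → ∑ gs (λ g′ → e u g * e u g′)))
          ≡⟨ ∑-cong gs (λ g → ∑-swap us gs _) ⟩
        ∑ gs (λ g → ∑ gs (both g))
          ≤⟨ ∑-≤ gs row ⟩
        length gs * (c * α + length gs * β) ∎

-- Product sets in a group and Ruzsa's triangle inequality

module Ruzsa
  {G : Set} (_≟_ : DecidableEquality G)
  (_∙_ : Op₂ G) (ε : G) (_⁻¹ : Op₁ G) (isGroup : IsGroup _≡_ _∙_ ε _⁻¹)
  where

  open Counting
  open import Data.Nat.Base
  open import Data.Nat.Properties hiding (_≟_)
  open import Data.Nat.Tactic.RingSolver using (solve-∀)
  open import Data.List.Properties using (length-map; map-∘; map-id; map-cong)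
  open import Data.List.Membership.DecPropositional _≟_ using (_∈?_)
  open import Data.List.Relation.Unary.Unique.DecPropositional.Properties _≟_ using (deduplicate-!)

  group : Group _ _
  group = record { isGroup = isGroup }
  open Group group using (assoc; identityˡ; _\\_)
  open GroupProperties group using (⁻¹-involutive; ⁻¹-injective; ⁻¹-anti-homo-∙; ∙-cancelˡ; \\-leftDividesˡ; \\-leftDividesʳ)

  private variable
    U V : List G
    x y : G

  infixr 7 _·_

  abstract

    -- Duplicates are removed so that `length` is the cardinality of the product set.
    _·_ : List G → List G → List G
    U · V = deduplicate _≟_ (cartesianProductWith _∙_ U V)

    ·-unique : ∀ U V → Unique (U · V)
    ·-unique U V = deduplicate-! (cartesianProductWith _∙_ U V)

    ∈-·⁺ : x ∈ U → y ∈ V → x ∙ y ∈ U · V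
    ∈-·⁺ x∈U y∈V = ∈-deduplicate⁺ _≟_ (∈-cartesianProductWith⁺ _∙_ x∈U y∈V)

    ∈-·⁻ : ∀ U V → x ∈ U · V → ∃₂ λ u v → u ∈ U × v ∈ V × x ≡ u ∙ v
    ∈-·⁻ U V x∈ = ∈-cartesianProductWith⁻ _∙_ U V (∈-deduplicate⁻ _≟_ (cartesianProductWith _∙_ U V) x∈)

  inv : List G → List G
  inv = map _⁻¹

  ∈-inv⁺ : x ∈ U → x ⁻¹ ∈ inv U
  ∈-inv⁺ = ∈-map⁺ _⁻¹

  inv-unique : Unique U → Unique (inv U)
  inv-unique = Unique.map⁺ ⁻¹-injective

  inv-involutive : ∀ U → inv (inv U) ≡ U
  inv-involutive U = trans (sym (map-∘ U)) (trans (map-cong ⁻¹-involutive U) (map-id U))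

  ·-mono : ∀ {U U′ V V′} → U ⊆ U′ → V ⊆ V′ → U · V ⊆ U′ · V′
  ·-mono {U} {V = V} U⊆ V⊆ x∈ with _ , _ , u∈ , v∈ , refl ← ∈-·⁻ U V x∈ = ∈-·⁺ (U⊆ u∈) (V⊆ v∈)

  ·-assocʳ : ∀ U V W → U · (V · W) ⊆ (U · V) · W
  ·-assocʳ U V W x∈ with _ , _ , u∈ , vw∈ , refl ← ∈-·⁻ U (V · W) x∈
                    with _ , _ , v∈ , w∈ , refl ← ∈-·⁻ V W vw∈ =
    subst (_∈ (U · V) · W) (assoc _ _ _) (∈-·⁺ (∈-·⁺ u∈ v∈) w∈)

  ·-assocˡ : ∀ U V W → (U · V) · W ⊆ U · (V · W)
  ·-assocˡ U V W x∈ with _ , _ , uv∈ , w∈ , refl ← ∈-·⁻ (U · V) W x∈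
                    with _ , _ , u∈ , v∈ , refl ← ∈-·⁻ U V uv∈ =
    subst (_∈ U · (V · W)) (sym (assoc _ _ _)) (∈-·⁺ u∈ (∈-·⁺ v∈ w∈))

  inv-· : ∀ U V → inv (U · V) ⊆ inv V · inv U
  inv-· U V x∈ with _ , y∈ , refl ← ∈-map⁻ _⁻¹ x∈
               with u , v , u∈ , v∈ , refl ← ∈-·⁻ U V y∈ =
    subst (_∈ inv V · inv U) (sym (⁻¹-anti-homo-∙ u v)) (∈-·⁺ (∈-inv⁺ v∈) (∈-inv⁺ u∈))

  ⊆⇒≤ : Unique U → U ⊆ V → length U ≤ length V
  ⊆⇒≤ U! U⊆V = length-≤-⊆ _≟_ U! U⊆V

  length-inv-≤ : Unique U → inv U ⊆ V → length U ≤ length V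
  length-inv-≤ {U} U! U⁻¹⊆V = ≤-trans (≤-reflexive (sym (length-map _⁻¹ U))) (⊆⇒≤ (inv-unique U!) U⁻¹⊆V)

  module _ (U V B : List G) (B! : Unique B) where

    private
      leftFactor : G → G
      leftFactor w with any? (λ u → (u \\ w) ∈? V) U
      ... | yes p = proj₁ (find p)
      -- A default value; `leftFactor-spec` shows that it does not arise for elements of U · V.
      ... | no _  = ε

      leftFactor-spec : ∀ {w} → w ∈ U · V → leftFactor w ∈ U × (leftFactor w \\ w) ∈ V
      leftFactor-spec {w} w∈ with any? (λ u → (u \\ w) ∈? V) U
      ... | yes p = proj₂ (find p)
      ... | no ¬p with u , v , u∈ , v∈ , refl ← ∈-·⁻ U V w∈ =
        contradiction (lose u∈ (subst (_∈ V) (sym (\\-leftDividesʳ u v)) v∈)) ¬p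

    -- Fix a factorisation w = u v for each w in U · V. The map (b , w) ↦ (u b , b⁻¹ v) is
    -- injective: the product of the two components is w, which determines u, and then u b
    -- determines b.
    ruzsa-triangle : length B * length (U · V) ≤ length (U · B) * length (inv B · V)
    ruzsa-triangle = begin
      length B * length (U · V)                                ≡⟨ sym (length-cartesianProduct B (U · V)) ⟩
      length (cartesianProduct B (U · V))                      ≤⟨ length-≤-injection (≡-dec _≟_ _≟_)
                                                                    (Unique.cartesianProduct⁺ B! (·-unique U V)) f f∈ f-inj ⟩
      length (cartesianProduct (U · B) (inv B · V))            ≡⟨ length-cartesianProduct (U · B) (inv B · V) ⟩
      length (U · B) * length (inv B · V)                      ∎
      where
      open ≤-Reasoning
      f : G × G → G × G
      f (b , w) = leftFactor w ∙ b , (b ⁻¹) ∙ (leftFactor w \\ w)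
      f∈ : ∀ {bw} → bw ∈ cartesianProduct B (U · V) → f bw ∈ cartesianProduct (U · B) (inv B · V)
      f∈ bw∈ = let (b∈ , w∈) = ∈-cartesianProduct⁻ B (U · V) bw∈
                   (u∈ , v∈) = leftFactor-spec w∈
               in ∈-cartesianProduct⁺ (∈-·⁺ u∈ b∈) (∈-·⁺ (∈-inv⁺ b∈) v∈)
      f-product : ∀ b w → proj₁ (f (b , w)) ∙ proj₂ (f (b , w)) ≡ w
      f-product b w = trans (assoc _ _ _) (trans (cong (leftFactor w ∙_) (\\-leftDividesˡ b _))
                                                 (\\-leftDividesˡ (leftFactor w) w))
      f-inj : ∀ {bw bw′} → bw ∈ cartesianProduct B (U · V) → bw′ ∈ cartesianProduct B (U · V) →
              f bw ≡ f bw′ → bw ≡ bw′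
      f-inj {b , w} {b′ , w′} _ _ eq with trans (sym (f-product b w)) (trans (cong (λ st → proj₁ st ∙ proj₂ st) eq) (f-product b′ w′))
      ... | refl = cong (_, w) (∙-cancelˡ (leftFactor w) b b′ (cong proj₁ eq))

  -- The product A A⁻¹ A ⋯ of n + 1 factors.
  alternating : ℕ → List G → List G
  alternating zero    A = A
  alternating (suc n) A = A · alternating n (inv A)

  alternating-∙⁺ : ∀ n {A x y z} → x ∈ A → y ∈ A → z ∈ alternating n A →
                   x ∙ ((y ⁻¹) ∙ z) ∈ alternating (2 + n) A
  alternating-∙⁺ n {A} {z = z} x∈A y∈A z∈ = ∈-·⁺ x∈A (∈-·⁺ (∈-inv⁺ y∈A)
    (subst (λ Z → z ∈ alternating n Z) (sym (inv-involutive A)) z∈))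

  module Tripling (A : List G) (A! : Unique A) (ε∈A : ε ∈ A)
                  (K : ℕ) (AAA≤ : length (A · (A · A)) ≤ K * length A) where

    private
      a = length A
      A⁻¹ = inv A
      A⁻¹! = inv-unique A!

      instance
        a≢0 : NonZero a
        a≢0 = >-nonZero (∈-length ε∈A)

      A⁻¹⁻¹⊆A : inv A⁻¹ ⊆ A
      A⁻¹⁻¹⊆A {x} = subst (x ∈_) (inv-involutive A)

      |A⁻¹| : length A⁻¹ ≡ a
      |A⁻¹| = length-map _⁻¹ A

      -- The shape in which the triangle inequality is applied: the set in the middle has a
      -- elements, one factor a cancels, and the exponents of K add up.
      cancel : ∀ i j {x y z} → a * x ≤ y * z → y ≤ K ^ i * a → z ≤ K ^ j * a → x ≤ K ^ (i + j) * a
      cancel i j {x} {y} {z} le y≤ z≤ = *-cancelˡ-≤ a (begin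
        a * x                        ≤⟨ le ⟩
        y * z                        ≤⟨ *-mono-≤ y≤ z≤ ⟩
        (K ^ i * a) * (K ^ j * a)    ≡⟨ eq (K ^ i) (K ^ j) a ⟩
        a * ((K ^ i * K ^ j) * a)    ≡⟨ cong (λ k → a * (k * a)) (sym (^-distribˡ-+-* K i j)) ⟩
        a * (K ^ (i + j) * a)        ∎)
        where
        open ≤-Reasoning
        eq : ∀ k l a → (k * a) * (l * a) ≡ a * ((k * l) * a)
        eq = solve-∀

      from-inv : ∀ {x y} → length A⁻¹ * x ≤ y → a * x ≤ y
      from-inv {x} = subst (λ n → n * x ≤ _) |A⁻¹|

      |AAA| : length (A · (A · A)) ≤ K ^ 1 * a
      |AAA| = subst (λ k → length (A · (A · A)) ≤ k * a) (sym (*-identityʳ K)) AAA≤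

      |AA| : length (A · A) ≤ K ^ 1 * a
      |AA| = ≤-trans (⊆⇒≤ (·-unique A A) (λ {x} x∈ → subst (_∈ A · (A · A)) (identityˡ x) (∈-·⁺ ε∈A x∈))) |AAA|

      |A⁻¹A⁻¹| : length (A⁻¹ · A⁻¹) ≤ K ^ 1 * a
      |A⁻¹A⁻¹| = ≤-trans (length-inv-≤ (·-unique A⁻¹ A⁻¹) (·-mono A⁻¹⁻¹⊆A A⁻¹⁻¹⊆A ∘ inv-· A⁻¹ A⁻¹)) |AA|

      |AAA⁻¹| : length ((A · A) · A⁻¹) ≤ K ^ 2 * a
      |AAA⁻¹| = cancel 1 1 (ruzsa-triangle (A · A) A⁻¹ A A!)
        (≤-trans (⊆⇒≤ (·-unique (A · A) A) (·-assocˡ A A A)) |AAA|) |A⁻¹A⁻¹|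

      |AA⁻¹A⁻¹| : length ((A · A⁻¹) · A⁻¹) ≤ K ^ 2 * a
      |AA⁻¹A⁻¹| = ≤-trans (length-inv-≤ (·-unique (A · A⁻¹) A⁻¹)
        (·-assocʳ A A A⁻¹ ∘ ·-mono A⁻¹⁻¹⊆A (·-mono A⁻¹⁻¹⊆A id ∘ inv-· A A⁻¹) ∘ inv-· (A · A⁻¹) A⁻¹)) |AAA⁻¹|

      |A⁻¹AA| : length (A⁻¹ · (A · A)) ≤ K ^ 2 * a
      |A⁻¹AA| = cancel 1 1 (from-inv (ruzsa-triangle A⁻¹ (A · A) A⁻¹ A⁻¹!)) |A⁻¹A⁻¹|
        (≤-trans (⊆⇒≤ (·-unique (inv A⁻¹) (A · A)) (·-mono A⁻¹⁻¹⊆A id)) |AAA|)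

    |AA⁻¹A| : length (alternating 2 A) ≤ K ^ 3 * a
    |AA⁻¹A| = ≤-trans (⊆⇒≤ (·-unique A _) (·-assocʳ A A⁻¹ A ∘ ·-mono id (·-mono id A⁻¹⁻¹⊆A)))
      (cancel 2 1 (from-inv (ruzsa-triangle (A · A⁻¹) A A⁻¹ A⁻¹!)) |AA⁻¹A⁻¹|
        (≤-trans (⊆⇒≤ (·-unique (inv A⁻¹) A) (·-mono A⁻¹⁻¹⊆A id)) |AA|))

    |A⁻¹AA⁻¹| : length (alternating 2 A⁻¹) ≤ K ^ 3 * a
    |A⁻¹AA⁻¹| = ≤-trans (⊆⇒≤ (·-unique A⁻¹ _) (·-assocʳ A⁻¹ A A⁻¹ ∘ ·-mono id
        (·-mono A⁻¹⁻¹⊆A (λ {x} → subst (x ∈_) (cong inv (inv-involutive A))))))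
      (cancel 2 1 (ruzsa-triangle (A⁻¹ · A) A⁻¹ A A!)
        (≤-trans (⊆⇒≤ (·-unique (A⁻¹ · A) A) (·-assocˡ A⁻¹ A A)) |A⁻¹AA|) |A⁻¹A⁻¹|)

    private
      step : ∀ B → Unique B → length B ≡ a → inv (inv B) ≡ B → length (alternating 2 B) ≤ K ^ 3 * a →
             ∀ n m → length (alternating (1 + n) (inv B)) ≤ K ^ m * a →
             length (alternating (2 + n) B) ≤ K ^ (3 + m) * a
      step B B! |B| B⁻¹⁻¹ |BB⁻¹B| n m |rest| = ≤-trans
        (⊆⇒≤ (·-unique B _) (·-assocʳ B (inv B) (alternating n (inv (inv B)))))
        (cancel 3 m (subst (λ k → k * length ((B · inv B) · alternating n (inv (inv B))) ≤ length ((B · inv B) · B) * length (inv B · alternating n (inv (inv B)))) |B|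
                  (ruzsa-triangle (B · inv B) (alternating n (inv (inv B))) B B!))
          (≤-trans (⊆⇒≤ (·-unique _ B) (·-mono id (·-mono id (λ {x} → subst (x ∈_) (sym B⁻¹⁻¹))) ∘ ·-assocˡ B (inv B) B)) |BB⁻¹B|)
          |rest|)

    -- Ruzsa's inequality with the third factor in the middle separates A A⁻¹ A from the rest, so
    -- each further factor costs K³. The rest starts with an inverse, hence the simultaneous
    -- induction for A and A⁻¹.
    alternating-≤ : ∀ n → length (alternating (2 + n) A) ≤ K ^ (3 + n * 3) * a ×
                          length (alternating (2 + n) A⁻¹) ≤ K ^ (3 + n * 3) * a
    alternating-≤ zero    = |AA⁻¹A| , |A⁻¹AA⁻¹|
    alternating-≤ (suc n) with IH , IH⁻¹ ← alternating-≤ n =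
      step A A! refl (inv-involutive A) |AA⁻¹A| (suc n) (3 + n * 3) IH⁻¹ ,
      step A⁻¹ A⁻¹! |A⁻¹| (cong inv (inv-involutive A)) |A⁻¹AA⁻¹| (suc n) (3 + n * 3)
        (subst (λ Z → length (alternating (2 + n) Z) ≤ K ^ (3 + n * 3) * a) (sym (inv-involutive A)) IH)

-- The field with p elements and a ring solver for it

module PrimeField (p : ℕ) (p-prime : Prime p) where

  import Data.Nat.Base as ℕ
  open import Data.Nat.Primality using (euclidsLemma)
  import Data.Nat.Properties as ℕ
  import Data.Nat.Divisibility as ℕ
  open import Data.Integer.Base as ℤ using (ℤ; 0ℤ; 1ℤ) renaming (+_ to pos)
  import Data.Integer.Properties as ℤ
  import Data.Integer.DivMod as ℤ
  open import Data.Integer.Tactic.RingSolver using (solve-∀)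
  open import Data.Fin.Base as Fin using (Fin; toℕ; fromℕ<)
  import Data.Fin.Properties as Fin
  open import Data.List.Properties using (length-tabulate)
  open import Data.Maybe.Base using (nothing)
  open import Data.Bool.Base using (Bool; true; false)
  open import Tactic.RingSolver.Core.AlmostCommutativeRing
    using (AlmostCommutativeRing; fromCommutativeRing)

  instance
    p≢0 : NonZero p
    p≢0 = prime⇒nonZero p-prime

  F : Set
  F = Fin p

  infix 4 _≟_

  abstract
    _≟_ : DecidableEquality F
    _≟_ = Fin._≟_

  private

    infix 4 _≈_
    record _≈_ (a b : ℤ) : Set where
      constructor mod
      field
        quotient : ℤ
        equation : a ≡ b ℤ.+ quotient ℤ.* pos p

    ≈-sym : ∀ {a b} → a ≈ b → b ≈ a
    ≈-sym {a} {b} (mod k refl) = mod (ℤ.- k) (lem b k (pos p))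
      where
      lem : ∀ b k q → b ≡ b ℤ.+ k ℤ.* q ℤ.+ ℤ.- k ℤ.* q
      lem = solve-∀

    ≈-trans : ∀ {a b c} → a ≈ b → b ≈ c → a ≈ c
    ≈-trans {c = c} (mod k refl) (mod l refl) = mod (l ℤ.+ k) (lem c k l (pos p))
      where
      lem : ∀ c k l q → c ℤ.+ l ℤ.* q ℤ.+ k ℤ.* q ≡ c ℤ.+ (l ℤ.+ k) ℤ.* q
      lem = solve-∀

    ≈-+ : ∀ {a b c d} → a ≈ b → c ≈ d → a ℤ.+ c ≈ b ℤ.+ d
    ≈-+ {b = b} {d = d} (mod k refl) (mod l refl) = mod (k ℤ.+ l) (lem b d k l (pos p))
      where
      lem : ∀ b d k l q → (b ℤ.+ k ℤ.* q) ℤ.+ (d ℤ.+ l ℤ.* q) ≡ (b ℤ.+ d) ℤ.+ (k ℤ.+ l) ℤ.* q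
      lem = solve-∀

    ≈-* : ∀ {a b c d} → a ≈ b → c ≈ d → a ℤ.* c ≈ b ℤ.* d
    ≈-* {b = b} {d = d} (mod k refl) (mod l refl) =
      mod (b ℤ.* l ℤ.+ k ℤ.* d ℤ.+ k ℤ.* pos p ℤ.* l) (lem b d k l (pos p))
      where
      lem : ∀ b d k l q → (b ℤ.+ k ℤ.* q) ℤ.* (d ℤ.+ l ℤ.* q) ≡
            (b ℤ.* d) ℤ.+ (b ℤ.* l ℤ.+ k ℤ.* d ℤ.+ k ℤ.* q ℤ.* l) ℤ.* q
      lem = solve-∀

    ≈-neg : ∀ {a b} → a ≈ b → ℤ.- a ≈ ℤ.- b
    ≈-neg {b = b} (mod k refl) = mod (ℤ.- k) (lem b k (pos p))
      where
      lem : ∀ b k q → ℤ.- (b ℤ.+ k ℤ.* q) ≡ ℤ.- b ℤ.+ ℤ.- k ℤ.* q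
      lem = solve-∀

    ≈-small : ∀ {m n} → m ℕ.< p → n ℕ.< p → pos m ≈ pos n → m ≡ n
    ≈-small {m} {n} m<p n<p (mod k eq) = ℤ.+-injective (ℤ.i-j≡0⇒i≡j (pos m) (pos n)
      (ℤ.∣i∣≡0⇒i≡0 (∣∧<⇒≡0 ℤ.∣ pos m ℤ.- pos n ∣ p∣ (ℕ.≤-<-trans
        (subst (λ z → ℤ.∣ z ∣ ℕ.≤ m ℕ.⊔ n) (sym (ℤ.m-n≡m⊖n m n)) (ℤ.∣m⊝n∣≤m⊔n m n))
        (ℕ.⊔-lub m<p n<p)))))
      where
      lem : ∀ n k q → n ℤ.+ k ℤ.* q ℤ.- n ≡ k ℤ.* q
      lem = solve-∀
      p∣ : p ℕ.∣ ℤ.∣ pos m ℤ.- pos n ∣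
      p∣ = ℕ.divides ℤ.∣ k ∣ (trans
        (cong ℤ.∣_∣ (trans (cong (ℤ._- pos n) eq) (lem (pos n) k (pos p)))) (ℤ.∣i*j∣≡∣i∣*∣j∣ k (pos p)))
      ∣∧<⇒≡0 : ∀ n → p ℕ.∣ n → n ℕ.< p → n ≡ 0
      ∣∧<⇒≡0 zero    _  _  = refl
      ∣∧<⇒≡0 (suc n) p∣ lt = contradiction (ℕ.∣⇒≤ p∣) (ℕ.<⇒≱ lt)

    ι : F → ℤ
    ι x = pos (toℕ x)

    ι-injective : ∀ {x y} → ι x ≈ ι y → x ≡ y
    ι-injective {x} {y} x≈y = Fin.toℕ-injective (≈-small (Fin.toℕ<n x) (Fin.toℕ<n y) x≈y)

  abstract

    ⟦_⟧ : ℤ → F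
    ⟦ z ⟧ = fromℕ< (ℤ.n%ℕd<d z p)

    private
      ι⟦_⟧ : ∀ z → z ≈ ι ⟦ z ⟧
      ι⟦ z ⟧ = mod (z ℤ./ℕ p) (trans (ℤ.a≡a%ℕn+[a/ℕn]*n z p)
        (cong (λ r → pos r ℤ.+ (z ℤ./ℕ p) ℤ.* pos p) (sym (Fin.toℕ-fromℕ< (ℤ.n%ℕd<d z p)))))

  private
    ⟦⟧-cong : ∀ {a b} → a ≈ b → ⟦ a ⟧ ≡ ⟦ b ⟧
    ⟦⟧-cong {a} {b} a≈b = ι-injective (≈-trans (≈-sym ι⟦ a ⟧) (≈-trans a≈b ι⟦ b ⟧))

    ⟦⟧⇒≈ : ∀ {a b} → ⟦ a ⟧ ≡ ⟦ b ⟧ → a ≈ b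
    ⟦⟧⇒≈ {a} {b} eq = ≈-trans ι⟦ a ⟧ (subst (λ x → ι x ≈ b) (sym eq) (≈-sym ι⟦ b ⟧))

  ⟦toℕ⟧ : ∀ x → ⟦ pos (toℕ x) ⟧ ≡ x
  ⟦toℕ⟧ x = ι-injective (≈-sym ι⟦ ι x ⟧)

  ⟦⟧-injective : ∀ {m n} → m ℕ.< p → n ℕ.< p → ⟦ pos m ⟧ ≡ ⟦ pos n ⟧ → m ≡ n
  ⟦⟧-injective m<p n<p eq = ≈-small m<p n<p (⟦⟧⇒≈ eq)

  ⟦⟧≡0⇒∣ : ∀ {n} → ⟦ pos n ⟧ ≡ ⟦ 0ℤ ⟧ → p ℕ.∣ n
  ⟦⟧≡0⇒∣ {n} eq with mod k n≡ ← ⟦⟧⇒≈ {pos n} {0ℤ} eq =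
    ℕ.divides ℤ.∣ k ∣ (trans (cong ℤ.∣_∣ (trans n≡ (ℤ.+-identityˡ (k ℤ.* pos p)))) (ℤ.∣i*j∣≡∣i∣*∣j∣ k (pos p)))

  ∣⇒⟦⟧≡0 : ∀ {n} → p ℕ.∣ n → ⟦ pos n ⟧ ≡ ⟦ 0ℤ ⟧
  ∣⇒⟦⟧≡0 (ℕ.divides k refl) = ⟦⟧-cong {pos (k ℕ.* p)} {0ℤ} (mod (pos k) (trans (ℤ.pos-* k p) (sym (ℤ.+-identityˡ _))))

  infixl 6 _+_ _-_
  infixl 7 _*_
  infix  8 -_

  abstract

    _+_ _*_ : Op₂ F
    x + y = ⟦ ι x ℤ.+ ι y ⟧
    x * y = ⟦ ι x ℤ.* ι y ⟧
    -_ : Op₁ F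
    - x = ⟦ ℤ.- ι x ⟧

    ⟦⟧-+ : ∀ a b → ⟦ a ℤ.+ b ⟧ ≡ ⟦ a ⟧ + ⟦ b ⟧
    ⟦⟧-+ a b = ⟦⟧-cong (≈-+ ι⟦ a ⟧ ι⟦ b ⟧)

    ⟦⟧-* : ∀ a b → ⟦ a ℤ.* b ⟧ ≡ ⟦ a ⟧ * ⟦ b ⟧
    ⟦⟧-* a b = ⟦⟧-cong (≈-* ι⟦ a ⟧ ι⟦ b ⟧)

    ⟦⟧-neg : ∀ a → ⟦ ℤ.- a ⟧ ≡ - ⟦ a ⟧
    ⟦⟧-neg a = ⟦⟧-cong (≈-neg ι⟦ a ⟧)

  0# 1# 2# 5# : F
  0# = ⟦ pos 0 ⟧
  1# = ⟦ pos 1 ⟧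
  2# = ⟦ pos 2 ⟧
  5# = ⟦ pos 5 ⟧

  _-_ : Op₂ F
  x - y = x + - y

  private

    -- Matching on this view replaces elements of F by integers, so that the ring laws descend from
    -- ℤ.
    data Residue : F → Set where
      [_] : ∀ z → Residue ⟦ z ⟧

    residue : ∀ x → Residue x
    residue x = subst Residue (⟦toℕ⟧ x) [ pos (toℕ x) ]

    module Lift (_∙_ : Op₂ F) (_∘_ : Op₂ ℤ) (homo : ∀ a b → ⟦ a ∘ b ⟧ ≡ ⟦ a ⟧ ∙ ⟦ b ⟧) where

      assoc : (∀ a b c → (a ∘ b) ∘ c ≡ a ∘ (b ∘ c)) → ∀ x y z → (x ∙ y) ∙ z ≡ x ∙ (y ∙ z)
      assoc assocℤ x y z with residue x | residue y | residue z
      ... | [ a ] | [ b ] | [ c ] = begin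
        (⟦ a ⟧ ∙ ⟦ b ⟧) ∙ ⟦ c ⟧   ≡⟨ cong (_∙ ⟦ c ⟧) (homo a b) ⟨
        ⟦ a ∘ b ⟧ ∙ ⟦ c ⟧         ≡⟨ homo (a ∘ b) c ⟨
        ⟦ (a ∘ b) ∘ c ⟧           ≡⟨ cong ⟦_⟧ (assocℤ a b c) ⟩
        ⟦ a ∘ (b ∘ c) ⟧           ≡⟨ homo a (b ∘ c) ⟩
        ⟦ a ⟧ ∙ ⟦ b ∘ c ⟧         ≡⟨ cong (⟦ a ⟧ ∙_) (homo b c) ⟩
        ⟦ a ⟧ ∙ (⟦ b ⟧ ∙ ⟦ c ⟧)   ∎
        where open ≡-Reasoning

      comm : (∀ a b → a ∘ b ≡ b ∘ a) → ∀ x y → x ∙ y ≡ y ∙ x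
      comm commℤ x y with residue x | residue y
      ... | [ a ] | [ b ] = trans (sym (homo a b)) (trans (cong ⟦_⟧ (commℤ a b)) (homo b a))

      identityˡ : ∀ e → (∀ a → e ∘ a ≡ a) → ∀ x → ⟦ e ⟧ ∙ x ≡ x
      identityˡ e idℤ x with residue x
      ... | [ a ] = trans (sym (homo e a)) (cong ⟦_⟧ (idℤ a))

    inverseˡ : ∀ x → - x + x ≡ 0#
    inverseˡ x with residue x
    ... | [ a ] = trans (cong (_+ ⟦ a ⟧) (sym (⟦⟧-neg a)))
                    (trans (sym (⟦⟧-+ (ℤ.- a) a)) (cong ⟦_⟧ (ℤ.+-inverseˡ a)))

    distribˡ : ∀ x y z → x * (y + z) ≡ x * y + x * z
    distribˡ x y z with residue x | residue y | residue z
    ... | [ a ] | [ b ] | [ c ] = begin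
      ⟦ a ⟧ * (⟦ b ⟧ + ⟦ c ⟧)             ≡⟨ cong (⟦ a ⟧ *_) (⟦⟧-+ b c) ⟨
      ⟦ a ⟧ * ⟦ b ℤ.+ c ⟧                 ≡⟨ ⟦⟧-* a (b ℤ.+ c) ⟨
      ⟦ a ℤ.* (b ℤ.+ c) ⟧                 ≡⟨ cong ⟦_⟧ (ℤ.*-distribˡ-+ a b c) ⟩
      ⟦ a ℤ.* b ℤ.+ a ℤ.* c ⟧             ≡⟨ ⟦⟧-+ (a ℤ.* b) (a ℤ.* c) ⟩
      ⟦ a ℤ.* b ⟧ + ⟦ a ℤ.* c ⟧           ≡⟨ cong₂ _+_ (⟦⟧-* a b) (⟦⟧-* a c) ⟩
      ⟦ a ⟧ * ⟦ b ⟧ + ⟦ a ⟧ * ⟦ c ⟧       ∎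
      where open ≡-Reasoning

    +-comm : ∀ x y → x + y ≡ y + x
    +-comm = Lift.comm _+_ ℤ._+_ ⟦⟧-+ ℤ.+-comm

    +-identityˡ : ∀ x → 0# + x ≡ x
    +-identityˡ = Lift.identityˡ _+_ ℤ._+_ ⟦⟧-+ 0ℤ ℤ.+-identityˡ

    *-comm : ∀ x y → x * y ≡ y * x
    *-comm = Lift.comm _*_ ℤ._*_ ⟦⟧-* ℤ.*-comm

    *-identityˡ : ∀ x → 1# * x ≡ x
    *-identityˡ = Lift.identityˡ _*_ ℤ._*_ ⟦⟧-* 1ℤ ℤ.*-identityˡ

  F-isCommutativeRing : IsCommutativeRing _≡_ _+_ _*_ (λ x → - x) 0# 1#
  F-isCommutativeRing = record
    { isRing = record
      { +-isAbelianGroup = record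
        { isGroup = record
          { isMonoid = record
            { isSemigroup = record
              { isMagma = record { isEquivalence = isEquivalence ; ∙-cong = cong₂ _+_ }
              ; assoc = Lift.assoc _+_ ℤ._+_ ⟦⟧-+ ℤ.+-assoc }
            ; identity = +-identityˡ , λ x → trans (+-comm x 0#) (+-identityˡ x) }
          ; inverse = inverseˡ , λ x → trans (+-comm x (- x)) (inverseˡ x)
          ; ⁻¹-cong = cong (λ x → - x) }
        ; comm = +-comm }
      ; *-cong = cong₂ _*_
      ; *-assoc = Lift.assoc _*_ ℤ._*_ ⟦⟧-* ℤ.*-assoc
      ; *-identity = *-identityˡ , λ x → trans (*-comm x 1#) (*-identityˡ x)
      ; distrib = distribˡ , λ x y z → trans (*-comm (y + z) x)
          (trans (distribˡ x y z) (cong₂ _+_ (*-comm x y) (*-comm x z)))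
      }
    ; *-comm = *-comm
    }

  F-commutativeRing : CommutativeRing _ _
  F-commutativeRing = record { isCommutativeRing = F-isCommutativeRing }

  F-ring : AlmostCommutativeRing _ _
  F-ring = fromCommutativeRing F-commutativeRing (λ _ → nothing)

  -- The coefficients are integers: in F itself the vanishing of a coefficient
  -- could not be decided by computation.
  module Solver where

    open import Data.Vec.Base using (Vec)
    open import Data.Vec.N-ary using (N-ary)
    open import Tactic.RingSolver.Core.Polynomial.Parameters using (Homomorphism)
    open import Tactic.RingSolver.Core.Expression public
    open AlmostCommutativeRing F-ring using (rawRing; semiring)
    open import Algebra.Properties.Semiring.Exp.TCOptimised semiring using (^-congˡ)

    isZero : ℤ → Bool
    isZero (pos 0) = true
    isZero _     = false

    homo : Homomorphism _ _ _ _
    homo = record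
      { from = record { rawRing = CommutativeRing.rawRing ℤ.+-*-commutativeRing ; isZero = isZero }
      ; to = F-ring
      ; morphism = record
        { ⟦_⟧ = ⟦_⟧ ; +-homo = ⟦⟧-+ ; *-homo = ⟦⟧-* ; -‿homo = ⟦⟧-neg ; 0-homo = refl ; 1-homo = refl }
      ; Zero-C⟶Zero-R = λ { (pos 0) _ → refl }
      }

    open Eval rawRing ⟦_⟧ renaming (⟦_⟧ to eval)
    open import Tactic.RingSolver.Core.Polynomial.Base (Homomorphism.from homo) renaming (ι to ιₚ)
    open import Tactic.RingSolver.Core.Polynomial.Semantics homo renaming (⟦_⟧ to ⟦_⟧ₚ)
    open import Tactic.RingSolver.Core.Polynomial.Homomorphism homo

    norm : ∀ {n} → Expr ℤ n → Poly n
    norm (Κ x)   = κ x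
    norm (Ι x)   = ιₚ x
    norm (x ⊕ y) = norm x ⊞ norm y
    norm (x ⊗ y) = norm x ⊠ norm y
    norm (⊝ x)   = ⊟ norm x
    norm (x ⊛ i) = norm x ⊡ i

    normal : ∀ {n} → Expr ℤ n → Vec F n → F
    normal e = ⟦ norm e ⟧ₚ

    correct : ∀ {n} (e : Expr ℤ n) ρ → normal e ρ ≡ eval e ρ
    correct (Κ x)   ρ = κ-hom x ρ
    correct (Ι x)   ρ = ι-hom x ρ
    correct (x ⊕ y) ρ = trans (⊞-hom (norm x) (norm y) ρ) (cong₂ _+_ (correct x ρ) (correct y ρ))
    correct (x ⊗ y) ρ = trans (⊠-hom (norm x) (norm y) ρ) (cong₂ _*_ (correct x ρ) (correct y ρ))
    correct (⊝ x)   ρ = trans (⊟-hom (norm x) ρ) (cong (λ z → - z) (correct x ρ))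
    correct (x ⊛ i) ρ = trans (⊡-hom (norm x) i ρ) (^-congˡ i (correct x ρ))

    open import Relation.Binary.Reflection (setoid F) Ι eval normal correct public
      using (solve)

    infix  9 #_
    infix  4 _⊜_
    infixl 6 _⊖_
    #_ : ∀ {n} → ℕ → Expr ℤ n
    # n = Κ (pos n)
    _⊜_ : ∀ {n} → Expr ℤ n → Expr ℤ n → Expr ℤ n × Expr ℤ n
    _⊜_ = _,_
    _⊖_ : ∀ {n} → Expr ℤ n → Expr ℤ n → Expr ℤ n
    x ⊖ y = x ⊕ ⊝ y

  open Solver using (solve; _⊜_; _⊕_; _⊗_; _⊖_; ⊝_; #_)

  abstract

    x*y≡0 : ∀ {x y} → x * y ≡ 0# → x ≡ 0# ⊎ y ≡ 0#
    x*y≡0 {x} {y} eq = Sum.map (zero? x) (zero? y)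
      (euclidsLemma (toℕ x) (toℕ y) p-prime (⟦⟧≡0⇒∣ (trans (cong ⟦_⟧ (ℤ.pos-* (toℕ x) (toℕ y)))
        (trans (⟦⟧-* (pos (toℕ x)) (pos (toℕ y))) (trans (cong₂ _*_ (⟦toℕ⟧ x) (⟦toℕ⟧ y)) eq)))))
      where
      zero? : ∀ x → p ℕ.∣ toℕ x → x ≡ 0#
      zero? x p∣x = trans (sym (⟦toℕ⟧ x)) (∣⇒⟦⟧≡0 p∣x)

    x-y≡0⇒x≡y : ∀ {x y} → x - y ≡ 0# → x ≡ y
    x-y≡0⇒x≡y {x} {y} eq = trans (solve 2 (λ x y → x ⊜ (x ⊖ y) ⊕ y) refl x y)
      (trans (cong (_+ y) eq) (solve 1 (λ y → # 0 ⊕ y ⊜ y) refl y))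

    x≡y⇒x-y≡0 : ∀ {x y} → x ≡ y → x - y ≡ 0#
    x≡y⇒x-y≡0 {x} refl = solve 1 (λ x → x ⊖ x ⊜ # 0) refl x

    *-cancelˡ-≢0 : ∀ {x y z} → x ≢ 0# → x * y ≡ x * z → y ≡ z
    *-cancelˡ-≢0 {x} {y} {z} x≢0 eq = Sum.[ (λ x≡0 → contradiction x≡0 x≢0) , x-y≡0⇒x≡y ]
      (x*y≡0 (trans (factor x y z) (x≡y⇒x-y≡0 eq)))
      where
      factor : ∀ x y z → x * (y - z) ≡ x * y - x * z
      factor = solve 3 (λ x y z → x ⊗ (y ⊖ z) ⊜ x ⊗ y ⊖ x ⊗ z) refl

  ⟦small⟧≢0 : ∀ n → n ℕ.< p → 0 ℕ.< n → ⟦ pos n ⟧ ≢ 0#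
  ⟦small⟧≢0 n n<p 0<n eq = ℕ.<⇒≢ 0<n (sym (⟦⟧-injective n<p (ℕ.>-nonZero⁻¹ p) eq))

  -- The additive group is generated by 1. This reaches all `U i` and `L j` from single
  -- multiplications by `U 1#` and `L 1#`.
  F-induction : (P : F → Set) → P 0# → (∀ x → P x → P (x + 1#)) → ∀ x → P x
  F-induction P P0 P+1 x = subst P (⟦toℕ⟧ x) (go (toℕ x))
    where
    go : ∀ n → P ⟦ pos n ⟧
    go zero    = P0
    go (suc n) = subst P (trans (sym (⟦⟧-+ (pos n) 1ℤ)) (cong (⟦_⟧ ∘ pos) (ℕ.+-comm n 1))) (P+1 _ (go n))

  abstract

    elements : List F
    elements = allFin p

    ∈-elements : ∀ x → x ∈ elements
    ∈-elements = ∈-allFin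

    elements-unique : Unique elements
    elements-unique = Unique.allFin⁺ p

    length-elements : length elements ≡ p
    length-elements = length-tabulate id

-- The group SL₂ over the prime field

module SL2 (p : ℕ) (p-prime : Prime p) where

  open PrimeField p p-prime
  open Solver using (solve; _⊜_; _⊕_; _⊗_; _⊖_; ⊝_; #_)

  record Mat : Set where
    constructor mat
    field
      m₁₁ m₁₂ m₂₁ m₂₂ : F

  open Mat public

  mat-≡ : ∀ {a b c d a′ b′ c′ d′} → a ≡ a′ → b ≡ b′ → c ≡ c′ → d ≡ d′ → mat a b c d ≡ mat a′ b′ c′ d′
  mat-≡ refl refl refl refl = refl

  infix 4 _≟ᴹ_
  _≟ᴹ_ : DecidableEquality Mat
  mat a b c d ≟ᴹ mat a′ b′ c′ d′ =
    map′ (λ (p , q , r , s) → mat-≡ p q r s) (λ { refl → refl , refl , refl , refl })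
      (a ≟ a′ ×-dec b ≟ b′ ×-dec c ≟ c′ ×-dec d ≟ d′)

  infixl 7 _⊛_
  _⊛_ : Op₂ Mat
  mat a b c d ⊛ mat e f g h = mat (a * e + b * g) (a * f + b * h) (c * e + d * g) (c * f + d * h)

  det tr : Mat → F
  det (mat a b c d) = a * d - b * c
  tr (mat a b c d) = a + d

  tr-⊛-comm : ∀ X Y → tr (X ⊛ Y) ≡ tr (Y ⊛ X)
  tr-⊛-comm (mat a b c d) (mat e f g h) = solve 8 (λ a b c d e f g h →
    (a ⊗ e ⊕ b ⊗ g) ⊕ (c ⊗ f ⊕ d ⊗ h) ⊜ (e ⊗ a ⊕ f ⊗ c) ⊕ (g ⊗ b ⊕ h ⊗ d)) refl a b c d e f g h

  adj : Op₁ Mat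
  adj (mat a b c d) = mat d (- b) (- c) a

  𝟏 : Mat
  𝟏 = mat 1# 0# 0# 1#

  ⊛-assoc : ∀ X Y Z → (X ⊛ Y) ⊛ Z ≡ X ⊛ (Y ⊛ Z)
  ⊛-assoc (mat a b c d) (mat e f g h) (mat i j k l) =
    mat-≡ (lem a b e f g h i k) (lem a b e f g h j l) (lem c d e f g h i k) (lem c d e f g h j l)
    where
    lem = solve 8 (λ a b e f g h i k →
      (a ⊗ e ⊕ b ⊗ g) ⊗ i ⊕ (a ⊗ f ⊕ b ⊗ h) ⊗ k ⊜ a ⊗ (e ⊗ i ⊕ f ⊗ k) ⊕ b ⊗ (g ⊗ i ⊕ h ⊗ k)) refl

  det-⊛ : ∀ X Y → det (X ⊛ Y) ≡ det X * det Y
  det-⊛ (mat a b c d) (mat e f g h) = solve 8 (λ a b c d e f g h →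
    (a ⊗ e ⊕ b ⊗ g) ⊗ (c ⊗ f ⊕ d ⊗ h) ⊖ (a ⊗ f ⊕ b ⊗ h) ⊗ (c ⊗ e ⊕ d ⊗ g)
    ⊜ (a ⊗ d ⊖ b ⊗ c) ⊗ (e ⊗ h ⊖ f ⊗ g)) refl a b c d e f g h

  ⊛-identityˡ : ∀ X → 𝟏 ⊛ X ≡ X
  ⊛-identityˡ (mat a b c d) = mat-≡ (lem₁ a c) (lem₁ b d) (lem₂ a c) (lem₂ b d)
    where
    lem₁ = solve 2 (λ x y → # 1 ⊗ x ⊕ # 0 ⊗ y ⊜ x) refl
    lem₂ = solve 2 (λ x y → # 0 ⊗ x ⊕ # 1 ⊗ y ⊜ y) refl

  ⊛-identityʳ : ∀ X → X ⊛ 𝟏 ≡ X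
  ⊛-identityʳ (mat a b c d) = mat-≡ (lem₁ a b) (lem₂ a b) (lem₁ c d) (lem₂ c d)
    where
    lem₁ = solve 2 (λ x y → x ⊗ # 1 ⊕ y ⊗ # 0 ⊜ x) refl
    lem₂ = solve 2 (λ x y → x ⊗ # 0 ⊕ y ⊗ # 1 ⊜ y) refl

  adj-inverseˡ : ∀ {X} → det X ≡ 1# → adj X ⊛ X ≡ 𝟏
  adj-inverseˡ {mat a b c d} eq = mat-≡ (trans (lem₁ a b c d) eq) (lem₂ b d) (lem₃ a c) (trans (lem₄ a b c d) eq)
    where
    lem₁ = solve 4 (λ a b c d → d ⊗ a ⊕ ⊝ b ⊗ c ⊜ a ⊗ d ⊖ b ⊗ c) refl
    lem₂ = solve 2 (λ b d → d ⊗ b ⊕ ⊝ b ⊗ d ⊜ # 0) refl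
    lem₃ = solve 2 (λ a c → ⊝ c ⊗ a ⊕ a ⊗ c ⊜ # 0) refl
    lem₄ = solve 4 (λ a b c d → ⊝ c ⊗ b ⊕ a ⊗ d ⊜ a ⊗ d ⊖ b ⊗ c) refl

  adj-inverseʳ : ∀ {X} → det X ≡ 1# → X ⊛ adj X ≡ 𝟏
  adj-inverseʳ {mat a b c d} eq = mat-≡ (trans (lem₁ a b c d) eq) (lem₂ a b) (lem₃ c d) (trans (lem₄ a b c d) eq)
    where
    lem₁ = solve 4 (λ a b c d → a ⊗ d ⊕ b ⊗ ⊝ c ⊜ a ⊗ d ⊖ b ⊗ c) refl
    lem₂ = solve 2 (λ a b → a ⊗ ⊝ b ⊕ b ⊗ a ⊜ # 0) refl
    lem₃ = solve 2 (λ c d → c ⊗ d ⊕ d ⊗ ⊝ c ⊜ # 0) refl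
    lem₄ = solve 4 (λ a b c d → c ⊗ ⊝ b ⊕ d ⊗ a ⊜ a ⊗ d ⊖ b ⊗ c) refl

  det-𝟏 : det 𝟏 ≡ 1#
  det-𝟏 = solve 0 (# 1 ⊗ # 1 ⊖ # 0 ⊗ # 0 ⊜ # 1) refl

  det-adj : ∀ X → det (adj X) ≡ det X
  det-adj (mat a b c d) = solve 4 (λ a b c d → d ⊗ a ⊖ (⊝ b) ⊗ (⊝ c) ⊜ a ⊗ d ⊖ b ⊗ c) refl a b c d

  -- The proof that the determinant is 1 is irrelevant, so that elements with
  -- equal entries are equal.
  data SL₂ : Set where
    sl : (X : Mat) → .(det X ≡ 1#) → SL₂

  matrix : SL₂ → Mat
  matrix (sl X _) = X

  det≡1 : ∀ g → det (matrix g) ≡ 1#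
  det≡1 (sl X eq) = recompute (det X ≟ 1#) eq

  matrix-injective : ∀ {g h} → matrix g ≡ matrix h → g ≡ h
  matrix-injective {sl _ _} {sl _ _} refl = refl

  infix 4 _≟ᴳ_
  abstract
    _≟ᴳ_ : DecidableEquality SL₂
    g ≟ᴳ h = map′ matrix-injective (cong matrix) (matrix g ≟ᴹ matrix h)

  infixl 7 _∙_
  infix 8 _⁻¹

  abstract

    _∙_ : Op₂ SL₂
    g ∙ h = sl (matrix g ⊛ matrix h) (det-∙ g h)
      where
      det-∙ : ∀ g h → det (matrix g ⊛ matrix h) ≡ 1#
      det-∙ g h = trans (det-⊛ (matrix g) (matrix h)) (trans (cong₂ _*_ (det≡1 g) (det≡1 h))
        (solve 0 (# 1 ⊗ # 1 ⊜ # 1) refl))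

    e : SL₂
    e = sl 𝟏 det-𝟏

    _⁻¹ : Op₁ SL₂
    g ⁻¹ = sl (adj (matrix g)) (trans (det-adj (matrix g)) (det≡1 g))

    matrix-∙ : ∀ g h → matrix (g ∙ h) ≡ matrix g ⊛ matrix h
    matrix-∙ g h = refl

    matrix-e : matrix e ≡ 𝟏
    matrix-e = refl

    matrix-⁻¹ : ∀ g → matrix (g ⁻¹) ≡ adj (matrix g)
    matrix-⁻¹ g = refl

    SL₂-isGroup : IsGroup _≡_ _∙_ e _⁻¹
    SL₂-isGroup = record
      { isMonoid = record
        { isSemigroup = record
          { isMagma = record { isEquivalence = isEquivalence ; ∙-cong = cong₂ _∙_ }
          ; assoc = λ g h k → matrix-injective (⊛-assoc (matrix g) (matrix h) (matrix k)) }
        ; identity = (λ g → matrix-injective (⊛-identityˡ (matrix g)))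
                   , (λ g → matrix-injective (⊛-identityʳ (matrix g))) }
      ; inverse = (λ g → matrix-injective (adj-inverseˡ (det≡1 g)))
                , (λ g → matrix-injective (adj-inverseʳ (det≡1 g)))
      ; ⁻¹-cong = cong _⁻¹
      }

-- Conics, centralisers, conjugates of one element, and traces of rank one matrices

module Geometry (p : ℕ) (p-prime : Prime p) where

  open PrimeField p p-prime
  open SL2 p p-prime
  open Solver using (solve; _⊜_; _⊕_; _⊗_; _⊖_; ⊝_; #_)
  open import Data.Integer.Base using (ℤ) renaming (+_ to pos)

  x*0≡0 : ∀ x → x * 0# ≡ 0#
  x*0≡0 = solve 1 (λ x → x ⊗ # 0 ⊜ # 0) refl

  0*x≡0 : ∀ x → 0# * x ≡ 0#
  0*x≡0 = solve 1 (λ x → # 0 ⊗ x ⊜ # 0) refl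

  -- Certificates of ideal membership: the polynomial identities below write what has to vanish as a
  -- combination of differences `x - y` of sides of hypotheses, and `vanish` and its variants
  -- evaluate the combination to 0.
  vanish : ∀ k {x y} → x ≡ y → k * (x - y) ≡ 0#
  vanish k x≡y = trans (cong (k *_) (x≡y⇒x-y≡0 x≡y)) (x*0≡0 k)

  vanish₂ : ∀ k {x y} l {u v} → x ≡ y → u ≡ v → k * (x - y) + l * (u - v) ≡ 0#
  vanish₂ k l x≡y u≡v = trans (cong₂ _+_ (vanish k x≡y) (vanish l u≡v))
    (solve 0 (# 0 ⊕ # 0 ⊜ # 0) refl)

  vanish₃ : ∀ k {x y} l {u v} m {w z} → x ≡ y → u ≡ v → w ≡ z →
            k * (x - y) + l * (u - v) + m * (w - z) ≡ 0#
  vanish₃ k l m x≡y u≡v w≡z = trans (cong₂ _+_ (vanish₂ k l x≡y u≡v) (vanish m w≡z))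
    (solve 0 (# 0 ⊕ # 0 ⊜ # 0) refl)

  Scalar : Mat → Set
  Scalar (mat a b c d) = b ≡ 0# × c ≡ 0# × a ≡ d

  scalar? : ∀ X → Dec (Scalar X)
  scalar? (mat a b c d) = b ≟ 0# ×-dec c ≟ 0# ×-dec a ≟ d

  scalar-±1 : ∀ {X Y} → det X ≡ 1# → det Y ≡ 1# → Scalar X → Scalar Y → X ≡ Y ⊎ m₁₁ X ≡ - m₁₁ Y
  scalar-±1 {mat a _ _ _} {mat a′ _ _ _} X≡1 Y≡1 (refl , refl , refl) (refl , refl , refl) =
    Sum.map (λ a-a′≡0 → let a≡a′ = x-y≡0⇒x≡y a-a′≡0 in mat-≡ a≡a′ refl refl a≡a′)
            (λ a+a′≡0 → x-y≡0⇒x≡y (trans (lem₁ a a′) a+a′≡0))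
      (x*y≡0 (trans (lem₂ a a′) (vanish 1# (trans X≡1 (sym Y≡1)))))
    where
    lem₁ = solve 2 (λ a b → a ⊖ ⊝ b ⊜ a ⊕ b) refl
    lem₂ = solve 2 (λ a b → (a ⊖ b) ⊗ (a ⊕ b) ⊜
      # 1 ⊗ ((a ⊗ a ⊖ # 0 ⊗ # 0) ⊖ (b ⊗ b ⊖ # 0 ⊗ # 0))) refl

  three-scalars : ∀ {X Y Z} → det X ≡ 1# → det Y ≡ 1# → det Z ≡ 1# → Scalar X → Scalar Y → Scalar Z →
                  X ≡ Y ⊎ X ≡ Z ⊎ Y ≡ Z
  three-scalars X≡1 Y≡1 Z≡1 sX sY@(refl , refl , refl) sZ@(refl , refl , refl)
    with scalar-±1 X≡1 Y≡1 sX sY | scalar-±1 X≡1 Z≡1 sX sZ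
  ... | inj₁ X≡Y  | _         = inj₁ X≡Y
  ... | inj₂ _    | inj₁ X≡Z  = inj₂ (inj₁ X≡Z)
  ... | inj₂ x≡-y | inj₂ x≡-z = inj₂ (inj₂ (mat-≡ y≡z refl refl y≡z))
    where
    y≡z = trans (neg-involutive _) (trans (cong (λ t → - t) (trans (sym x≡-y) x≡-z)) (sym (neg-involutive _)))
      where
      neg-involutive : ∀ x → x ≡ - - x
      neg-involutive = solve 1 (λ x → x ⊜ ⊝ ⊝ x) refl

  -- For X = u g⁻¹ and Y = g g′⁻¹ the product X Y is u g′⁻¹. The conditions hold when u lies in the
  -- translates by g and by g′ of a piece of a conjugacy class of trace τ. Two linear equations cut
  -- a conic out of the quadric det = 1.
  record OnCurve (τ : F) (Y X : Mat) : Set where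
    constructor onCurve
    field
      unimodular : det X ≡ 1#
      trace      : tr X ≡ τ
      traceʸ     : tr (X ⊛ Y) ≡ τ

  OneOfPair : Mat → Mat → Mat → Set
  OneOfPair X₁ X₂ X₃ = X₁ ≡ X₂ ⊎ X₁ ≡ X₃ ⊎ X₂ ≡ X₃

  private
    trace-elim : ∀ {a d τ} → a + d ≡ τ → d ≡ τ - a
    trace-elim {a} {d} refl = solve 2 (λ a d → d ⊜ (a ⊕ d) ⊖ a) refl a d

    module UpperRight {e f g h τ : F} (f≢0 : f ≢ 0#) where

      Y = mat e f g h

      same-a : ∀ {a₁ a₂ b c₁ c₂ d₁ d₂} → OnCurve τ Y (mat a₁ b c₁ d₁) → OnCurve τ Y (mat a₂ b c₂ d₂) →
               a₁ ≡ a₂ → mat a₁ b c₁ d₁ ≡ mat a₂ b c₂ d₂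
      same-a {a} {_} {b} {c₁} {c₂} (onCurve _ t₁ s₁) (onCurve _ t₂ s₂) refl
        with refl ← trans (trace-elim t₁) (sym (trace-elim t₂)) =
        mat-≡ refl refl (*-cancelˡ-≢0 f≢0 (x-y≡0⇒x≡y (trans (lem a b c₁ c₂ _ e f g h)
          (vanish 1# (trans s₁ (sym s₂)))))) refl
        where
        lem = solve 9 (λ a b c₁ c₂ d e f g h → f ⊗ c₁ ⊖ f ⊗ c₂ ⊜
          # 1 ⊗ ((a ⊗ e ⊕ b ⊗ g ⊕ (c₁ ⊗ f ⊕ d ⊗ h)) ⊖ (a ⊗ e ⊕ b ⊗ g ⊕ (c₂ ⊗ f ⊕ d ⊗ h)))) refl

      -- Since f ≠ 0, the equation for tr (X Y) eliminates c, and the determinant becomes a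
      -- quadratic in a with leading coefficient f up to sign. The second alternative is Vieta's
      -- formula for the sum of its roots.
      same-b : ∀ {a₁ a₂ b c₁ c₂ d₁ d₂} → OnCurve τ Y (mat a₁ b c₁ d₁) → OnCurve τ Y (mat a₂ b c₂ d₂) →
               a₁ ≡ a₂ ⊎ f * a₂ ≡ f * (τ - a₁) + b * (e - h)
      same-b {a₁} {a₂} {b} {c₁} {c₂} (onCurve δ₁ t₁ s₁) (onCurve δ₂ t₂ s₂)
        with refl ← trace-elim t₁ | refl ← trace-elim t₂ =
        Sum.map x-y≡0⇒x≡y (sym ∘ x-y≡0⇒x≡y)
          (x*y≡0 (trans (lem τ a₁ a₂ b c₁ c₂ e f g h) (vanish₂ f b (trans δ₁ (sym δ₂)) (trans s₁ (sym s₂)))))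
        where
        lem = solve 10 (λ τ a₁ a₂ b c₁ c₂ e f g h →
          (a₁ ⊖ a₂) ⊗ (f ⊗ (τ ⊖ a₁) ⊕ b ⊗ (e ⊖ h) ⊖ f ⊗ a₂) ⊜
          f ⊗ ((a₁ ⊗ (τ ⊖ a₁) ⊖ b ⊗ c₁) ⊖ (a₂ ⊗ (τ ⊖ a₂) ⊖ b ⊗ c₂)) ⊕
          b ⊗ ((a₁ ⊗ e ⊕ b ⊗ g ⊕ (c₁ ⊗ f ⊕ (τ ⊖ a₁) ⊗ h)) ⊖ (a₂ ⊗ e ⊕ b ⊗ g ⊕ (c₂ ⊗ f ⊕ (τ ⊖ a₂) ⊗ h)))) refl

      three : ∀ {X₁ X₂ X₃} → OnCurve τ Y X₁ → OnCurve τ Y X₂ → OnCurve τ Y X₃ →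
              m₁₂ X₁ ≡ m₁₂ X₂ → m₁₂ X₁ ≡ m₁₂ X₃ → OneOfPair X₁ X₂ X₃
      three {mat _ _ _ _} {mat _ _ _ _} {mat _ _ _ _} o₁ o₂ o₃ refl refl with same-b o₁ o₂ | same-b o₁ o₃
      ... | inj₁ a₁≡a₂ | _          = inj₁ (same-a o₁ o₂ a₁≡a₂)
      ... | inj₂ _     | inj₁ a₁≡a₃ = inj₂ (inj₁ (same-a o₁ o₃ a₁≡a₃))
      ... | inj₂ eq₂   | inj₂ eq₃   = inj₂ (inj₂ (same-a o₂ o₃ (*-cancelˡ-≢0 f≢0 (trans eq₂ (sym eq₃)))))

    module Diagonal {e h τ : F} (e≢h : e ≢ h) where

      Y = mat e 0# 0# h

      same-a : ∀ {a₁ a₂ b₁ b₂ c₁ c₂ d₁ d₂} → OnCurve τ Y (mat a₁ b₁ c₁ d₁) → OnCurve τ Y (mat a₂ b₂ c₂ d₂) →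
               a₁ ≡ a₂
      same-a {a₁} {a₂} {b₁} {b₂} {c₁} {c₂} (onCurve _ t₁ s₁) (onCurve _ t₂ s₂)
        with refl ← trace-elim t₁ | refl ← trace-elim t₂ =
        *-cancelˡ-≢0 (e≢h ∘ x-y≡0⇒x≡y) (x-y≡0⇒x≡y (trans (lem τ a₁ a₂ b₁ b₂ c₁ c₂ e h)
          (vanish 1# (trans s₁ (sym s₂)))))
        where
        lem = solve 9 (λ τ a₁ a₂ b₁ b₂ c₁ c₂ e h → (e ⊖ h) ⊗ a₁ ⊖ (e ⊖ h) ⊗ a₂ ⊜
          # 1 ⊗ ((a₁ ⊗ e ⊕ b₁ ⊗ # 0 ⊕ (c₁ ⊗ # 0 ⊕ (τ ⊖ a₁) ⊗ h)) ⊖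
                       (a₂ ⊗ e ⊕ b₂ ⊗ # 0 ⊕ (c₂ ⊗ # 0 ⊕ (τ ⊖ a₂) ⊗ h)))) refl

      -- As a and d are fixed by `same-a`, the determinant fixes b c, so b and c are the roots of a
      -- quadratic once their sum is given. The coordinate b alone could not serve as key: if the
      -- product is 0, all c are possible on b = 0.
      two : ∀ {a₁ a₂ b₁ b₂ c₁ c₂ d₁ d₂} → OnCurve τ Y (mat a₁ b₁ c₁ d₁) → OnCurve τ Y (mat a₂ b₂ c₂ d₂) →
            b₁ + c₁ ≡ b₂ + c₂ → b₁ ≡ b₂ ⊎ c₂ ≡ b₁
      two {a₁} {a₂} {b₁} {b₂} {c₁} {c₂} o₁@(onCurve δ₁ t₁ s₁) o₂@(onCurve δ₂ t₂ s₂) k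
        with refl ← same-a o₁ o₂
        with refl ← trans (trace-elim t₁) (sym (trace-elim t₂)) =
        Sum.map x-y≡0⇒x≡y x-y≡0⇒x≡y (x*y≡0 (trans (lem a₁ b₁ b₂ c₁ c₂ _)
          (vanish₂ b₁ 1# (sym k) (trans δ₂ (sym δ₁)))))
        where
        lem = solve 6 (λ a b₁ b₂ c₁ c₂ d → (b₁ ⊖ b₂) ⊗ (c₂ ⊖ b₁) ⊜
              b₁ ⊗ ((b₂ ⊕ c₂) ⊖ (b₁ ⊕ c₁)) ⊕ # 1 ⊗ ((a ⊗ d ⊖ b₂ ⊗ c₂) ⊖ (a ⊗ d ⊖ b₁ ⊗ c₁))) refl

      +-cancelˡ : ∀ {x y z} → x + y ≡ x + z → y ≡ z
      +-cancelˡ {x} {y} {z} eq = x-y≡0⇒x≡y (trans (lem x y z) (vanish 1# eq))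
        where
        lem = solve 3 (λ x y z → y ⊖ z ⊜ # 1 ⊗ ((x ⊕ y) ⊖ (x ⊕ z))) refl

      +-cancelʳ : ∀ {x y z} → y + x ≡ z + x → y ≡ z
      +-cancelʳ {x} {y} {z} eq = x-y≡0⇒x≡y (trans (lem x y z) (vanish 1# eq))
        where
        lem = solve 3 (λ x y z → y ⊖ z ⊜ # 1 ⊗ ((y ⊕ x) ⊖ (z ⊕ x))) refl

      equal : ∀ {a₁ a₂ b₁ b₂ c₁ c₂ d₁ d₂} → OnCurve τ Y (mat a₁ b₁ c₁ d₁) → OnCurve τ Y (mat a₂ b₂ c₂ d₂) →
              b₁ + c₁ ≡ b₂ + c₂ → b₁ ≡ b₂ → mat a₁ b₁ c₁ d₁ ≡ mat a₂ b₂ c₂ d₂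
      equal o₁@(onCurve _ t₁ _) o₂@(onCurve _ t₂ _) k refl with refl ← same-a o₁ o₂ =
        mat-≡ refl refl (+-cancelˡ k) (trans (trace-elim t₁) (sym (trace-elim t₂)))

      three : ∀ {X₁ X₂ X₃} → OnCurve τ Y X₁ → OnCurve τ Y X₂ → OnCurve τ Y X₃ →
              m₁₂ X₁ + m₂₁ X₁ ≡ m₁₂ X₂ + m₂₁ X₂ → m₁₂ X₁ + m₂₁ X₁ ≡ m₁₂ X₃ + m₂₁ X₃ → OneOfPair X₁ X₂ X₃
      three {mat _ _ _ _} {mat _ _ _ _} {mat _ _ _ _} o₁ o₂ o₃ k₂ k₃ with two o₁ o₂ k₂ | two o₁ o₃ k₃
      ... | inj₁ b₁≡b₂ | _          = inj₁ (equal o₁ o₂ k₂ b₁≡b₂)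
      ... | inj₂ _     | inj₁ b₁≡b₃ = inj₂ (inj₁ (equal o₁ o₃ k₃ b₁≡b₃))
      ... | inj₂ refl  | inj₂ refl  = inj₂ (inj₂ (equal o₂ o₃ (trans (sym k₂) k₃) (+-cancelʳ (trans (sym k₂) k₃))))

    transpose : Mat → Mat
    transpose (mat a b c d) = mat a c b d

    transpose-curve : ∀ {τ Y X} → OnCurve τ Y X → OnCurve τ (transpose Y) (transpose X)
    transpose-curve {Y = mat e f g h} {mat a b c d} (onCurve δ t s) =
      onCurve (trans (lem₁ a b c d) δ) t (trans (lem₂ a b c d e f g h) s)
      where
      lem₁ = solve 4 (λ a b c d → a ⊗ d ⊖ c ⊗ b ⊜ a ⊗ d ⊖ b ⊗ c) refl
      lem₂ = solve 8 (λ a b c d e f g h →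
        (a ⊗ e ⊕ c ⊗ f) ⊕ (b ⊗ g ⊕ d ⊗ h) ⊜ (a ⊗ e ⊕ b ⊗ g) ⊕ (c ⊗ f ⊕ d ⊗ h)) refl

  -- A coordinate that takes each of its p values at most twice on the conic, hence the bound 2p on
  -- its points. Which coordinate works depends on which of f, g, e - h is nonzero; the case of g is
  -- that of f transposed.
  curve-key : ∀ Y → ¬ Scalar Y → ∃ λ (key : Mat → F) → ∀ {τ X₁ X₂ X₃} →
              OnCurve τ Y X₁ → OnCurve τ Y X₂ → OnCurve τ Y X₃ →
              key X₁ ≡ key X₂ → key X₁ ≡ key X₃ → OneOfPair X₁ X₂ X₃
  curve-key (mat e f g h) ¬scalar with f ≟ 0# | g ≟ 0# | e ≟ h
  ... | no f≢0   | _        | _       = m₁₂ , UpperRight.three f≢0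
  ... | yes refl | no g≢0   | _       = m₂₁ , λ {τ} {X₁} {X₂} {X₃} o₁ o₂ o₃ k₂ k₃ →
    Sum.map untranspose (Sum.map untranspose untranspose)
      (UpperRight.three {e} {g} {0#} {h} g≢0 {transpose X₁} {transpose X₂} {transpose X₃}
        (transpose-curve o₁) (transpose-curve o₂) (transpose-curve o₃) k₂ k₃)
    where
    untranspose : ∀ {X Y} → transpose X ≡ transpose Y → X ≡ Y
    untranspose eq = cong transpose eq
  ... | yes refl | yes refl | no e≢h  = (λ X → m₁₂ X + m₂₁ X) , Diagonal.three e≢h
  ... | yes refl | yes refl | yes e≡h = contradiction (refl , refl , e≡h) ¬scalar

  Vec₃ : Set
  Vec₃ = F × F × F

  -- The traceless part of a matrix, up to a factor of 2.
  axis : Mat → Vec₃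
  axis (mat a b c d) = a - d , b , c

  infix 4 _∥_
  -- The cross product vanishes. The zero vector is parallel to every vector, just as scalar
  -- matrices commute with every matrix.
  _∥_ : Vec₃ → Vec₃ → Set
  (u₁ , u₂ , u₃) ∥ (v₁ , v₂ , v₃) = u₁ * v₂ ≡ u₂ * v₁ × u₁ * v₃ ≡ u₃ * v₁ × u₂ * v₃ ≡ u₃ * v₂

  private
    module _ where
      cross : ∀ {wₖ wᵢ wⱼ uₖ uᵢ uⱼ vₖ vᵢ vⱼ} → wₖ ≢ 0# → uₖ * wᵢ ≡ uᵢ * wₖ → uₖ * wⱼ ≡ uⱼ * wₖ →
              vₖ * wᵢ ≡ vᵢ * wₖ → vₖ * wⱼ ≡ vⱼ * wₖ → uᵢ * vⱼ ≡ uⱼ * vᵢ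
      cross {wₖ} {wᵢ} {wⱼ} {uₖ} {uᵢ} {uⱼ} {vₖ} {vᵢ} {vⱼ} wₖ≢0 uᵢ≡ uⱼ≡ vᵢ≡ vⱼ≡ =
        *-cancelˡ-≢0 wₖ≢0 (*-cancelˡ-≢0 wₖ≢0 (begin
          wₖ * (wₖ * (uᵢ * vⱼ))       ≡⟨ lem₁ wₖ uᵢ vⱼ ⟩
          (uᵢ * wₖ) * (vⱼ * wₖ)       ≡⟨ cong₂ _*_ (sym uᵢ≡) (sym vⱼ≡) ⟩
          (uₖ * wᵢ) * (vₖ * wⱼ)       ≡⟨ lem₂ uₖ vₖ wᵢ wⱼ ⟩
          (uₖ * wⱼ) * (vₖ * wᵢ)       ≡⟨ cong₂ _*_ uⱼ≡ vᵢ≡ ⟩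
          (uⱼ * wₖ) * (vᵢ * wₖ)       ≡⟨ lem₁ wₖ uⱼ vᵢ ⟨
          wₖ * (wₖ * (uⱼ * vᵢ))       ∎))
        where
        open ≡-Reasoning
        lem₁ = solve 3 (λ w u v → w ⊗ (w ⊗ (u ⊗ v)) ⊜ (u ⊗ w) ⊗ (v ⊗ w)) refl
        lem₂ = solve 4 (λ u v w x → (u ⊗ w) ⊗ (v ⊗ x) ⊜ (u ⊗ x) ⊗ (v ⊗ w)) refl

  ∥-trans : ∀ {u w v} → w ≢ (0# , 0# , 0#) → u ∥ w → v ∥ w → u ∥ v
  ∥-trans {u₁ , u₂ , u₃} {w₁ , w₂ , w₃} {v₁ , v₂ , v₃} w≢0 (u₁₂ , u₁₃ , u₂₃) (v₁₂ , v₁₃ , v₂₃)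
    with w₁ ≟ 0# | w₂ ≟ 0# | w₃ ≟ 0#
  ... | no w₁≢0  | _        | _        = cross w₁≢0 refl u₁₂ refl v₁₂
                                       , cross w₁≢0 refl u₁₃ refl v₁₃
                                       , cross w₁≢0 u₁₂ u₁₃ v₁₂ v₁₃
  ... | yes _    | no w₂≢0  | _        = cross w₂≢0 (sym u₁₂) refl (sym v₁₂) refl
                                       , cross w₂≢0 (sym u₁₂) u₂₃ (sym v₁₂) v₂₃
                                       , cross w₂≢0 refl u₂₃ refl v₂₃
  ... | yes _    | yes _    | no w₃≢0  = cross w₃≢0 (sym u₁₃) (sym u₂₃) (sym v₁₃) (sym v₂₃)
                                       , cross w₃≢0 (sym u₁₃) refl (sym v₁₃) refl
                                       , cross w₃≢0 (sym u₂₃) refl (sym v₂₃) refl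
  ... | yes refl | yes refl | yes refl = contradiction refl w≢0

  axis-scalar : ∀ X → axis X ≡ (0# , 0# , 0#) → Scalar X
  axis-scalar (mat a b c d) eq =
    cong (proj₁ ∘ proj₂) eq , cong (proj₂ ∘ proj₂) eq , x-y≡0⇒x≡y (cong proj₁ eq)

  Commute : Mat → Mat → Set
  Commute X Y = X ⊛ Y ≡ Y ⊛ X

  commute⇒∥ : ∀ {X Y} → Commute X Y → axis X ∥ axis Y
  commute⇒∥ {mat a b c d} {mat e f g h} eq =
    x-y≡0⇒x≡y (trans (lem₁ a b c d e f g h) (vanish 1# (cong m₁₂ eq))) ,
    x-y≡0⇒x≡y (trans (lem₂ a b c d e f g h) (vanish 1# (cong m₂₁ (sym eq)))) ,
    x-y≡0⇒x≡y (trans (lem₃ a b c e f g) (vanish 1# (cong m₁₁ eq)))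
    where
    lem₁ = solve 8 (λ a b c d e f g h → (a ⊖ d) ⊗ f ⊖ b ⊗ (e ⊖ h) ⊜
      # 1 ⊗ ((a ⊗ f ⊕ b ⊗ h) ⊖ (e ⊗ b ⊕ f ⊗ d))) refl
    lem₂ = solve 8 (λ a b c d e f g h → (a ⊖ d) ⊗ g ⊖ c ⊗ (e ⊖ h) ⊜
      # 1 ⊗ ((g ⊗ a ⊕ h ⊗ c) ⊖ (c ⊗ e ⊕ d ⊗ g))) refl
    lem₃ = solve 6 (λ a b c e f g → b ⊗ g ⊖ c ⊗ f ⊜
      # 1 ⊗ ((a ⊗ e ⊕ b ⊗ g) ⊖ (e ⊗ a ⊕ f ⊗ c))) refl

  ∥⇒commute : ∀ {X Y} → axis X ∥ axis Y → Commute X Y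
  ∥⇒commute {mat a b c d} {mat e f g h} (eq₁ , eq₂ , eq₃) = mat-≡
    (x-y≡0⇒x≡y (trans (lem₁₁ a b c e f g) (vanish 1# eq₃)))
    (x-y≡0⇒x≡y (trans (lem₁₂ a b d e f h) (vanish 1# eq₁)))
    (x-y≡0⇒x≡y (trans (lem₂₁ a c d e g h) (vanish 1# (sym eq₂))))
    (x-y≡0⇒x≡y (trans (lem₂₂ b c d f g h) (vanish 1# (sym eq₃))))
    where
    lem₁₁ = solve 6 (λ a b c e f g → (a ⊗ e ⊕ b ⊗ g) ⊖ (e ⊗ a ⊕ f ⊗ c) ⊜
      # 1 ⊗ (b ⊗ g ⊖ c ⊗ f)) refl
    lem₁₂ = solve 6 (λ a b d e f h → (a ⊗ f ⊕ b ⊗ h) ⊖ (e ⊗ b ⊕ f ⊗ d) ⊜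
      # 1 ⊗ ((a ⊖ d) ⊗ f ⊖ b ⊗ (e ⊖ h))) refl
    lem₂₁ = solve 6 (λ a c d e g h → (c ⊗ e ⊕ d ⊗ g) ⊖ (g ⊗ a ⊕ h ⊗ c) ⊜
      # 1 ⊗ (c ⊗ (e ⊖ h) ⊖ (a ⊖ d) ⊗ g)) refl
    lem₂₂ = solve 6 (λ b c d f g h → (c ⊗ f ⊕ d ⊗ h) ⊖ (g ⊗ b ⊕ h ⊗ d) ⊜
      # 1 ⊗ (c ⊗ f ⊖ b ⊗ g)) refl

  -- The centraliser of a nonscalar matrix is commutative: its members have axes parallel to a
  -- nonzero axis, and parallelism is transitive through a nonzero vector.
  commute-trans : ∀ {X Y Z} → ¬ Scalar Z → Commute X Z → Commute Y Z → Commute X Y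
  commute-trans {X} {Y} {Z} ¬sZ XZ YZ =
    ∥⇒commute (∥-trans (¬sZ ∘ axis-scalar Z) (commute⇒∥ XZ) (commute⇒∥ YZ))

  scalar-commute : ∀ {X} Y → Scalar X → Commute X Y
  scalar-commute {mat a _ _ _} Y (refl , refl , refl) = ∥⇒commute (zero∥ a (axis Y))
    where
    lem = solve 3 (λ a v w → (a ⊖ a) ⊗ v ⊜ # 0 ⊗ w) refl
    zero∥ : ∀ a v → (a - a , 0# , 0#) ∥ v
    zero∥ a (v₁ , v₂ , v₃) = lem a v₂ v₁ , lem a v₃ v₁ , trans (0*x≡0 v₃) (sym (0*x≡0 v₂))

  module _ (2≢0 : 2# ≢ 0#) (5≢0 : 5# ≢ 0#) where

    private
      -- For parallel u and v of norm 5 the polar form takes the value ± 5 and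
      -- scales v to 5 u.
      norm : Vec₃ → F
      norm (u₁ , u₂ , u₃) = u₁ * u₁ + 2# * (2# * (u₂ * u₃))

      polar : Vec₃ → Vec₃ → F
      polar (u₁ , u₂ , u₃) (v₁ , v₂ , v₃) = u₁ * v₁ + 2# * (u₂ * v₃ + u₃ * v₂)

      -- This norm is the discriminant tr² - 4 det, here 9 - 4. It is the origin of the condition 5
      -- ≠ 0.
      norm-axis : ∀ {X} → det X ≡ 1# → tr X ≡ ⟦ pos 3 ⟧ → norm (axis X) ≡ 5#
      norm-axis {mat a b c d} δ t = x-y≡0⇒x≡y (trans (lem a b c d)
        (vanish₂ ((a + d) + ⟦ pos 3 ⟧) (- ⟦ pos 4 ⟧) t δ))
        where
        lem = solve 4 (λ a b c d → (a ⊖ d) ⊗ (a ⊖ d) ⊕ # 2 ⊗ (# 2 ⊗ (b ⊗ c)) ⊖ # 5 ⊜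
          ((a ⊕ d) ⊕ # 3) ⊗ ((a ⊕ d) ⊖ # 3) ⊕ (⊝ # 4) ⊗ ((a ⊗ d ⊖ b ⊗ c) ⊖ # 1)) refl

      polar-scale : ∀ u v → u ∥ v → norm v ≡ 5# →
                    let (u₁ , u₂ , u₃) = u ; (v₁ , v₂ , v₃) = v in
                    polar u v * v₁ ≡ 5# * u₁ × polar u v * v₂ ≡ 5# * u₂ × polar u v * v₃ ≡ 5# * u₃
      polar-scale (u₁ , u₂ , u₃) (v₁ , v₂ , v₃) (p₁₂ , p₁₃ , p₂₃) q =
        x-y≡0⇒x≡y (trans (lem₁ u₁ u₂ u₃ v₁ v₂ v₃) (vanish₃ u₁ (- (2# * v₃)) (- (2# * v₂)) q p₁₂ p₁₃)) ,
        x-y≡0⇒x≡y (trans (lem₂ u₁ u₂ u₃ v₁ v₂ v₃) (vanish₃ u₂ v₁ (- (2# * v₂)) q p₁₂ p₂₃)) ,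
        x-y≡0⇒x≡y (trans (lem₃ u₁ u₂ u₃ v₁ v₂ v₃) (vanish₃ u₃ v₁ (2# * v₃) q p₁₃ p₂₃))
        where
        lem₁ = solve 6 (λ u₁ u₂ u₃ v₁ v₂ v₃ →
               (u₁ ⊗ v₁ ⊕ # 2 ⊗ (u₂ ⊗ v₃ ⊕ u₃ ⊗ v₂)) ⊗ v₁ ⊖ # 5 ⊗ u₁ ⊜
               u₁ ⊗ ((v₁ ⊗ v₁ ⊕ # 2 ⊗ (# 2 ⊗ (v₂ ⊗ v₃))) ⊖ # 5)
                 ⊕ (⊝ (# 2 ⊗ v₃)) ⊗ (u₁ ⊗ v₂ ⊖ u₂ ⊗ v₁)
                 ⊕ (⊝ (# 2 ⊗ v₂)) ⊗ (u₁ ⊗ v₃ ⊖ u₃ ⊗ v₁)) refl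
        lem₂ = solve 6 (λ u₁ u₂ u₃ v₁ v₂ v₃ →
               (u₁ ⊗ v₁ ⊕ # 2 ⊗ (u₂ ⊗ v₃ ⊕ u₃ ⊗ v₂)) ⊗ v₂ ⊖ # 5 ⊗ u₂ ⊜
               u₂ ⊗ ((v₁ ⊗ v₁ ⊕ # 2 ⊗ (# 2 ⊗ (v₂ ⊗ v₃))) ⊖ # 5)
                 ⊕ v₁ ⊗ (u₁ ⊗ v₂ ⊖ u₂ ⊗ v₁)
                 ⊕ (⊝ (# 2 ⊗ v₂)) ⊗ (u₂ ⊗ v₃ ⊖ u₃ ⊗ v₂)) refl
        lem₃ = solve 6 (λ u₁ u₂ u₃ v₁ v₂ v₃ →
               (u₁ ⊗ v₁ ⊕ # 2 ⊗ (u₂ ⊗ v₃ ⊕ u₃ ⊗ v₂)) ⊗ v₃ ⊖ # 5 ⊗ u₃ ⊜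
               u₃ ⊗ ((v₁ ⊗ v₁ ⊕ # 2 ⊗ (# 2 ⊗ (v₂ ⊗ v₃))) ⊖ # 5)
                 ⊕ v₁ ⊗ (u₁ ⊗ v₃ ⊖ u₃ ⊗ v₁)
                 ⊕ (# 2 ⊗ v₃) ⊗ (u₂ ⊗ v₃ ⊖ u₃ ⊗ v₂)) refl

      polar-square : ∀ u v → u ∥ v → norm u ≡ 5# → norm v ≡ 5# → polar u v ≡ 5# ⊎ polar u v ≡ - 5#
      polar-square u@(u₁ , u₂ , u₃) v@(v₁ , v₂ , v₃) u∥v qu qv =
        Sum.map x-y≡0⇒x≡y (x-y≡0⇒x≡y ∘ trans (lem₃ B)) (x*y≡0 (begin
          (B - 5#) * (B + 5#)
            ≡⟨ lem₁ u₁ u₂ u₃ v₁ v₂ v₃ ⟩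
          u₁ * (B * v₁) + 2# * (u₂ * (B * v₃) + u₃ * (B * v₂)) - 5# * 5#
            ≡⟨ cong₂ (λ s t → u₁ * s + 2# * t - 5# * 5#) s₁ (cong₂ (λ s t → u₂ * s + u₃ * t) s₃ s₂) ⟩
          u₁ * (5# * u₁) + 2# * (u₂ * (5# * u₃) + u₃ * (5# * u₂)) - 5# * 5#
            ≡⟨ lem₂ u₁ u₂ u₃ ⟩
          5# * (norm u - 5#)
            ≡⟨ vanish 5# qu ⟩
          0# ∎))
        where
        open ≡-Reasoning
        B = polar u v
        s₁ = proj₁ (polar-scale u v u∥v qv)
        s₂ = proj₁ (proj₂ (polar-scale u v u∥v qv))
        s₃ = proj₂ (proj₂ (polar-scale u v u∥v qv))
        lem₁ = solve 6 (λ u₁ u₂ u₃ v₁ v₂ v₃ → let B = u₁ ⊗ v₁ ⊕ # 2 ⊗ (u₂ ⊗ v₃ ⊕ u₃ ⊗ v₂) in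
               (B ⊖ # 5) ⊗ (B ⊕ # 5) ⊜
               u₁ ⊗ (B ⊗ v₁) ⊕ # 2 ⊗ (u₂ ⊗ (B ⊗ v₃) ⊕ u₃ ⊗ (B ⊗ v₂)) ⊖ # 5 ⊗ # 5) refl
        lem₂ = solve 3 (λ u₁ u₂ u₃ →
               u₁ ⊗ (# 5 ⊗ u₁) ⊕ # 2 ⊗ (u₂ ⊗ (# 5 ⊗ u₃) ⊕ u₃ ⊗ (# 5 ⊗ u₂)) ⊖ # 5 ⊗ # 5
               ⊜ # 5 ⊗ ((u₁ ⊗ u₁ ⊕ # 2 ⊗ (# 2 ⊗ (u₂ ⊗ u₃))) ⊖ # 5)) refl
        lem₃ = solve 1 (λ x → x ⊖ ⊝ # 5 ⊜ x ⊕ # 5) refl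

      scale-cancel : ∀ {u v : Vec₃} (k : F) → k ≢ 0# → let (u₁ , u₂ , u₃) = u ; (v₁ , v₂ , v₃) = v in
                     k * u₁ ≡ k * v₁ × k * u₂ ≡ k * v₂ × k * u₃ ≡ k * v₃ → u ≡ v
      scale-cancel k k≢0 (e₁ , e₂ , e₃) =
        cong₂ _,_ (*-cancelˡ-≢0 k≢0 e₁) (cong₂ _,_ (*-cancelˡ-≢0 k≢0 e₂) (*-cancelˡ-≢0 k≢0 e₃))

      axis-injective : ∀ {X Y} → tr X ≡ tr Y → axis X ≡ axis Y → X ≡ Y
      axis-injective {mat a b c d} {mat a′ b′ c′ d′} t eq =
        mat-≡ (*-cancelˡ-≢0 2≢0 2a≡2a′) (cong (proj₁ ∘ proj₂) eq) (cong (proj₂ ∘ proj₂) eq)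
              (*-cancelˡ-≢0 2≢0 2d≡2d′)
        where
        lem₁ = solve 2 (λ a d → # 2 ⊗ a ⊜ (a ⊕ d) ⊕ (a ⊖ d)) refl
        lem₂ = solve 2 (λ a d → # 2 ⊗ d ⊜ (a ⊕ d) ⊖ (a ⊖ d)) refl
        2a≡2a′ = trans (lem₁ a d) (trans (cong₂ _+_ t (cong proj₁ eq)) (sym (lem₁ a′ d′)))
        2d≡2d′ = trans (lem₂ a d) (trans (cong₂ _-_ t (cong proj₁ eq)) (sym (lem₂ a′ d′)))

      -5≢0 : - 5# ≢ 0#
      -5≢0 eq = 5≢0 (trans lem (trans (cong (λ x → - x) eq) (solve 0 (⊝ # 0 ⊜ # 0) refl)))
        where
        lem = solve 0 (# 5 ⊜ ⊝ ⊝ # 5) refl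

    -- Two commuting matrices of trace 3 are equal or have opposite axes.
    three-commuting : ∀ {X₁ X₂ X₃ Z} → ¬ Scalar Z →
      det X₁ ≡ 1# → det X₂ ≡ 1# → det X₃ ≡ 1# →
      tr X₁ ≡ ⟦ pos 3 ⟧ → tr X₂ ≡ ⟦ pos 3 ⟧ → tr X₃ ≡ ⟦ pos 3 ⟧ →
      Commute X₁ Z → Commute X₂ Z → Commute X₃ Z → OneOfPair X₁ X₂ X₃
    three-commuting {X₁} {X₂} {X₃} ¬sZ δ₁ δ₂ δ₃ t₁ t₂ t₃ c₁ c₂ c₃ =
      cases (polar-square (axis X₁) (axis X₂) ∥₂ q₁ q₂) (polar-square (axis X₁) (axis X₃) ∥₃ q₁ q₃)
      where
      q₁ = norm-axis {X₁} δ₁ t₁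
      q₂ = norm-axis {X₂} δ₂ t₂
      q₃ = norm-axis {X₃} δ₃ t₃
      ∥₂ : axis X₁ ∥ axis X₂
      ∥₂ = commute⇒∥ (commute-trans ¬sZ c₁ c₂)
      ∥₃ : axis X₁ ∥ axis X₃
      ∥₃ = commute⇒∥ (commute-trans ¬sZ c₁ c₃)

      equal : ∀ {Y} → tr Y ≡ ⟦ pos 3 ⟧ → axis X₁ ∥ axis Y → norm (axis Y) ≡ 5# →
              polar (axis X₁) (axis Y) ≡ 5# → X₁ ≡ Y
      equal {Y} t ∥Y qY B≡5 = sym (axis-injective (trans t (sym t₁)) (scale-cancel 5# 5≢0
        (subst (λ B → B * proj₁ v ≡ _ × B * proj₁ (proj₂ v) ≡ _ × B * proj₂ (proj₂ v) ≡ _) B≡5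
          (polar-scale (axis X₁) v ∥Y qY))))
        where
        v = axis Y

      both : ∀ {B C k v₁ v₂ v₃ w₁ w₂ w₃ u₁ u₂ u₃} → B ≡ k → C ≡ k →
             B * v₁ ≡ u₁ × B * v₂ ≡ u₂ × B * v₃ ≡ u₃ → C * w₁ ≡ u₁ × C * w₂ ≡ u₂ × C * w₃ ≡ u₃ →
             k * v₁ ≡ k * w₁ × k * v₂ ≡ k * w₂ × k * v₃ ≡ k * w₃
      both refl refl (a₁ , a₂ , a₃) (b₁ , b₂ , b₃) =
        trans a₁ (sym b₁) , trans a₂ (sym b₂) , trans a₃ (sym b₃)

      cases : polar (axis X₁) (axis X₂) ≡ 5# ⊎ polar (axis X₁) (axis X₂) ≡ - 5# →
              polar (axis X₁) (axis X₃) ≡ 5# ⊎ polar (axis X₁) (axis X₃) ≡ - 5# →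
              OneOfPair X₁ X₂ X₃
      cases (inj₁ B≡5) _          = inj₁ (equal t₂ ∥₂ q₂ B≡5)
      cases (inj₂ _)   (inj₁ B≡5) = inj₂ (inj₁ (equal t₃ ∥₃ q₃ B≡5))
      cases (inj₂ B₂)  (inj₂ B₃)  = inj₂ (inj₂ (axis-injective (trans t₂ (sym t₃))
        (scale-cancel (- 5#) -5≢0 (both B₂ B₃ (polar-scale (axis X₁) (axis X₂) ∥₂ q₂)
                                              (polar-scale (axis X₁) (axis X₃) ∥₃ q₃)))))

  abstract
    det-U : ∀ i → det (mat 1# i 0# 1#) ≡ 1#
    det-U = solve 1 (λ i → # 1 ⊗ # 1 ⊖ i ⊗ # 0 ⊜ # 1) refl

    det-L : ∀ j → det (mat 1# 0# j 1#) ≡ 1#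
    det-L = solve 1 (λ j → # 1 ⊗ # 1 ⊖ # 0 ⊗ j ⊜ # 1) refl

    det-g₀ : det (mat 1# 1# 1# 2#) ≡ 1#
    det-g₀ = solve 0 (# 1 ⊗ # 2 ⊖ # 1 ⊗ # 1 ⊜ # 1) refl

  U L : F → SL₂
  U i = sl (mat 1# i 0# 1#) (det-U i)
  L j = sl (mat 1# 0# j 1#) (det-L j)

  g₀ : SL₂
  g₀ = sl (mat 1# 1# 1# 2#) det-g₀

  U-0 : U 0# ≡ e
  U-0 = matrix-injective (sym matrix-e)

  L-0 : L 0# ≡ e
  L-0 = matrix-injective (sym matrix-e)

  U-+1 : ∀ i → U (i + 1#) ≡ U 1# ∙ U i
  U-+1 i = matrix-injective (trans (mat-≡ (lem₁ 1#) (lem₂ i) lem₃ (lem₄ i)) (sym (matrix-∙ (U 1#) (U i))))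
    where
    lem₁ = solve 1 (λ i → # 1 ⊜ # 1 ⊗ # 1 ⊕ i ⊗ # 0) refl
    lem₂ = solve 1 (λ i → i ⊕ # 1 ⊜ # 1 ⊗ i ⊕ # 1 ⊗ # 1) refl
    lem₃ = solve 0 (# 0 ⊜ # 0 ⊗ # 1 ⊕ # 1 ⊗ # 0) refl
    lem₄ = solve 1 (λ i → # 1 ⊜ # 0 ⊗ i ⊕ # 1 ⊗ # 1) refl

  L-+1 : ∀ j → L (j + 1#) ≡ L 1# ∙ L j
  L-+1 j = matrix-injective (trans (mat-≡ (lem₁ j) lem₃ (lem₂ j) (lem₄ 1#)) (sym (matrix-∙ (L 1#) (L j))))
    where
    lem₁ = solve 1 (λ j → # 1 ⊜ # 1 ⊗ # 1 ⊕ # 0 ⊗ j) refl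
    lem₂ = solve 1 (λ j → j ⊕ # 1 ⊜ # 1 ⊗ # 1 ⊕ # 1 ⊗ j) refl
    lem₃ = solve 0 (# 0 ⊜ # 1 ⊗ # 0 ⊕ # 0 ⊗ # 1) refl
    lem₄ = solve 1 (λ i → # 1 ⊜ i ⊗ # 0 ⊕ # 1 ⊗ # 1) refl

  conjugate : SL₂ → SL₂ → SL₂
  conjugate x g = (x ∙ g) ∙ x ⁻¹

  matrix-conjugate : ∀ x y g → matrix (conjugate (x ∙ y) g) ≡
    ((matrix x ⊛ matrix y) ⊛ matrix g) ⊛ adj (matrix x ⊛ matrix y)
  matrix-conjugate x y g = trans (matrix-∙ ((x ∙ y) ∙ g) ((x ∙ y) ⁻¹)) (cong₂ _⊛_
    (trans (matrix-∙ (x ∙ y) g) (cong (_⊛ matrix g) (matrix-∙ x y)))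
    (trans (matrix-⁻¹ (x ∙ y)) (cong adj (matrix-∙ x y))))

  -- Two parameters, since a conjugacy class is a surface with about p² points. Conjugation by
  -- `U i ∙ L j` keeps the entries explicit polynomials, from which each value is seen to occur at
  -- most twice.
  family : F × F → SL₂
  family (i , j) = conjugate (U i ∙ L j) g₀

  private
    c-entry : F → F
    c-entry j = 1# - j - j * j

    family-entries : F × F → Mat
    family-entries (i , j) = mat
      (1# - j + i * c-entry j) (1# + i * (1# + 2# * j) - i * i * c-entry j)
      (c-entry j) (j + 2# - i * c-entry j)

    family-matrix : ∀ ij → matrix (family ij) ≡ family-entries ij
    family-matrix (i , j) = trans (matrix-conjugate (U i) (L j) g₀) (mat-≡
      (solve 2 (λ i j → proj₁ (product i j) ⊜ # 1 ⊖ j ⊕ i ⊗ c j) refl i j)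
      (solve 2 (λ i j → proj₁ (proj₂ (product i j)) ⊜
          # 1 ⊕ i ⊗ (# 1 ⊕ # 2 ⊗ j) ⊖ i ⊗ i ⊗ c j) refl i j)
      (solve 2 (λ i j → proj₁ (proj₂ (proj₂ (product i j))) ⊜ c j) refl i j)
      (solve 2 (λ i j → proj₂ (proj₂ (proj₂ (product i j))) ⊜ j ⊕ # 2 ⊖ i ⊗ c j) refl i j))
      where
      E = Solver.Expr ℤ 2
      infixl 7 _⊗ᴹ_
      _⊗ᴹ_ : E × E × E × E → E × E × E × E → E × E × E × E
      (a , b , c , d) ⊗ᴹ (e , f , g , h) =
        (a ⊗ e ⊕ b ⊗ g) , (a ⊗ f ⊕ b ⊗ h) , (c ⊗ e ⊕ d ⊗ g) , (c ⊗ f ⊕ d ⊗ h)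
      adjᴱ : E × E × E × E → E × E × E × E
      adjᴱ (a , b , c , d) = d , (⊝ b) , (⊝ c) , a
      one zer : E
      one = # 1
      zer = # 0
      c : E → E
      c j = one ⊖ j ⊖ j ⊗ j
      product : E → E → E × E × E × E
      product i j = ((one , i , zer , one) ⊗ᴹ (one , zer , j , one)) ⊗ᴹ (one , one , one , # 2)
                    ⊗ᴹ adjᴱ ((one , i , zer , one) ⊗ᴹ (one , zer , j , one))

  tr-family : ∀ ij → tr (matrix (family ij)) ≡ ⟦ pos 3 ⟧
  tr-family (i , j) = trans (cong tr (family-matrix (i , j))) (lem i j)
    where
    lem = solve 2 (λ i j → # 1 ⊖ j ⊕ i ⊗ (# 1 ⊖ j ⊖ j ⊗ j) ⊕
                     (j ⊕ # 2 ⊖ i ⊗ (# 1 ⊖ j ⊖ j ⊗ j)) ⊜ # 3) refl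

  module _ (5≢0 : 5# ≢ 0#) where

    private
      -- The entries `m₁₁` and `m₁₂` show that i - i′ is annihilated by c = 1 - j - j² and by 1 +
      -- 2j, hence also by (1 + 2j)² + 4c = 5.
      same-j : ∀ {i i′ j} → family-entries (i , j) ≡ family-entries (i′ , j) → i ≡ i′
      same-j {i} {i′} {j} eq = *-cancelˡ-≢0 5≢0 (x-y≡0⇒x≡y (trans (lem i i′ j)
        (vanish₂ (1# + 2# * j) ((1# + 2# * j) * (i + i′) + ⟦ pos 4 ⟧) (cong m₁₂ eq) (cong m₁₁ eq))))
        where
        lem = solve 3 (λ i i′ j → let c = # 1 ⊖ j ⊖ j ⊗ j ; k = # 1 ⊕ # 2 ⊗ j in
              # 5 ⊗ i ⊖ # 5 ⊗ i′ ⊜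
              k ⊗ ((# 1 ⊕ i ⊗ k ⊖ i ⊗ i ⊗ c) ⊖ (# 1 ⊕ i′ ⊗ k ⊖ i′ ⊗ i′ ⊗ c)) ⊕
              (k ⊗ (i ⊕ i′) ⊕ # 4) ⊗ ((# 1 ⊖ j ⊕ i ⊗ c) ⊖ (# 1 ⊖ j ⊕ i′ ⊗ c))) refl

      two-j : ∀ {i j i′ j′} → family-entries (i , j) ≡ family-entries (i′ , j′) → j ≡ j′ ⊎ j′ ≡ - 1# - j
      two-j {j = j} {j′ = j′} eq = Sum.map x-y≡0⇒x≡y (sym ∘ x-y≡0⇒x≡y)
        (x*y≡0 (trans (lem j j′) (vanish 1# (cong m₂₁ eq))))
        where
        lem = solve 2 (λ j j′ → (j ⊖ j′) ⊗ (⊝ # 1 ⊖ j ⊖ j′) ⊜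
          # 1 ⊗ ((# 1 ⊖ j ⊖ j ⊗ j) ⊖ (# 1 ⊖ j′ ⊖ j′ ⊗ j′))) refl

      three-entries : ∀ {x y z} → family-entries x ≡ family-entries y → family-entries x ≡ family-entries z →
                      x ≡ y ⊎ x ≡ z ⊎ y ≡ z
      three-entries {i₁ , j₁} {i₂ , j₂} {i₃ , j₃} eq₂ eq₃ = cases (two-j eq₂) (two-j eq₃)
        where
        same : ∀ {i i′ j j′} → family-entries (i , j) ≡ family-entries (i′ , j′) → j ≡ j′ → (i , j) ≡ (i′ , j′)
        same eq refl = cong (_, _) (same-j eq)
        cases : j₁ ≡ j₂ ⊎ j₂ ≡ - 1# - j₁ → j₁ ≡ j₃ ⊎ j₃ ≡ - 1# - j₁ →
                (i₁ , j₁) ≡ (i₂ , j₂) ⊎ (i₁ , j₁) ≡ (i₃ , j₃) ⊎ (i₂ , j₂) ≡ (i₃ , j₃)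
        cases (inj₁ j≡) _         = inj₁ (same eq₂ j≡)
        cases (inj₂ _)  (inj₁ j≡) = inj₂ (inj₁ (same eq₃ j≡))
        cases (inj₂ a)  (inj₂ b)  = inj₂ (inj₂ (same (trans (sym eq₂) eq₃) (trans a (sym b))))

    family-fibre : ∀ {x y z g} → family x ≡ g → family y ≡ g → family z ≡ g → x ≡ y ⊎ x ≡ z ⊎ y ≡ z
    family-fibre {x} {y} {z} refl y≡ z≡ = three-entries (entries y≡) (entries z≡)
      where
      entries : ∀ {y} → family y ≡ family x → family-entries x ≡ family-entries y
      entries {y} eq = trans (sym (family-matrix x)) (trans (cong matrix (sym eq)) (family-matrix y))

  row col : Mat → F × F
  row (mat a b c d) = c , d
  col (mat a b c d) = b , d

  private
    select : {X Y : Set} → Dec X → Y → Y → Y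
    select (yes _) x y = x
    select (no _)  x y = y

  -- A coordinate on the line of unimodular matrices with bottom row (c , d): if d ≠ 0 then b
  -- determines a, and if d = 0 then b is fixed and a is free.
  rowKey : Mat → F
  rowKey (mat a b c d) = select (d ≟ 0#) a b

  rowKey-injective : ∀ {X Y} → det X ≡ 1# → det Y ≡ 1# → row X ≡ row Y → rowKey X ≡ rowKey Y → X ≡ Y
  rowKey-injective {mat a b c d} {mat a′ b′ .c .d} δ δ′ refl = go (d ≟ 0#) δ δ′
    where
    go : (d? : Dec (d ≡ 0#)) → a * d - b * c ≡ 1# → a′ * d - b′ * c ≡ 1# →
         select d? a b ≡ select d? a′ b′ → mat a b c d ≡ mat a′ b′ c d
    go (no d≢0) δ δ′ refl = mat-≡ (*-cancelˡ-≢0 d≢0 (x-y≡0⇒x≡y (trans (lem a a′ b c d)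
      (vanish 1# (trans δ (sym δ′)))))) refl refl refl
      where
      lem = solve 5 (λ a a′ b c d → d ⊗ a ⊖ d ⊗ a′ ⊜ # 1 ⊗ ((a ⊗ d ⊖ b ⊗ c) ⊖ (a′ ⊗ d ⊖ b ⊗ c))) refl
    go (yes refl) δ δ′ refl = mat-≡ refl (x-y≡0⇒x≡y (trans (lem a b b′ c)
      (vanish₂ (b′ - b) (- b) δ (trans δ′ (sym δ))))) refl refl
      where
      lem = solve 4 (λ a b b′ c → b ⊖ b′ ⊜ (b′ ⊖ b) ⊗ ((a ⊗ # 0 ⊖ b ⊗ c) ⊖ # 1) ⊕
        (⊝ b) ⊗ ((a ⊗ # 0 ⊖ b′ ⊗ c) ⊖ (a ⊗ # 0 ⊖ b ⊗ c))) refl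

  transpose-injective : ∀ {X Y} → transpose X ≡ transpose Y → X ≡ Y
  transpose-injective eq = cong transpose eq

  colKey : Mat → F
  colKey X = rowKey (transpose X)

  colKey-injective : ∀ {X Y} → det X ≡ 1# → det Y ≡ 1# → col X ≡ col Y → colKey X ≡ colKey Y → X ≡ Y
  colKey-injective {mat a b c d} {mat a′ b′ c′ d′} δ δ′ same key = transpose-injective
    (rowKey-injective {mat a c b d} {mat a′ c′ b′ d′} (trans (lem a b c d) δ) (trans (lem a′ b′ c′ d′) δ′) same key)
    where
    lem = solve 4 (λ a b c d → a ⊗ d ⊖ c ⊗ b ⊜ a ⊗ d ⊖ b ⊗ c) refl

  outer : F × F → F × F → Mat
  outer (c₁ , c₂) (r₁ , r₂) = mat (c₁ * r₁) (c₁ * r₂) (c₂ * r₁) (c₂ * r₂)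

  -- The entry is the 1 × 1 matrix (row of X) Y (column of Z), and the trace is invariant under
  -- rotating the factors.
  tr-outer : ∀ X Y Z → tr (outer (col Z) (row X) ⊛ Y) ≡ m₂₂ ((X ⊛ Y) ⊛ Z)
  tr-outer (mat _ _ c d) (mat e f g h) (mat _ b′ _ d′) = lem b′ c d d′ e f g h
    where
    lem = solve 8 (λ b′ c d d′ e f g h →
      (b′ ⊗ c ⊗ e ⊕ b′ ⊗ d ⊗ g) ⊕ (d′ ⊗ c ⊗ f ⊕ d′ ⊗ d ⊗ h) ⊜ (c ⊗ e ⊕ d ⊗ g) ⊗ b′ ⊕ (c ⊗ f ⊕ d ⊗ h) ⊗ d′) refl

  private
    *-comm : ∀ x y → x * y ≡ y * x
    *-comm = solve 2 (λ x y → x ⊗ y ⊜ y ⊗ x) refl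

    *-cancelʳ-≢0 : ∀ {x y z} → x ≢ 0# → y * x ≡ z * x → y ≡ z
    *-cancelʳ-≢0 {x} {y} {z} x≢0 eq = *-cancelˡ-≢0 x≢0 (trans (*-comm x y) (trans eq (*-comm z x)))

    *-≢0ˡ : ∀ {x y} → x * y ≢ 0# → x ≢ 0#
    *-≢0ˡ {y = y} xy≢0 refl = xy≢0 (0*x≡0 y)

    *-≢0ʳ : ∀ {x y} → x * y ≢ 0# → y ≢ 0#
    *-≢0ʳ {x} xy≢0 refl = xy≢0 (x*0≡0 x)

  -- A nonzero product of a column and a row determines both up to a scalar, which a nonzero
  -- coordinate of the row fixes. The coordinate is selected from the product matrix, so that all
  -- pairs with the same product use the same one.
  outerKey : Mat → F × F → F
  outerKey (mat a b c d) (r₁ , r₂) = select (a ≟ 0# ×-dec c ≟ 0#) r₂ r₁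

  outerKey-injective : ∀ {c r c′ r′} → outer c r ≢ mat 0# 0# 0# 0# → outer c r ≡ outer c′ r′ →
                       outerKey (outer c r) r ≡ outerKey (outer c r) r′ → c ≡ c′ × r ≡ r′
  outerKey-injective {c₁ , c₂} {r₁ , r₂} {c₁′ , c₂′} {r₁′ , r₂′} m≢0 eq =
    go (c₁ * r₁ ≟ 0# ×-dec c₂ * r₁ ≟ 0#)
    where
    e₁₁ = cong m₁₁ eq
    e₁₂ = cong m₁₂ eq
    e₂₁ = cong m₂₁ eq
    e₂₂ = cong m₂₂ eq

    first : r₁ ≡ r₁′ → r₁ ≢ 0# → c₁ ≢ 0# ⊎ c₂ ≢ 0# → (c₁ , c₂) ≡ (c₁′ , c₂′) × (r₁ , r₂) ≡ (r₁′ , r₂′)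
    first refl r≢0 c≢0 = conclude (*-cancelʳ-≢0 r≢0 e₁₁) (*-cancelʳ-≢0 r≢0 e₂₁)
      where
      conclude : c₁ ≡ c₁′ → c₂ ≡ c₂′ → (c₁ , c₂) ≡ (c₁′ , c₂′) × (r₁ , r₂) ≡ (r₁ , r₂′)
      conclude refl refl = refl , cong (r₁ ,_) (Sum.[ (λ c₁≢0 → *-cancelˡ-≢0 c₁≢0 e₁₂) , (λ c₂≢0 → *-cancelˡ-≢0 c₂≢0 e₂₂) ] c≢0)

    second : r₂ ≡ r₂′ → r₂ ≢ 0# → c₁ ≢ 0# ⊎ c₂ ≢ 0# → (c₁ , c₂) ≡ (c₁′ , c₂′) × (r₁ , r₂) ≡ (r₁′ , r₂′)
    second refl r≢0 c≢0 = conclude (*-cancelʳ-≢0 r≢0 e₁₂) (*-cancelʳ-≢0 r≢0 e₂₂)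
      where
      conclude : c₁ ≡ c₁′ → c₂ ≡ c₂′ → (c₁ , c₂) ≡ (c₁′ , c₂′) × (r₁ , r₂) ≡ (r₁′ , r₂)
      conclude refl refl = refl , cong (_, r₂) (Sum.[ (λ c₁≢0 → *-cancelˡ-≢0 c₁≢0 e₁₁) , (λ c₂≢0 → *-cancelˡ-≢0 c₂≢0 e₂₁) ] c≢0)

    go : (z? : Dec (c₁ * r₁ ≡ 0# × c₂ * r₁ ≡ 0#)) → select z? r₂ r₁ ≡ select z? r₂′ r₁′ →
         (c₁ , c₂) ≡ (c₁′ , c₂′) × (r₁ , r₂) ≡ (r₁′ , r₂′)
    go (no ¬z) key with c₁ * r₁ ≟ 0# | c₂ * r₁ ≟ 0#
    ... | no ≢0 | _      = first key (*-≢0ʳ ≢0) (inj₁ (*-≢0ˡ ≢0))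
    ... | _     | no ≢0  = first key (*-≢0ʳ ≢0) (inj₂ (*-≢0ˡ ≢0))
    ... | yes z | yes z′ = contradiction (z , z′) ¬z
    go (yes (z , z′)) key with c₁ * r₂ ≟ 0# | c₂ * r₂ ≟ 0#
    ... | no ≢0 | _       = second key (*-≢0ʳ ≢0) (inj₁ (*-≢0ˡ ≢0))
    ... | _     | no ≢0   = second key (*-≢0ʳ ≢0) (inj₂ (*-≢0ˡ ≢0))
    ... | yes w | yes w′  = contradiction (mat-≡ z w z′ w′) m≢0

  traceless : F × F × F → Mat
  traceless (x , y , z) = mat x y z (- x)

  tr-traceless : ∀ x → tr (traceless x) ≡ 0#
  tr-traceless (x , _) = solve 1 (λ x → x ⊕ ⊝ x ⊜ # 0) refl x

  upper : Mat → F × F × F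
  upper (mat a b c d) = a , b , c

  upper-injective : ∀ {X Y} → tr X ≡ 0# → tr Y ≡ 0# → upper X ≡ upper Y → X ≡ Y
  upper-injective {mat a b c d} {mat .a .b .c d′} t t′ refl =
    mat-≡ refl refl refl (trans (trace-elim t) (sym (trace-elim t′)))

  PlaneKey : Mat → Set
  PlaneKey Y = ∃ λ (key : Mat → F × F) → ∀ X₁ X₂ → tr X₁ ≡ 0# → tr X₂ ≡ 0# →
               tr (X₁ ⊛ Y) ≡ 0# → tr (X₂ ⊛ Y) ≡ 0# → key X₁ ≡ key X₂ → X₁ ≡ X₂

  -- Two of the three coordinates of a traceless X are free on the plane
  -- tr (X Y) = 0.
  plane-key : ∀ Y → ¬ Scalar Y → PlaneKey Y
  plane-key (mat e f g h) ¬scalar = go (f ≟ 0#) (g ≟ 0#) (e ≟ h)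
    where
    relation : ∀ {a b c d} → a + d ≡ 0# → (a * e + b * g) + (c * f + d * h) ≡ 0# →
               (e - h) * a + g * b + f * c ≡ 0#
    relation {a} {b} {c} {d} t s = trans (lem a b c d e f g h)
      (trans (cong₂ (λ x y → x - h * y) s t) (solve 1 (λ h → # 0 ⊖ h ⊗ # 0 ⊜ # 0) refl h))
      where
      lem = solve 8 (λ a b c d e f g h → (e ⊖ h) ⊗ a ⊕ g ⊗ b ⊕ f ⊗ c ⊜
        ((a ⊗ e ⊕ b ⊗ g) ⊕ (c ⊗ f ⊕ d ⊗ h)) ⊖ h ⊗ (a ⊕ d)) refl

    cancel₁ : ∀ {k x x′ y z} → k ≢ 0# → k * x + y + z ≡ 0# → k * x′ + y + z ≡ 0# → x ≡ x′
    cancel₁ {k} {x} {x′} {y} {z} k≢0 eq eq′ = *-cancelˡ-≢0 k≢0 (x-y≡0⇒x≡y (trans (lem k x x′ y z) (vanish 1# (trans eq (sym eq′)))))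
      where
      lem = solve 5 (λ k x x′ y z → k ⊗ x ⊖ k ⊗ x′ ⊜ # 1 ⊗ ((k ⊗ x ⊕ y ⊕ z) ⊖ (k ⊗ x′ ⊕ y ⊕ z))) refl

    cancel₂ : ∀ {k x x′ y z} → k ≢ 0# → y + k * x + z ≡ 0# → y + k * x′ + z ≡ 0# → x ≡ x′
    cancel₂ {k} {x} {x′} {y} {z} k≢0 eq eq′ = *-cancelˡ-≢0 k≢0 (x-y≡0⇒x≡y (trans (lem k x x′ y z) (vanish 1# (trans eq (sym eq′)))))
      where
      lem = solve 5 (λ k x x′ y z → k ⊗ x ⊖ k ⊗ x′ ⊜ # 1 ⊗ ((y ⊕ k ⊗ x ⊕ z) ⊖ (y ⊕ k ⊗ x′ ⊕ z))) refl

    cancel₃ : ∀ {k x x′ y z} → k ≢ 0# → y + z + k * x ≡ 0# → y + z + k * x′ ≡ 0# → x ≡ x′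
    cancel₃ {k} {x} {x′} {y} {z} k≢0 eq eq′ = *-cancelˡ-≢0 k≢0 (x-y≡0⇒x≡y (trans (lem k x x′ y z) (vanish 1# (trans eq (sym eq′)))))
      where
      lem = solve 5 (λ k x x′ y z → k ⊗ x ⊖ k ⊗ x′ ⊜ # 1 ⊗ ((y ⊕ z ⊕ k ⊗ x) ⊖ (y ⊕ z ⊕ k ⊗ x′))) refl

    go : Dec (f ≡ 0#) → Dec (g ≡ 0#) → Dec (e ≡ h) → PlaneKey (mat e f g h)
    go (no f≢0) _ _ = (λ X → m₁₁ X , m₁₂ X) , λ where
      (mat a b _ _) (mat _ _ _ _) t t′ s s′ refl → upper-injective t t′
        (cong (λ c → a , b , c) (cancel₃ f≢0 (relation t s) (relation t′ s′)))
    go (yes _) (no g≢0) _ = (λ X → m₁₁ X , m₂₁ X) , λ where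
      (mat a _ c _) (mat _ _ _ _) t t′ s s′ refl → upper-injective t t′
        (cong (λ b → a , b , c) (cancel₂ g≢0 (relation t s) (relation t′ s′)))
    go (yes _) (yes _) (no e≢h) = (λ X → m₁₂ X , m₂₁ X) , λ where
      (mat _ b c _) (mat _ _ _ _) t t′ s s′ refl → upper-injective t t′
        (cong (λ a → a , b , c) (cancel₁ (e≢h ∘ x-y≡0⇒x≡y) (relation t s) (relation t′ s′)))
    go (yes f≡0) (yes g≡0) (yes e≡h) = contradiction (f≡0 , g≡0 , e≡h) ¬scalar

  tr-zero : ∀ X → tr (mat 0# 0# 0# 0# ⊛ X) ≡ 0#
  tr-zero (mat a b c d) = solve 4 (λ a b c d → (# 0 ⊗ a ⊕ # 0 ⊗ c) ⊕ (# 0 ⊗ b ⊕ # 0 ⊗ d) ⊜ # 0) refl a b c d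

-- Sets of small tripling in SL₂ are large

module Growth (p : ℕ) (p-prime : Prime p) where

  open Counting
  open PrimeField p p-prime hiding (_*_; _-_) renaming (_+_ to _+ᶠ_)
  open SL2 p p-prime
  open Geometry p p-prime
  open Ruzsa _≟ᴳ_ _∙_ e _⁻¹ SL₂-isGroup
  import Algebra.Solver.Monoid
  open import Data.Nat.Base hiding (_⊔_)
  open import Data.Nat.Properties hiding (_≟_)
  open import Data.Nat.Tactic.RingSolver using (solve-∀)
  open import Data.Integer.Base using () renaming (+_ to pos)
  import Data.List.Base as List
  open import Data.List.Properties using (length-take)
  open import Data.List.Membership.DecPropositional _≟ᴳ_ using (_∈?_)
  open import Data.List.Relation.Unary.Unique.DecPropositional.Properties _≟ᴳ_ using (deduplicate-!)

  open Group group using (assoc; identityˡ; identityʳ; inverseˡ; inverseʳ)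
  open GroupProperties group
    using (∙-cancelˡ; ∙-cancelʳ; ⁻¹-injective; ⁻¹-anti-homo-∙; ⁻¹-involutive; ε⁻¹≈ε)

  private module Monoid = Algebra.Solver.Monoid (Group.monoid group)

  g⁻¹∙gh : ∀ g h → g ⁻¹ ∙ (g ∙ h) ≡ h
  g⁻¹∙gh g h = trans (sym (assoc _ _ _)) (trans (cong (_∙ h) (inverseˡ g)) (identityˡ h))

  hg⁻¹∙g : ∀ g h → (h ∙ g ⁻¹) ∙ g ≡ h
  hg⁻¹∙g g h = trans (assoc _ _ _) (trans (cong (h ∙_) (inverseˡ g)) (identityʳ h))

  hg∙g⁻¹ : ∀ g h → (h ∙ g) ∙ g ⁻¹ ≡ h
  hg∙g⁻¹ g h = trans (assoc _ _ _) (trans (cong (h ∙_) (inverseʳ g)) (identityʳ h))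

  conjugate-∙ : ∀ x y g → conjugate (x ∙ y) g ≡ conjugate x (conjugate y g)
  conjugate-∙ x y g = begin
    ((x ∙ y) ∙ g) ∙ (x ∙ y) ⁻¹         ≡⟨ cong (((x ∙ y) ∙ g) ∙_) (⁻¹-anti-homo-∙ x y) ⟩
    ((x ∙ y) ∙ g) ∙ (y ⁻¹ ∙ x ⁻¹)      ≡⟨ sym (assoc _ _ _) ⟩
    (((x ∙ y) ∙ g) ∙ y ⁻¹) ∙ x ⁻¹      ≡⟨ cong (λ z → (z ∙ y ⁻¹) ∙ x ⁻¹) (assoc x y g) ⟩
    ((x ∙ (y ∙ g)) ∙ y ⁻¹) ∙ x ⁻¹      ≡⟨ cong (_∙ x ⁻¹) (assoc x (y ∙ g) (y ⁻¹)) ⟩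
    (x ∙ ((y ∙ g) ∙ y ⁻¹)) ∙ x ⁻¹      ∎
    where open ≡-Reasoning

  conjugate-∙-slide : ∀ x g → conjugate x g ∙ x ≡ x ∙ g
  conjugate-∙-slide x g = hg⁻¹∙g x (x ∙ g)

  infix 4 _⟷_
  _⟷_ : SL₂ → SL₂ → Set
  g ⟷ h = g ∙ h ≡ h ∙ g

  conjugate-≡⇒⟷ : ∀ x y g → conjugate x g ≡ conjugate y g → y ⁻¹ ∙ x ⟷ g
  conjugate-≡⇒⟷ x y g eq = begin
    (y ⁻¹ ∙ x) ∙ g                 ≡⟨ assoc _ _ _ ⟩
    y ⁻¹ ∙ (x ∙ g)                 ≡⟨ cong (y ⁻¹ ∙_) (sym (conjugate-∙-slide x g)) ⟩
    y ⁻¹ ∙ (conjugate x g ∙ x)     ≡⟨ cong (λ z → y ⁻¹ ∙ (z ∙ x)) eq ⟩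
    y ⁻¹ ∙ (conjugate y g ∙ x)     ≡⟨ cong (λ z → y ⁻¹ ∙ (z ∙ x)) (assoc y g (y ⁻¹)) ⟩
    y ⁻¹ ∙ ((y ∙ (g ∙ y ⁻¹)) ∙ x)  ≡⟨ cong (y ⁻¹ ∙_) (assoc y (g ∙ y ⁻¹) x) ⟩
    y ⁻¹ ∙ (y ∙ ((g ∙ y ⁻¹) ∙ x))  ≡⟨ g⁻¹∙gh y _ ⟩
    (g ∙ y ⁻¹) ∙ x                 ≡⟨ assoc _ _ _ ⟩
    g ∙ (y ⁻¹ ∙ x)                 ∎
    where open ≡-Reasoning

  abstract
    _⟷?_ : ∀ g h → Dec (g ⟷ h)
    g ⟷? h = (g ∙ h) ≟ᴳ (h ∙ g)

  Central : SL₂ → Set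
  Central g = Scalar (matrix g)

  abstract
    central? : ∀ g → Dec (Central g)
    central? g = scalar? (matrix g)

  ⟷⇒commute : ∀ {g h} → g ⟷ h → Commute (matrix g) (matrix h)
  ⟷⇒commute {g} {h} eq = trans (sym (matrix-∙ g h)) (trans (cong matrix eq) (matrix-∙ h g))

  commute⇒⟷ : ∀ {g h} → Commute (matrix g) (matrix h) → g ⟷ h
  commute⇒⟷ {g} {h} eq = matrix-injective (trans (matrix-∙ g h) (trans eq (sym (matrix-∙ h g))))

  ⟷-trans : ∀ {g h k} → ¬ Central k → g ⟷ k → h ⟷ k → g ⟷ h
  ⟷-trans {g} {h} {k} ¬ck gk hk =
    commute⇒⟷ (commute-trans {matrix g} {matrix h} {matrix k} ¬ck (⟷⇒commute gk) (⟷⇒commute hk))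

  conjugate-⟷ : ∀ x {g h} → g ⟷ h → conjugate x g ⟷ conjugate x h
  conjugate-⟷ x {g} {h} gh = trans (sym (conjugate-homo g h)) (trans (cong (conjugate x) gh) (conjugate-homo h g))
    where
    conjugate-homo : ∀ g h → conjugate x (g ∙ h) ≡ conjugate x g ∙ conjugate x h
    conjugate-homo g h = sym (begin
      ((x ∙ g) ∙ x ⁻¹) ∙ ((x ∙ h) ∙ x ⁻¹)   ≡⟨ sym (assoc _ _ _) ⟩
      (((x ∙ g) ∙ x ⁻¹) ∙ (x ∙ h)) ∙ x ⁻¹   ≡⟨ cong (_∙ x ⁻¹) (assoc (x ∙ g) (x ⁻¹) (x ∙ h)) ⟩
      ((x ∙ g) ∙ (x ⁻¹ ∙ (x ∙ h))) ∙ x ⁻¹   ≡⟨ cong (λ z → ((x ∙ g) ∙ z) ∙ x ⁻¹) (g⁻¹∙gh x h) ⟩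
      ((x ∙ g) ∙ h) ∙ x ⁻¹                  ≡⟨ cong (_∙ x ⁻¹) (assoc x g h) ⟩
      (x ∙ (g ∙ h)) ∙ x ⁻¹                  ∎)
      where open ≡-Reasoning

  central⇒⟷ : ∀ {g} → Central g → ∀ h → g ⟷ h
  central⇒⟷ c h = commute⇒⟷ (scalar-commute (matrix h) c)

  central-conjugate : ∀ x {g} → Central (conjugate x g) → conjugate x g ≡ g
  central-conjugate x {g} c = ∙-cancelˡ x _ _
    (trans (sym (central⇒⟷ {conjugate x g} c x)) (conjugate-∙-slide x g))

  three-central : ∀ {g h k} → Central g → Central h → Central k → g ≡ h ⊎ g ≡ k ⊎ h ≡ k
  three-central {g} {h} {k} cg ch ck =
    Sum.map matrix-injective (Sum.map matrix-injective matrix-injective)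
      (three-scalars (det≡1 g) (det≡1 h) (det≡1 k) cg ch ck)

  module _ {X : Set} {x y z : X} {Y : Set} (f : X → Y) (f-inj : ∀ {x y} → f x ≡ f y → x ≡ y) where
    one-of-pair : f x ≡ f y ⊎ f x ≡ f z ⊎ f y ≡ f z → x ≡ y ⊎ x ≡ z ⊎ y ≡ z
    one-of-pair = Sum.map f-inj (Sum.map f-inj f-inj)

  tr-conjugate : ∀ x g → tr (matrix (conjugate x g)) ≡ tr (matrix g)
  tr-conjugate x g = trans (tr-∙-comm (x ∙ g) (x ⁻¹)) (cong (tr ∘ matrix) (g⁻¹∙gh x g))
    where
    tr-∙-comm : ∀ g h → tr (matrix (g ∙ h)) ≡ tr (matrix (h ∙ g))
    tr-∙-comm g h = trans (cong tr (matrix-∙ g h))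
      (trans (tr-⊛-comm (matrix g) (matrix h)) (cong tr (sym (matrix-∙ h g))))

  -- The translates X g of a conjugacy class piece X overlap in at most 2p
  -- points unless g is ± 1, so that many of them have a large union.
  module ConjugacyClass (A : List SL₂) (A! : Unique A) (h : SL₂) where

    X : List SL₂
    X = deduplicate _≟ᴳ_ (map (λ a → conjugate a h) A)

    X! : Unique X
    X! = deduplicate-! (map (λ a → conjugate a h) A)

    ∈-X⁺ : ∀ {a} → a ∈ A → conjugate a h ∈ X
    ∈-X⁺ a∈A = ∈-deduplicate⁺ _≟ᴳ_ (∈-map⁺ (λ a → conjugate a h) a∈A)

    ∈-X⁻ : ∀ {x} → x ∈ X → ∃ λ a → a ∈ A × x ≡ conjugate a h
    ∈-X⁻ x∈X = ∈-map⁻ (λ a → conjugate a h) (∈-deduplicate⁻ _≟ᴳ_ (map (λ a → conjugate a h) A) x∈X)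

    tr-X : ∀ {x} → x ∈ X → tr (matrix x) ≡ tr (matrix h)
    tr-X x∈X with a , _ , refl ← ∈-X⁻ x∈X = tr-conjugate a h

    -- If a and a₀ conjugate h to the same element, then a₀⁻¹ a commutes with h. Left translation by
    -- a₀⁻¹ thus embeds each fibre of A → X into the part of the centraliser lying in A⁻¹ A.
    orbit-stabiliser : length A ≤ length X * count (_⟷? h) (inv A · A)
    orbit-stabiliser = length-≤-fibres (λ a x → conjugate a h ≟ᴳ x) A X _
      (λ {a} a∈A → conjugate a h , ∈-X⁺ a∈A , refl) fibre
      where
      fibre : ∀ {x} → x ∈ X → count (λ a → conjugate a h ≟ᴳ x) A ≤ count (_⟷? h) (inv A · A)
      fibre x∈X with a₀ , a₀∈A , refl ← ∈-X⁻ x∈X = begin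
        count P? A              ≡⟨ count≡length-filter P? A ⟩
        length (filter P? A)    ≤⟨ length-≤-injection _≟ᴳ_ (Unique.filter⁺ P? A!) (a₀ ⁻¹ ∙_) to
                                     (λ _ _ → ∙-cancelˡ (a₀ ⁻¹) _ _) ⟩
        length (filter (_⟷? h) (inv A · A))  ≡⟨ count≡length-filter (_⟷? h) (inv A · A) ⟨
        count (_⟷? h) (inv A · A)            ∎
        where
        open ≤-Reasoning
        P? = λ a → conjugate a h ≟ᴳ conjugate a₀ h
        to : ∀ {a} → a ∈ filter P? A → a₀ ⁻¹ ∙ a ∈ filter (_⟷? h) (inv A · A)
        to {a} a∈ with a∈A , eq ← ∈-filter⁻ P? a∈ =
          ∈-filter⁺ (_⟷? h) (∈-·⁺ (∈-inv⁺ a₀∈A) a∈A) (conjugate-≡⇒⟷ a a₀ h eq)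

    translate? : ∀ u g → Dec (u ∙ g ⁻¹ ∈ X)
    translate? u g = (u ∙ g ⁻¹) ∈? X

    _≋_ : SL₂ → SL₂ → Set
    g ≋ g′ = Central (g ∙ g′ ⁻¹)

    _≋?_ : ∀ g g′ → Dec (g ≋ g′)
    g ≋? g′ = central? (g ∙ g′ ⁻¹)

    module Translates (gs : List SL₂) (gs! : Unique gs) where

      private
        us = X · gs
        us! = ·-unique X gs

      translate-size : ∀ {g} → g ∈ gs → length X ≤ count (λ u → translate? u g) us
      translate-size {g} g∈ = ≤-trans
        (length-≤-injection _≟ᴳ_ X! (_∙ g)
          (λ {x} x∈ → ∈-filter⁺ (λ u → translate? u g) (∈-·⁺ x∈ g∈) (subst (_∈ X) (sym (hg∙g⁻¹ g x)) x∈))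
          (λ _ _ → ∙-cancelʳ g _ _))
        (≤-reflexive (sym (count≡length-filter (λ u → translate? u g) us)))

      few-≋ : ∀ {g} → g ∈ gs → count (g ≋?_) gs ≤ 2
      few-≋ {g} _ = count≤2 (g ≋?_) gs! λ _ _ _ cx cy cz →
        one-of-pair (λ g′ → g ∙ g′ ⁻¹) (⁻¹-injective ∘ ∙-cancelˡ g _ _) (three-central cx cy cz)

      both? : ∀ g g′ u → Dec (u ∙ g ⁻¹ ∈ X × u ∙ g′ ⁻¹ ∈ X)
      both? g g′ u = translate? u g ×-dec translate? u g′

      overlap-≤ : ∀ {g g′} → g ∈ gs → g′ ∈ gs → count (both? g g′) us ≤ length X
      overlap-≤ {g} {g′} _ _ = ≤-trans (≤-reflexive (count≡length-filter (both? g g′) us))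
        (length-≤-injection _≟ᴳ_ (Unique.filter⁺ (both? g g′) us!) (_∙ g ⁻¹)
          (λ {u} u∈ → proj₁ (proj₂ (∈-filter⁻ (both? g g′) {xs = us} u∈)))
          (λ _ _ → ∙-cancelʳ (g ⁻¹) _ _))

      overlap-small : ∀ {g g′} → g ∈ gs → g′ ∈ gs → ¬ g ≋ g′ → count (both? g g′) us ≤ p * 2
      overlap-small {g} {g′} _ _ g≄g′ with key , three ← curve-key (matrix (g ∙ g′ ⁻¹)) g≄g′ = begin
        count (both? g g′) us      ≡⟨ count≡length-filter (both? g g′) us ⟩
        length zs                  ≤⟨ length-≤-fibres (λ u k → κ u ≟ k) zs elements 2
                                        (λ {u} _ → κ u , ∈-elements (κ u) , refl) (λ {k} _ → fibre k) ⟩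
        length elements * 2        ≡⟨ cong (_* 2) length-elements ⟩
        p * 2                      ∎
        where
        open ≤-Reasoning
        zs = filter (both? g g′) us
        κ : SL₂ → F
        κ u = key (matrix (u ∙ g ⁻¹))
        on-curve : ∀ {u} → u ∈ zs → OnCurve (tr (matrix h)) (matrix (g ∙ g′ ⁻¹)) (matrix (u ∙ g ⁻¹))
        on-curve {u} u∈ with _ , ug , ug′ ← ∈-filter⁻ (both? g g′) {xs = us} u∈ =
          onCurve (det≡1 (u ∙ g ⁻¹)) (tr-X ug) (trans (cong tr (sym (matrix-∙ (u ∙ g ⁻¹) (g ∙ g′ ⁻¹)))) (trans (cong (tr ∘ matrix) eq) (tr-X ug′)))
          where
          eq : (u ∙ g ⁻¹) ∙ (g ∙ g′ ⁻¹) ≡ u ∙ g′ ⁻¹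
          eq = trans (sym (assoc _ _ _)) (cong (_∙ g′ ⁻¹) (hg⁻¹∙g g u))
        fibre : ∀ k → count (λ u → κ u ≟ k) zs ≤ 2
        fibre k = count≤2 (λ u → κ u ≟ k) (Unique.filter⁺ (both? g g′) us!) λ x∈ y∈ z∈ kx ky kz →
          one-of-pair (λ u → matrix (u ∙ g ⁻¹)) (λ eq → ∙-cancelʳ (g ⁻¹) _ _ (matrix-injective eq))
            (three (on-curve x∈) (on-curve y∈) (on-curve z∈) (trans kx (sym ky)) (trans kx (sym kz)))

      translates : (length gs * length X) * (length gs * length X) ≤
                   length (X · gs) * (length gs * (2 * length X + length gs * (p * 2)))
      translates = second-moment translate? _≋?_ us gs (length X) 2 (length X) (p * 2)
        translate-size few-≋ overlap-≤ overlap-small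

  -- Here x = |X|, c counts the centraliser, u is the size of the union of m translates and q = p.
  -- If x ≤ m q, then a ≤ x c and m q n ≤ a already give n ≤ c. Otherwise the overlaps are
  -- negligible, so m x ≤ 4 u ≤ 4 k a, that is n x ≤ a ≤ x c up to the common factor 4 k in m.
  class-arithmetic : ∀ {a x c u k n q} .{{_ : NonZero a}} .{{_ : NonZero k}} .{{_ : NonZero n}} .{{_ : NonZero q}} →
    let m = 4 * k * n in
    a ≤ x * c → (m * x) * (m * x) ≤ u * (m * (2 * x + m * (q * 2))) → u ≤ k * a → m * q * n ≤ a →
    n ≤ c
  class-arithmetic {a} {x} {c} {u} {k} {n} {q} a≤xc ineq u≤ka mqn≤a with ≤-total x (4 * k * n * q)
  ... | inj₁ x≤mq = *-cancelˡ-≤ (m * q) {{m*n≢0 m q}} (≤-trans mqn≤a (≤-trans a≤xc (*-monoˡ-≤ c x≤mq)))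
    where
    m = 4 * k * n
    instance
      4k≢0 : NonZero (4 * k)
      4k≢0 = m*n≢0 4 k
      m≢0 : NonZero m
      m≢0 = m*n≢0 (4 * k) n
  ... | inj₂ mq≤x = *-cancelˡ-≤ (4 * k) (*-cancelʳ-≤ _ _ a (begin
    4 * k * n * a          ≤⟨ *-monoʳ-≤ m a≤xc ⟩
    m * (x * c)            ≡⟨ sym (*-assoc m x c) ⟩
    m * x * c              ≤⟨ *-monoˡ-≤ c mx≤4u ⟩
    4 * u * c              ≤⟨ *-monoˡ-≤ c (*-monoʳ-≤ 4 u≤ka) ⟩
    4 * (k * a) * c        ≡⟨ eq₃ k a c ⟩
    4 * k * c * a          ∎))
    where
    open ≤-Reasoning
    m = 4 * k * n
    instance
      4k≢0 : NonZero (4 * k)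
      4k≢0 = m*n≢0 4 k
      m≢0 : NonZero m
      m≢0 = m*n≢0 (4 * k) n
      mq≢0 : NonZero (m * q)
      mq≢0 = m*n≢0 m q
      x≢0 : NonZero x
      x≢0 = >-nonZero (<-≤-trans (>-nonZero⁻¹ (m * q)) mq≤x)
      mx≢0 : NonZero (m * x)
      mx≢0 = m*n≢0 m x
    eq₁ : ∀ m x q → m * (2 * x + m * (q * 2)) ≡ 2 * (m * x) + 2 * (m * (m * q))
    eq₁ = solve-∀
    eq₂ : ∀ m x u → u * (2 * (m * x) + 2 * (m * x)) ≡ 4 * u * (m * x)
    eq₂ = solve-∀
    eq₃ : ∀ k a c → 4 * (k * a) * c ≡ 4 * k * c * a
    eq₃ = solve-∀
    mx≤4u : m * x ≤ 4 * u
    mx≤4u = *-cancelʳ-≤ _ _ (m * x) (begin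
      (m * x) * (m * x)                             ≤⟨ ineq ⟩
      u * (m * (2 * x + m * (q * 2)))               ≡⟨ cong (u *_) (eq₁ m x q) ⟩
      u * (2 * (m * x) + 2 * (m * (m * q)))         ≤⟨ *-monoʳ-≤ u (+-monoʳ-≤ (2 * (m * x)) (*-monoʳ-≤ 2 (*-monoʳ-≤ m mq≤x))) ⟩
      u * (2 * (m * x) + 2 * (m * x))               ≡⟨ eq₂ m x u ⟩
      4 * u * (m * x)                               ∎)

  module Pivot (2≢0 : 2# ≢ 0#) (5≢0 : 5# ≢ 0#)
    (A : List SL₂) (A! : Unique A) (e∈A : e ∈ A)
    (g₀∈A : g₀ ∈ A) (g₀U∈A : g₀ ∙ U 1# ∈ A) (Lg₀∈A : L 1# ∙ g₀ ∈ A)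
    (K : ℕ) {{K≢0 : NonZero K}} (AAA≤ : length (A · (A · A)) ≤ K * length A)
    (N : ℕ) (3≤N : 3 ≤ N) (N-small : 4 * K ^ 21 * N * p * N ≤ length A) where

    open Tripling A A! e∈A K AAA≤ using (alternating-≤; |A⁻¹AA⁻¹|)

    private
      a = length A
      Q = inv A · A
      Q! = ·-unique (inv A) A

      instance
        N≢0 : NonZero N
        N≢0 = >-nonZero (≤-trans (s≤s z≤n) 3≤N)
        a≢0 : NonZero a
        a≢0 = >-nonZero (∈-length e∈A)
        K²¹≢0 : NonZero (K ^ 21)
        K²¹≢0 = m^n≢0 K 21

      -- The number of translates. An element of X · gs for the class of q h q⁻¹ with q, h ∈ Q is an
      -- alternating product of nine factors, and `alternating-≤ 6` bounds such products by K²¹ a.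
      M = 4 * K ^ 21 * N

      M≤a : M ≤ a
      M≤a = ≤-trans (≤-trans (m≤m*n M (p * N) {{m*n≢0 p N}}) (≤-reflexive (sym (*-assoc M p N)))) N-small

      gs = take M A
      gs! : Unique gs
      gs! = Unique.take⁺ M A!

      length-gs : length gs ≡ M
      length-gs = trans (length-take M A) (m≤n⇒m⊓n≡m M≤a)

      gs⊆A : gs ⊆ A
      gs⊆A = take-⊆ M A
        where
        take-⊆ : ∀ n (xs : List SL₂) → take n xs ⊆ xs
        take-⊆ (suc n) (x List.∷ xs) (here eq)  = here eq
        take-⊆ (suc n) (x List.∷ xs) (there x∈) = there (take-⊆ n xs x∈)

    record Rich (g : SL₂) : Set where
      constructor rich
      field
        centraliser-≥ : N ≤ count (_⟷? g) Q
    open Rich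

    conjugate-rich : ∀ {q h} → q ∈ Q → h ∈ Q → Rich (conjugate q h)
    conjugate-rich {q} {h} q∈Q h∈Q = rich (
      class-arithmetic {a} {length X} {count (_⟷? conjugate q h) Q} {length (X · gs)} {K ^ 21} {N} {p}
        orbit-stabiliser
        (subst (λ m → (m * length X) * (m * length X) ≤ length (X · gs) * (m * (2 * length X + m * (p * 2))))
          length-gs translates)
        (≤-trans (⊆⇒≤ (·-unique X gs) X·gs⊆) (proj₁ (alternating-≤ 6)))
        N-small)
      where
      open ConjugacyClass A A! (conjugate q h)
      open Translates gs gs!

      regroup : ∀ a b t v w t′ s a′ g →
                ((a ∙ (((b ∙ t) ∙ (v ∙ w)) ∙ (t′ ∙ s))) ∙ a′) ∙ g ≡ a ∙ (b ∙ (t ∙ (v ∙ (w ∙ (t′ ∙ (s ∙ (a′ ∙ g)))))))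
      regroup = Monoid.solve 9 (λ a b t v w t′ s a′ g →
        ((a ⊙ (((b ⊙ t) ⊙ (v ⊙ w)) ⊙ (t′ ⊙ s))) ⊙ a′) ⊙ g Monoid.⊜ a ⊙ (b ⊙ (t ⊙ (v ⊙ (w ⊙ (t′ ⊙ (s ⊙ (a′ ⊙ g)))))))) refl
        where
        _⊙_ = Monoid._⊕_

      X·gs⊆ : X · gs ⊆ alternating 8 A
      X·gs⊆ {u} u∈ =
        let x , g , x∈ , g∈ , u≡ = ∈-·⁻ X gs u∈
            a′ , a′∈ , x≡ = ∈-X⁻ x∈
            s⁻¹ , t , s⁻¹∈ , t∈ , q≡ = ∈-·⁻ (inv A) A q∈Q
            v⁻¹ , w , v⁻¹∈ , w∈ , h≡ = ∈-·⁻ (inv A) A h∈Q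
            s , s∈ , s⁻¹≡ = ∈-map⁻ _⁻¹ s⁻¹∈
            v , v∈ , v⁻¹≡ = ∈-map⁻ _⁻¹ v⁻¹∈
            q≡′ : q ≡ s ⁻¹ ∙ t
            q≡′ = trans q≡ (cong (_∙ t) s⁻¹≡)
            q⁻¹≡ : q ⁻¹ ≡ t ⁻¹ ∙ s
            q⁻¹≡ = trans (cong _⁻¹ q≡′) (trans (⁻¹-anti-homo-∙ (s ⁻¹) t) (cong (t ⁻¹ ∙_) (⁻¹-involutive s)))
            u≡′ : u ≡ a′ ∙ (s ⁻¹ ∙ (t ∙ (v ⁻¹ ∙ (w ∙ (t ⁻¹ ∙ (s ∙ (a′ ⁻¹ ∙ g)))))))
            u≡′ = trans u≡ (trans (cong (_∙ g) x≡) (trans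
              (cong₂ (λ y z → ((a′ ∙ (y ∙ z)) ∙ a′ ⁻¹) ∙ g)
                (cong₂ _∙_ q≡′ (trans h≡ (cong (_∙ w) v⁻¹≡))) q⁻¹≡)
              (regroup a′ (s ⁻¹) t (v ⁻¹) w (t ⁻¹) s (a′ ⁻¹) g)))
        in subst (_∈ alternating 8 A) (sym u≡′)
             (alternating-∙⁺ 6 a′∈ s∈ (alternating-∙⁺ 4 t∈ v∈ (alternating-∙⁺ 2 w∈ t∈
               (alternating-∙⁺ 0 s∈ a′∈ (gs⊆A g∈)))))

    private
      A⊆Q : A ⊆ Q
      A⊆Q {x} x∈ = subst (_∈ Q) (trans (cong (_∙ x) ε⁻¹≈ε) (identityˡ x)) (∈-·⁺ (∈-inv⁺ e∈A) x∈)

      A⁻¹⊆Q : ∀ {x} → x ∈ A → x ⁻¹ ∈ Q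
      A⁻¹⊆Q {x} x∈ = subst (_∈ Q) (identityʳ (x ⁻¹)) (∈-·⁺ (∈-inv⁺ x∈) e∈A)

      count-central≤2 : count central? Q ≤ 2
      count-central≤2 = count≤2 central? Q! (λ _ _ _ → three-central)

    noncentral-commuting? : ∀ g b → Dec (¬ Central b × b ⟷ g)
    noncentral-commuting? g b = ¬? (central? b) ×-dec (b ⟷? g)

    rich-noncentral : ∀ {g} → Rich g → N ∸ 2 ≤ count (noncentral-commuting? g) Q
    rich-noncentral {g} r = m≤n+o⇒m∸n≤o N 2 (begin
      N                                                            ≤⟨ centraliser-≥ r ⟩
      count (_⟷? g) Q                                              ≤⟨ ∑-mono Q (λ {b} _ → 𝟙-split (central? b) (b ⟷? g)) ⟩
      ∑ Q (λ b → 𝟙 (central? b) + 𝟙 (noncentral-commuting? g b))   ≡⟨ ∑-+ Q _ _ ⟩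
      count central? Q + count (noncentral-commuting? g) Q         ≤⟨ +-monoˡ-≤ _ count-central≤2 ⟩
      2 + count (noncentral-commuting? g) Q                        ∎)
      where
      open ≤-Reasoning

    -- The centraliser of g is also that of a noncentral h ∈ Q, to which
    -- conjugate-rich applies.
    step : ∀ {g q} → Rich g → q ∈ Q → Rich (conjugate q g)
    step {g} {q} r q∈Q =
      through (count-witness (noncentral-commuting? g) Q (≤-trans (∸-monoˡ-≤ 2 3≤N) (rich-noncentral r)))
      where
      through : (∃ λ h → h ∈ Q × ¬ Central h × h ⟷ g) → Rich (conjugate q g)
      through (h , h∈Q , ¬ch , h⟷g) = rich (≤-trans (centraliser-≥ (conjugate-rich q∈Q h∈Q))
        (count-mono (_⟷? conjugate q h) (_⟷? conjugate q g) Q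
          (λ _ b⟷ → ⟷-trans ¬cqh b⟷ (sym (conjugate-⟷ q h⟷g)))))
        where
        ¬cqh : ¬ Central (conjugate q h)
        ¬cqh c = ¬ch (subst Central (central-conjugate q c) c)

    family-rich : ∀ ij → Rich (family ij)
    family-rich (i , j) = F-induction (λ i → Rich (conjugate (U i ∙ L j) g₀)) (at-0 j) next-i i
      where
      rich-∙ : ∀ {x y z} → Rich (conjugate y g₀) → x ∈ Q → z ≡ x ∙ y → Rich (conjugate z g₀)
      rich-∙ {x} {y} r x∈ refl = subst Rich (sym (conjugate-∙ x y g₀)) (step r x∈)

      at-0-0 : Rich (conjugate (U 0# ∙ L 0#) g₀)
      at-0-0 = subst (λ x → Rich (conjugate x g₀)) (sym (trans (cong₂ _∙_ U-0 L-0) (identityˡ e)))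
        (conjugate-rich {e} {g₀} (A⊆Q e∈A) (A⊆Q g₀∈A))

      -- `L 1#` is (L 1# ∙ g₀) ∙ g₀⁻¹, a product in A A⁻¹ and not in Q = A⁻¹ A, so two conjugations
      -- are made. For `U 1#` = g₀⁻¹ ∙ (g₀ ∙ U 1#) one is enough.
      next-j : ∀ j → Rich (conjugate (U 0# ∙ L j) g₀) → Rich (conjugate (U 0# ∙ L (j +ᶠ 1#)) g₀)
      next-j j r = rich-∙ {L 1# ∙ g₀} (rich-∙ {g₀ ⁻¹} r (A⁻¹⊆Q g₀∈A) refl) (A⊆Q Lg₀∈A) (begin
        U 0# ∙ L (j +ᶠ 1#)                             ≡⟨ cong (_∙ L (j +ᶠ 1#)) U-0 ⟩
        e ∙ L (j +ᶠ 1#)                                ≡⟨ identityˡ _ ⟩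
        L (j +ᶠ 1#)                                    ≡⟨ L-+1 j ⟩
        L 1# ∙ L j                                    ≡⟨ cong (_∙ L j) (hg∙g⁻¹ g₀ (L 1#)) ⟨
        ((L 1# ∙ g₀) ∙ g₀ ⁻¹) ∙ L j                   ≡⟨ cong (((L 1# ∙ g₀) ∙ g₀ ⁻¹) ∙_) (trans (cong (_∙ L j) U-0) (identityˡ _)) ⟨
        ((L 1# ∙ g₀) ∙ g₀ ⁻¹) ∙ (U 0# ∙ L j)          ≡⟨ assoc _ _ _ ⟩
        (L 1# ∙ g₀) ∙ (g₀ ⁻¹ ∙ (U 0# ∙ L j))          ∎)
        where open ≡-Reasoning

      at-0 : ∀ j → Rich (conjugate (U 0# ∙ L j) g₀)
      at-0 = F-induction (λ j → Rich (conjugate (U 0# ∙ L j) g₀)) at-0-0 next-j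

      next-i : ∀ i → Rich (conjugate (U i ∙ L j) g₀) → Rich (conjugate (U (i +ᶠ 1#) ∙ L j) g₀)
      next-i i r = rich-∙ {U 1#} r
        (subst (_∈ Q) (g⁻¹∙gh g₀ (U 1#)) (∈-·⁺ (∈-inv⁺ g₀∈A) g₀U∈A))
        (trans (cong (_∙ L j) (U-+1 i)) (assoc _ _ _))

    private
      pairs : List (F × F)
      pairs = cartesianProduct elements elements

      Y : List SL₂
      Y = deduplicate _≟ᴳ_ (map family pairs)

      Y! : Unique Y
      Y! = deduplicate-! (map family pairs)

      p²≤2|Y| : p * p ≤ length Y * 2
      p²≤2|Y| = begin
        p * p          ≡⟨ cong₂ _*_ length-elements length-elements ⟨
        length elements * length elements  ≡⟨ length-cartesianProduct elements elements ⟨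
        length pairs   ≤⟨ length-≤-fibres (λ ij y → family ij ≟ᴳ y) pairs Y 2
                            (λ {ij} ij∈ → family ij , ∈-deduplicate⁺ _≟ᴳ_ (∈-map⁺ family ij∈) , refl)
                            (λ {y} _ → count≤2 (λ ij → family ij ≟ᴳ y) (Unique.cartesianProduct⁺ elements-unique elements-unique)
                              (λ _ _ _ → family-fibre 5≢0)) ⟩
        length Y * 2   ∎
        where open ≤-Reasoning

      Y-family : ∀ {y} → y ∈ Y → ∃ λ ij → y ≡ family ij
      Y-family y∈ = let ij , _ , y≡ = ∈-map⁻ family (∈-deduplicate⁻ _≟ᴳ_ (map family pairs) y∈) in ij , y≡

      -- All elements of Y have trace 3, so by `three-commuting` a noncentral b commutes with at
      -- most two of them: the centralisers cover the noncentral part of Q at most twice.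
      |Y|*[N-2]≤2|Q| : length Y * (N ∸ 2) ≤ length Q * 2
      |Y|*[N-2]≤2|Q| = begin
        length Y * (N ∸ 2)                                  ≤⟨ ∑-≥ Y rich-y ⟩
        ∑ Y (λ y → count (noncentral-commuting? y) Q)       ≡⟨ double-count noncentral-commuting? Y Q ⟩
        ∑ Q (λ b → count (λ y → noncentral-commuting? y b) Y)  ≤⟨ ∑-≤ Q (λ {b} _ → count≤2 (λ y → noncentral-commuting? y b) Y! few) ⟩
        length Q * 2                                        ∎
        where
        open ≤-Reasoning
        rich-y : ∀ {y} → y ∈ Y → N ∸ 2 ≤ count (noncentral-commuting? y) Q
        rich-y y∈ = let ij , y≡ = Y-family y∈ in rich-noncentral (subst Rich (sym y≡) (family-rich ij))
        few : ∀ {b x y z} → x ∈ Y → y ∈ Y → z ∈ Y → ¬ Central b × b ⟷ x → ¬ Central b × b ⟷ y → ¬ Central b × b ⟷ z →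
              x ≡ y ⊎ x ≡ z ⊎ y ≡ z
        few {b} {x} {y} {z} x∈ y∈ z∈ (¬cb , bx) (_ , by) (_ , bz) = one-of-pair matrix matrix-injective
          (three-commuting 2≢0 5≢0 {Z = matrix b} ¬cb (det≡1 x) (det≡1 y) (det≡1 z)
            (trace-3 x∈) (trace-3 y∈) (trace-3 z∈)
            (⟷⇒commute (sym bx)) (⟷⇒commute (sym by)) (⟷⇒commute (sym bz)))
          where
          trace-3 : ∀ {y} → y ∈ Y → tr (matrix y) ≡ ⟦ pos 3 ⟧
          trace-3 y∈ = let ij , y≡ = Y-family y∈ in trans (cong (tr ∘ matrix) y≡) (tr-family ij)

      |Q|≤ : length Q ≤ K ^ 3 * a
      |Q|≤ = ≤-trans (⊆⇒≤ Q! Q⊆) |A⁻¹AA⁻¹|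
        where
        Q⊆ : Q ⊆ alternating 2 (inv A)
        Q⊆ {x} x∈ =
          let s⁻¹ , t , s⁻¹∈ , t∈ , x≡ = ∈-·⁻ (inv A) A x∈
          in subst (_∈ alternating 2 (inv A)) (sym (trans x≡ (cong (s⁻¹ ∙_) (trans (sym (identityʳ t)) (cong (t ∙_) (sym ε⁻¹≈ε))))))
               (∈-·⁺ s⁻¹∈ (∈-·⁺ (subst (t ∈_) (sym (inv-involutive A)) t∈)
                 (subst (e ⁻¹ ∈_) (cong inv (sym (inv-involutive A))) (∈-inv⁺ e∈A))))

    pivot : p * p * (N ∸ 2) ≤ 4 * (K ^ 3 * a)
    pivot = begin
      p * p * (N ∸ 2)             ≤⟨ *-monoˡ-≤ (N ∸ 2) p²≤2|Y| ⟩
      length Y * 2 * (N ∸ 2)      ≡⟨ swap (length Y) (N ∸ 2) ⟩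
      2 * (length Y * (N ∸ 2))    ≤⟨ *-monoʳ-≤ 2 |Y|*[N-2]≤2|Q| ⟩
      2 * (length Q * 2)          ≤⟨ *-monoʳ-≤ 2 (*-monoˡ-≤ 2 |Q|≤) ⟩
      2 * (K ^ 3 * a * 2)         ≡⟨ double (K ^ 3 * a) ⟩
      4 * (K ^ 3 * a)             ∎
      where
      open ≤-Reasoning
      swap : ∀ y n → y * 2 * n ≡ 2 * (y * n)
      swap = solve-∀
      double : ∀ x → 2 * (x * 2) ≡ 4 * x
      double = solve-∀

  square-root : ∀ c n .{{_ : NonZero c}} → ∃ λ r → c * (r * r) ≤ n × n < c * (suc r * suc r)
  square-root c zero    = 0 , ≤-reflexive (*-zeroʳ c) , ≤-trans (>-nonZero⁻¹ c) (≤-reflexive (sym (*-identityʳ c)))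
  square-root c (suc n) with square-root c n
  ... | r , lo , hi with suc n <? c * (suc r * suc r)
  ...   | yes lt  = r , m≤n⇒m≤1+n lo , lt
  ...   | no  ¬lt = suc r , ≮⇒≥ ¬lt , <-≤-trans (s≤s hi) (*-monoʳ-< c (*-mono-< {suc r} (n<1+n _) (n<1+n _)))

  module _ (2≢0 : 2# ≢ 0#) (5≢0 : 5# ≢ 0#)
    (A : List SL₂) (A! : Unique A) (e∈A : e ∈ A)
    (g₀∈A : g₀ ∈ A) (g₀U∈A : g₀ ∙ U 1# ∈ A) (Lg₀∈A : L 1# ∙ g₀ ∈ A)
    (K : ℕ) {{K≢0 : NonZero K}} (AAA≤ : length (A · (A · A)) ≤ K * length A) where

    private
      a = length A
      c = 4 * K ^ 21 * p

      instance
        a≢0 : NonZero a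
        a≢0 = >-nonZero (∈-length e∈A)
        K²¹≢0 : NonZero (K ^ 21)
        K²¹≢0 = m^n≢0 K 21
        4K²¹≢0 : NonZero (4 * K ^ 21)
        4K²¹≢0 = m*n≢0 4 (K ^ 21)
        c≢0 : NonZero c
        c≢0 = m*n≢0 (4 * K ^ 21) p

      suc≤3* : ∀ {n} → 4 ≤ n → suc n ≤ 3 * (n ∸ 2)
      suc≤3* {suc (suc (suc (suc n)))} (s≤s (s≤s (s≤s (s≤s _)))) = ≤-trans (m≤n+m (5 + n) (suc (n + n))) (≤-reflexive (eq n))
        where
        eq : ∀ n → suc (n + n) + (5 + n) ≡ 3 * (2 + n)
        eq = solve-∀

      4≤root : ∀ {r} → c * 16 ≤ a → a < c * (suc r * suc r) → 4 ≤ r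
      4≤root {r} lo hi with 4 ≤? r
      ... | yes le = le
      ... | no nle = contradiction (≤-<-trans lo (<-≤-trans hi (*-monoʳ-≤ c (*-mono-≤ (≰⇒> nle) (≰⇒> nle))))) (<-irrefl refl)

    -- N is the largest number with c N² ≤ a, and c * 16 ≤ a makes it at least 4, so that a < c (N +
    -- 1)² ≤ 9 c (N - 2)². The square of `pivot` bounds p⁴ (N - 2)² by 16 K⁶ a². With c = 4 K²¹ p
    -- the constant becomes 9 · 16 · 4 = 576.
    tripling⇒large : c * 16 ≤ a → p * p * p ≤ 576 * (K ^ 21 * (K ^ 3 * K ^ 3)) * a
    tripling⇒large large = conclude (square-root c a)
      where
      conclude : (∃ λ r → c * (r * r) ≤ a × a < c * (suc r * suc r)) → p * p * p ≤ 576 * (K ^ 21 * (K ^ 3 * K ^ 3)) * a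
      conclude (N , lo , hi) = *-cancelˡ-≤ p (*-cancelʳ-≤ _ _ a (begin
        p * (p * p * p) * a                                    ≤⟨ *-monoʳ-≤ (p * (p * p * p)) (<⇒≤ hi) ⟩
        p * (p * p * p) * (c * (suc N * suc N))                ≤⟨ *-monoʳ-≤ (p * (p * p * p)) (*-monoʳ-≤ c (*-mono-≤ (suc≤3* 4≤N) (suc≤3* 4≤N))) ⟩
        p * (p * p * p) * (c * (3 * M * (3 * M)))              ≡⟨ eq₁ p c M ⟩
        9 * c * ((p * p * M) * (p * p * M))                    ≤⟨ *-monoʳ-≤ (9 * c) (*-mono-≤ pivoted pivoted) ⟩
        9 * c * (4 * (K ^ 3 * a) * (4 * (K ^ 3 * a)))          ≡⟨ eq₂ (K ^ 21) p (K ^ 3) a ⟩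
        p * (576 * (K ^ 21 * (K ^ 3 * K ^ 3)) * a) * a         ∎))
        where
        open ≤-Reasoning
        M = N ∸ 2
        4≤N = 4≤root {N} large hi
        eq₀ : ∀ k n p → 4 * k * n * p * n ≡ 4 * k * p * (n * n)
        eq₀ = solve-∀
        pivoted : p * p * M ≤ 4 * (K ^ 3 * a)
        pivoted = Pivot.pivot 2≢0 5≢0 A A! e∈A g₀∈A g₀U∈A Lg₀∈A K AAA≤ N (≤-trans (n≤1+n 3) 4≤N)
          (≤-trans (≤-reflexive (eq₀ (K ^ 21) N p)) lo)
        eq₁ : ∀ p c m → p * (p * p * p) * (c * (3 * m * (3 * m))) ≡ 9 * c * ((p * p * m) * (p * p * m))
        eq₁ = solve-∀
        eq₂ : ∀ k p l a → 9 * (4 * k * p) * (4 * (l * a) * (4 * (l * a))) ≡ p * (576 * (k * (l * l)) * a) * a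
        eq₂ = solve-∀

-- Mixing: a second moment over all 2 × 2 matrices

module Gowers (p : ℕ) (p-prime : Prime p) where

  open Counting
  open PrimeField p p-prime hiding (_*_; _-_; _+_)
  open SL2 p p-prime
  open Geometry p p-prime
  open Growth p p-prime using (Central; central?; three-central; one-of-pair)
  open Ruzsa _≟ᴳ_ _∙_ e _⁻¹ SL₂-isGroup using (group)
  open import Data.Nat.Base
  open import Data.Nat.Properties hiding (_≟_)
  open import Data.Nat.Tactic.RingSolver using (solve-∀)
  import Data.List.Base as List
  open import Data.List.Properties using (length-map)
  open import Data.List.Membership.DecPropositional _≟ᴹ_ using (_∈?_)
  import Data.List.Relation.Unary.Unique.DecPropositional.Properties as Dedup

  infix 4 _≟²_ _≟³_
  _≟²_ : DecidableEquality (F × F)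
  _≟²_ = ≡-dec _≟_ _≟_

  _≟³_ : DecidableEquality (F × F × F)
  _≟³_ = ≡-dec _≟_ _≟²_

  F² : List (F × F)
  F² = cartesianProduct elements elements

  F³ : List (F × F × F)
  F³ = cartesianProduct elements F²

  F²-length : length F² ≡ p * p
  F²-length = trans (length-cartesianProduct elements elements) (cong₂ _*_ length-elements length-elements)

  F³-length : length F³ ≡ p * (p * p)
  F³-length = trans (length-cartesianProduct elements F²) (cong₂ _*_ length-elements F²-length)

  F²-unique : Unique F²
  F²-unique = Unique.cartesianProduct⁺ elements-unique elements-unique

  F³-unique : Unique F³
  F³-unique = Unique.cartesianProduct⁺ elements-unique F²-unique

  ∈-F² : ∀ x → x ∈ F²
  ∈-F² (a , b) = ∈-cartesianProduct⁺ (∈-elements a) (∈-elements b)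

  ∈-F³ : ∀ x → x ∈ F³
  ∈-F³ (a , x) = ∈-cartesianProduct⁺ (∈-elements a) (∈-F² x)

  toMat : F × F × F × F → Mat
  toMat (a , b , c , d) = mat a b c d

  matrices : List Mat
  matrices = map toMat (cartesianProduct elements F³)

  ∈-matrices : ∀ X → X ∈ matrices
  ∈-matrices (mat a b c d) = ∈-map⁺ toMat (∈-cartesianProduct⁺ (∈-elements a) (∈-F³ (b , c , d)))

  matrices-length : length matrices ≡ p * (p * (p * p))
  matrices-length = trans (length-map toMat (cartesianProduct elements F³))
    (trans (length-cartesianProduct elements F³) (cong₂ _*_ length-elements F³-length))

  matrices-unique : Unique matrices
  matrices-unique = Unique.map⁺ {f = toMat} toMat-injective (Unique.cartesianProduct⁺ elements-unique F³-unique)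
    where
    toMat-injective : ∀ {x y} → toMat x ≡ toMat y → x ≡ y
    toMat-injective refl = refl

  module _ {X : Set} {K : Set} (_≟ᴷ_ : DecidableEquality K) {P : X → Set} (P? : ∀ x → Dec (P x))
           {xs : List X} (xs! : Unique xs) {ks : List K} (∈-ks : ∀ k → k ∈ ks) (key : X → K) where

    count-≤-keys : (∀ {x y} → x ∈ xs → y ∈ xs → P x → P y → key x ≡ key y → x ≡ y) →
                   count P? xs ≤ length ks
    count-≤-keys inj = ≤-trans (≤-reflexive (count≡length-filter P? xs))
      (length-≤-injection _≟ᴷ_ (Unique.filter⁺ P? xs!) key (λ _ → ∈-ks _)
        (λ x∈ y∈ → let x∈xs , px = ∈-filter⁻ P? x∈ ; y∈xs , py = ∈-filter⁻ P? y∈ in inj x∈xs y∈xs px py))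

  open Group group using (assoc; identityˡ; inverseʳ)
  open GroupProperties group using (∙-cancelˡ)

  -- For a matrix m let N(m) be the number of b ∈ B with tr (m b) = 0.  Its
  -- variance over all m is so small that N cannot vanish on the large set of
  -- matrices  (column of c) (row of a).
  module Mixing (A B C : List SL₂) (A! : Unique A) (B! : Unique B) (C! : Unique C)
    (avoid : ∀ {a b c} → a ∈ A → b ∈ B → c ∈ C → m₂₂ (matrix ((a ∙ b) ∙ c)) ≢ 0#) where

    private
      rows cols : List (F × F)
      rows = deduplicate _≟²_ (map (row ∘ matrix) A)
      cols = deduplicate _≟²_ (map (col ∘ matrix) C)

      |A|≤ : length A ≤ length rows * p
      |A|≤ = subst (λ n → length A ≤ length rows * n) length-elements
        (length-≤-fibres (λ a r → row (matrix a) ≟² r) A rows (length elements)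
          (λ {a} a∈ → row (matrix a) , ∈-deduplicate⁺ _≟²_ (∈-map⁺ (row ∘ matrix) a∈) , refl)
          (λ {r} _ → count-≤-keys _≟_ (λ a → row (matrix a) ≟² r) A! ∈-elements (rowKey ∘ matrix)
            (λ {x} {y} _ _ rx ry k → matrix-injective
              (rowKey-injective (det≡1 x) (det≡1 y) (trans rx (sym ry)) k))))

      |C|≤ : length C ≤ length cols * p
      |C|≤ = subst (λ n → length C ≤ length cols * n) length-elements
        (length-≤-fibres (λ a r → col (matrix a) ≟² r) C cols (length elements)
          (λ {a} a∈ → col (matrix a) , ∈-deduplicate⁺ _≟²_ (∈-map⁺ (col ∘ matrix) a∈) , refl)
          (λ {r} _ → count-≤-keys _≟_ (λ a → col (matrix a) ≟² r) C! ∈-elements (colKey ∘ matrix)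
            (λ {x} {y} _ _ rx ry k → matrix-injective
              (colKey-injective (det≡1 x) (det≡1 y) (trans rx (sym ry)) k))))

      outer′ : (F × F) × (F × F) → Mat
      outer′ (c , r) = outer c r

      colrows : List ((F × F) × (F × F))
      colrows = cartesianProduct cols rows

      products : List Mat
      products = deduplicate _≟ᴹ_ (map outer′ colrows)

      products! : Unique products
      products! = Dedup.deduplicate-! _≟ᴹ_ (map outer′ colrows)

      product-tr≢0 : ∀ {m b} → m ∈ products → b ∈ B → tr (m ⊛ matrix b) ≢ 0#
      product-tr≢0 {m} {b} m∈ b∈ tr≡0 =
        let cr , cr∈ , m≡ = ∈-map⁻ outer′ (∈-deduplicate⁻ _≟ᴹ_ (map outer′ colrows) m∈)
            c∈ , r∈ = ∈-cartesianProduct⁻ cols rows cr∈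
            z , z∈ , c≡ = ∈-map⁻ (col ∘ matrix) (∈-deduplicate⁻ _≟²_ (map (col ∘ matrix) C) c∈)
            x , x∈ , r≡ = ∈-map⁻ (row ∘ matrix) (∈-deduplicate⁻ _≟²_ (map (row ∘ matrix) A) r∈)
        in avoid x∈ b∈ z∈ (trans (cong m₂₂ (trans (matrix-∙ (x ∙ b) z) (cong (_⊛ matrix z) (matrix-∙ x b))))
             (trans (sym (tr-outer (matrix x) (matrix b) (matrix z)))
             (trans (cong (λ m → tr (m ⊛ matrix b)) (sym (trans m≡ (cong₂ outer c≡ r≡)))) tr≡0)))

      |cols|*|rows|≤ : ∀ {b} → b ∈ B → length cols * length rows ≤ length products * p
      |cols|*|rows|≤ {b} b∈ = begin
        length cols * length rows       ≡⟨ sym (length-cartesianProduct cols rows) ⟩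
        length colrows                  ≤⟨ length-≤-fibres (λ cr m → outer′ cr ≟ᴹ m) colrows products (length elements)
                                             (λ {cr} cr∈ → outer′ cr , ∈-deduplicate⁺ _≟ᴹ_ (∈-map⁺ outer′ cr∈) , refl)
                                             (λ {m} m∈ → count-≤-keys _≟_ (λ cr → outer′ cr ≟ᴹ m)
                                               (Unique.cartesianProduct⁺ (Dedup.deduplicate-! _≟²_ (map (col ∘ matrix) C)) (Dedup.deduplicate-! _≟²_ (map (row ∘ matrix) A)))
                                               ∈-elements (outerKey m ∘ proj₂)
                                               (λ _ _ eq eq′ k → inj m∈ eq eq′ k)) ⟩
        length products * length elements  ≡⟨ cong (length products *_) length-elements ⟩
        length products * p                ∎
        where
        open ≤-Reasoning
        inj : ∀ {m x y} → m ∈ products → outer′ x ≡ m → outer′ y ≡ m → outerKey m (proj₂ x) ≡ outerKey m (proj₂ y) → x ≡ y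
        inj {m} {c , r} {c′ , r′} m∈ refl eq′ k =
          let c≡ , r≡ = outerKey-injective {c} {r} {c′} {r′}
                (λ m≡0 → product-tr≢0 m∈ b∈ (trans (cong (λ m → tr (m ⊛ matrix b)) m≡0) (tr-zero (matrix b))))
                (sym eq′) k
          in cong₂ _,_ c≡ r≡

      -- By `avoid` the equation tr (m b) = 0 can hold only outside the products. The second moment
      -- is therefore taken over this complement: Cauchy-Schwarz forces it to contain nearly all
      -- matrices, which leaves few products.
      us : List Mat
      us = filter (λ m → ¬? (m ∈? products)) matrices

      us! : Unique us
      us! = Unique.filter⁺ (λ m → ¬? (m ∈? products)) matrices-unique

      |products|+|us|≤ : length products + length us ≤ p * (p * (p * p))
      |products|+|us|≤ = begin
        length products + length us
          ≤⟨ +-monoˡ-≤ (length us) (length-≤-⊆ _≟ᴹ_ products! (λ {m} m∈ → ∈-filter⁺ (_∈? products) (∈-matrices m) m∈)) ⟩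
        length (filter (_∈? products) matrices) + length us
          ≡⟨ cong₂ _+_ (count≡length-filter (_∈? products) matrices) (count≡length-filter (¬? ∘ (_∈? products)) matrices) ⟨
        count (_∈? products) matrices + count (¬? ∘ (_∈? products)) matrices
          ≡⟨ count+count¬ (_∈? products) matrices ⟩
        length matrices
          ≡⟨ matrices-length ⟩
        p * (p * (p * p)) ∎
        where open ≤-Reasoning

      kills? : ∀ m b → Dec (tr (m ⊛ matrix b) ≡ 0#)
      kills? m b = tr (m ⊛ matrix b) ≟ 0#

      ⊛-cancelʳ : ∀ g {X Y} → X ⊛ matrix g ≡ Y ⊛ matrix g → X ≡ Y
      ⊛-cancelʳ g {X} {Y} eq = trans (sym (undo X)) (trans (cong (_⊛ adj (matrix g)) eq) (undo Y))
        where
        undo : ∀ X → (X ⊛ matrix g) ⊛ adj (matrix g) ≡ X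
        undo X = trans (⊛-assoc X _ _) (trans (cong (X ⊛_) (adj-inverseʳ (det≡1 g))) (⊛-identityʳ X))

      ⊛-adj-⊛ : ∀ g X → (X ⊛ adj (matrix g)) ⊛ matrix g ≡ X
      ⊛-adj-⊛ g X = trans (⊛-assoc X _ _) (trans (cong (X ⊛_) (adj-inverseˡ (det≡1 g))) (⊛-identityʳ X))

      -- The traceless matrices times b⁻¹ are p³ solutions m of tr (m b) = 0, and none of them is a
      -- product.
      many-killed : ∀ {b} → b ∈ B → p * (p * p) ≤ count (λ m → kills? m b) us
      many-killed {b} b∈ = begin
        p * (p * p)                             ≡⟨ sym F³-length ⟩
        length F³                               ≤⟨ length-≤-injection _≟ᴹ_ F³-unique f
                                                     (λ {x} _ → ∈-filter⁺ (λ m → kills? m b) (f∈us x) (f-kills x)) (λ _ _ → f-inj) ⟩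
        length (filter (λ m → kills? m b) us)   ≡⟨ sym (count≡length-filter (λ m → kills? m b) us) ⟩
        count (λ m → kills? m b) us             ∎
        where
        open ≤-Reasoning
        f : F × F × F → Mat
        f x = traceless x ⊛ adj (matrix b)
        f-kills : ∀ x → tr (f x ⊛ matrix b) ≡ 0#
        f-kills x = trans (cong tr (⊛-adj-⊛ b (traceless x))) (tr-traceless x)
        f∈us : ∀ x → f x ∈ us
        f∈us x = ∈-filter⁺ (λ m → ¬? (m ∈? products)) (∈-matrices (f x))
          (λ fx∈ → product-tr≢0 fx∈ b∈ (f-kills x))
        f-inj : ∀ {x y} → f x ≡ f y → x ≡ y
        f-inj {x} {y} eq = cong upper (trans (sym (⊛-adj-⊛ b (traceless x)))
          (trans (cong (_⊛ matrix b) eq) (⊛-adj-⊛ b (traceless y))))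

      _≋_ : SL₂ → SL₂ → Set
      g ≋ g′ = Central (g ⁻¹ ∙ g′)

      _≋?_ : ∀ g g′ → Dec (g ≋ g′)
      g ≋? g′ = central? (g ⁻¹ ∙ g′)

      few-≋ : ∀ {g} → g ∈ B → count (g ≋?_) B ≤ 2
      few-≋ {g} _ = count≤2 (g ≋?_) B! λ _ _ _ cx cy cz →
        one-of-pair (λ g′ → g ⁻¹ ∙ g′) (∙-cancelˡ (g ⁻¹) _ _) (three-central cx cy cz)

      both? : ∀ g g′ m → Dec (tr (m ⊛ matrix g) ≡ 0# × tr (m ⊛ matrix g′) ≡ 0#)
      both? g g′ m = kills? m g ×-dec kills? m g′

      both-≤p³ : ∀ {g g′} → g ∈ B → g′ ∈ B → count (both? g g′) us ≤ p * (p * p)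
      both-≤p³ {g} {g′} _ _ = subst (count (both? g g′) us ≤_) F³-length
        (count-≤-keys _≟³_ (both? g g′) us! ∈-F³ (λ m → upper (m ⊛ matrix g))
          (λ _ _ (t , _) (t′ , _) k → ⊛-cancelʳ g (upper-injective t t′ k)))

      -- For X = m g the conditions are tr X = 0 and tr (X g⁻¹ g′) = 0. These are independent linear
      -- equations as g⁻¹ g′ is not scalar.
      both-≤p² : ∀ {g g′} → g ∈ B → g′ ∈ B → ¬ g ≋ g′ → count (both? g g′) us ≤ p * p
      both-≤p² {g} {g′} _ _ g≄g′ =
        let key , key-injective = plane-key (matrix (g ⁻¹ ∙ g′)) g≄g′
        in subst (count (both? g g′) us ≤_) F²-length
             (count-≤-keys _≟²_ (both? g g′) us! ∈-F² (λ m → key (m ⊛ matrix g))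
               (λ {x} {y} _ _ (t , s) (t′ , s′) k → ⊛-cancelʳ g
                 (key-injective _ _ t t′ (trans (cong tr (shift x)) s) (trans (cong tr (shift y)) s′) k)))
        where
        shift : ∀ X → (X ⊛ matrix g) ⊛ matrix (g ⁻¹ ∙ g′) ≡ X ⊛ matrix g′
        shift X = trans (⊛-assoc X _ _) (cong (X ⊛_) (trans (sym (matrix-∙ g (g ⁻¹ ∙ g′)))
          (cong matrix (trans (sym (assoc _ _ _)) (trans (cong (_∙ g′) (inverseʳ g)) (identityˡ g′))))))

      variance : (length B * (p * (p * p))) * (length B * (p * (p * p))) ≤
                 length us * (length B * (2 * (p * (p * p)) + length B * (p * p)))
      variance = second-moment kills? _≋?_ us B (p * (p * p)) 2 (p * (p * p)) (p * p)
        many-killed few-≋ both-≤p³ both-≤p²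

      -- With w = 2 q³ + b q² the second moment gives b q⁶ ≤ u w. Since (l + u) w ≤ q⁴ w = 2 q⁷ + b
      -- q⁶, the main terms b q⁶ cancel, and l b q² ≤ l w ≤ 2 q⁷ remains.
      arithmetic : ∀ l u b q .{{_ : NonZero b}} .{{_ : NonZero q}} → l + u ≤ q * (q * (q * q)) →
        (b * (q * (q * q))) * (b * (q * (q * q))) ≤ u * (b * (2 * (q * (q * q)) + b * (q * q))) →
        l * b ≤ 2 * (q * q * q * q * q)
      arithmetic l u b q l+u≤ var = *-cancelʳ-≤ _ _ (q * q) {{m*n≢0 q q}} (+-cancelʳ-≤ (b * (q * q * q * q * q * q)) _ _ (begin
        l * b * (q * q) + b * (q * q * q * q * q * q)
          ≤⟨ +-mono-≤ (≤-trans (≤-reflexive (*-assoc l b (q * q))) (*-monoʳ-≤ l (m≤n+m (b * (q * q)) (2 * (q * (q * q))))))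
               (*-cancelˡ-≤ b (≤-trans (≤-reflexive (eq₁ b q)) (≤-trans var (≤-reflexive (eq₂ u b _))))) ⟩
        l * w + u * w            ≡⟨ sym (*-distribʳ-+ w l u) ⟩
        (l + u) * w              ≤⟨ *-monoˡ-≤ w l+u≤ ⟩
        q * (q * (q * q)) * w    ≡⟨ eq₃ b q ⟩
        2 * (q * q * q * q * q) * (q * q) + b * (q * q * q * q * q * q) ∎))
        where
        open ≤-Reasoning
        w = 2 * (q * (q * q)) + b * (q * q)
        eq₁ : ∀ b q → b * (b * (q * q * q * q * q * q)) ≡ (b * (q * (q * q))) * (b * (q * (q * q)))
        eq₁ = solve-∀
        eq₂ : ∀ u b w → u * (b * w) ≡ b * (u * w)
        eq₂ = solve-∀
        eq₃ : ∀ b q → q * (q * (q * q)) * (2 * (q * (q * q)) + b * (q * q)) ≡ 2 * (q * q * q * q * q) * (q * q) + b * (q * q * q * q * q * q)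
        eq₃ = solve-∀

    -- Passing from A to its bottom rows, from C to its right columns and from pairs of these to
    -- products costs a factor p each time. This accounts for p³ beside the bound 2 p⁵ of
    -- `arithmetic`.
    few : ∀ {b} → b ∈ B → length A * length B * length C ≤ 2 * (p * p * p * p * p * (p * p * p))
    few {b} b∈ = begin
      length A * length B * length C                       ≤⟨ *-mono-≤ (*-monoˡ-≤ (length B) |A|≤) |C|≤ ⟩
      length rows * p * length B * (length cols * p)       ≡⟨ eq₁ (length rows) (length cols) (length B) p ⟩
      length cols * length rows * (length B * (p * p))     ≤⟨ *-monoˡ-≤ (length B * (p * p)) (|cols|*|rows|≤ b∈) ⟩
      length products * p * (length B * (p * p))           ≡⟨ eq₂ (length products) (length B) p ⟩
      length products * length B * (p * p * p)             ≤⟨ *-monoˡ-≤ (p * p * p) (arithmetic (length products) (length us) (length B) p {{B≢0}} |products|+|us|≤ variance) ⟩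
      2 * (p * p * p * p * p) * (p * p * p)                ≡⟨ *-assoc 2 (p * p * p * p * p) (p * p * p) ⟩
      2 * (p * p * p * p * p * (p * p * p))                ∎
      where
      open ≤-Reasoning
      B≢0 : NonZero (length B)
      B≢0 = >-nonZero (∈-length b∈)
      eq₁ : ∀ r c b q → r * q * b * (c * q) ≡ c * r * (b * (q * q))
      eq₁ = solve-∀
      eq₂ : ∀ l b q → l * q * (b * (q * q)) ≡ l * b * (q * q * q)
      eq₂ = solve-∀

  mixing : (A B C : List SL₂) → Unique A → Unique B → Unique C →
           2 * (p * p * p * p * p * (p * p * p)) < length A * length B * length C →
           ∃ λ a → ∃ λ b → ∃ λ c → a ∈ A × b ∈ B × c ∈ C × m₂₂ (matrix ((a ∙ b) ∙ c)) ≡ 0#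
  -- The lists are finite, so existence is decided by exhaustive search, and a failed search
  -- supplies the hypothesis `avoid` of `Mixing`.
  mixing A B C A! B! C! large = decide (any? (λ a → any? (λ b → any? (zero? a b) C) B) A)
    where
    zero? : ∀ a b c → Dec (m₂₂ (matrix ((a ∙ b) ∙ c)) ≡ 0#)
    zero? a b c = m₂₂ (matrix ((a ∙ b) ∙ c)) ≟ 0#
    decide : Dec _ → _
    decide (yes found) =
      let a , a∈ , found-b = find found ; b , b∈ , found-c = find found-b ; c , c∈ , eq = find found-c
      in a , b , c , a∈ , b∈ , c∈ , eq
    decide (no none) = contradiction large (≤⇒≯ (bound B refl))
      where
      bound : ∀ B′ → B ≡ B′ → length A * length B * length C ≤ 2 * (p * p * p * p * p * (p * p * p))
      bound List.[] refl = ≤-trans (≤-reflexive (cong (_* length C) (*-zeroʳ (length A)))) z≤n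
      bound (b List.∷ _) B≡ = Mixing.few A B C A! B! C!
        (λ a∈ b∈ c∈ eq → none (lose a∈ (lose b∈ (lose c∈ eq)))) (subst (b ∈_) (sym B≡) (here refl))

-- Words in the letters 1 and 2, their matrices and continued fractions

module Words where

  open import Defs
  open import Data.Nat.Base
  open import Data.Nat.Properties
  open import Data.Nat.Divisibility using (_∣_; ∣m+n∣m⇒∣n; ∣n⇒∣m*n; ∣1⇒≡1)
  open import Data.Nat.GCD using (gcd)
  open import Data.Nat.Coprimality using (Coprime; coprime⇒gcd≡1)
  open import Data.Nat.Tactic.RingSolver using (solve-∀)
  import Data.Integer.Base as ℤ
  import Data.Integer.Properties as ℤ
  import Data.Integer.Tactic.RingSolver as ℤSolver
  open import Data.Rational.Base as ℚ using (ℚ; 1ℚ; 1/_)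
  import Data.Rational.Properties as ℚ
  import Data.Rational.Unnormalised.Base as ℚᵘ
  import Data.Rational.Unnormalised.Properties as ℚᵘ
  open import Data.Maybe.Base using (just)
  open import Data.Maybe.Relation.Unary.Any using (Any; just)

  data Digit : Set where
    one two : Digit

  digit : Digit → ℕ
  digit one = 1
  digit two = 2

  record Matℕ : Set where
    constructor matℕ
    field
      n₁₁ n₁₂ n₂₁ n₂₂ : ℕ

  open Matℕ public

  matℕ-≡ : ∀ {a b c d a′ b′ c′ d′} → a ≡ a′ → b ≡ b′ → c ≡ c′ → d ≡ d′ → matℕ a b c d ≡ matℕ a′ b′ c′ d′
  matℕ-≡ refl refl refl refl = refl

  infixl 7 _⊠_
  _⊠_ : Matℕ → Matℕ → Matℕ
  matℕ a b c d ⊠ matℕ e f g h = matℕ (a * e + b * g) (a * f + b * h) (c * e + d * g) (c * f + d * h)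

  -- The matrix of b₁ ⋯ bₛ is [[p′, p], [q′, q]], where p / q = [0; b₁, …, bₛ]
  -- and p′ / q′ is the preceding convergent.
  prepend : Digit → Matℕ → Matℕ
  prepend b (matℕ x y z w) = matℕ z w (x + digit b * z) (y + digit b * w)

  identity : Matℕ
  identity = matℕ 1 0 0 1

  convergents : List Digit → Matℕ
  convergents []       = identity
  convergents (b ∷ bs) = prepend b (convergents bs)

  prepend-⊠ : ∀ b X Y → prepend b (X ⊠ Y) ≡ prepend b X ⊠ Y
  prepend-⊠ b (matℕ x y z w) (matℕ e f g h) =
    matℕ-≡ refl refl (lem x y z w (digit b) e g) (lem x y z w (digit b) f h)
    where
    lem : ∀ x y z w b e g → (x * e + y * g) + b * (z * e + w * g) ≡ (x + b * z) * e + (y + b * w) * g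
    lem = solve-∀

  ⊠-identityˡ : ∀ X → identity ⊠ X ≡ X
  ⊠-identityˡ (matℕ a b c d) = matℕ-≡ (lem₁ a c) (lem₁ b d) (lem₂ a c) (lem₂ b d)
    where
    lem₁ : ∀ x y → 1 * x + 0 * y ≡ x
    lem₁ = solve-∀
    lem₂ : ∀ x y → 0 * x + 1 * y ≡ y
    lem₂ = solve-∀

  convergents-++ : ∀ bs cs → convergents (bs ++ cs) ≡ convergents bs ⊠ convergents cs
  convergents-++ []       cs = sym (⊠-identityˡ (convergents cs))
  convergents-++ (b ∷ bs) cs = trans (cong (prepend b) (convergents-++ bs cs)) (prepend-⊠ b (convergents bs) (convergents cs))

  size : Matℕ → ℕ
  size (matℕ a b c d) = a + b + c + d

  size-⊠ : ∀ X Y → size (X ⊠ Y) ≤ size X * size Y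
  size-⊠ (matℕ a b c d) (matℕ e f g h) = ≤-trans (m≤m+n _ _) (≤-reflexive (lem a b c d e f g h))
    where
    lem : ∀ a b c d e f g h →
          ((a * e + b * g) + (a * f + b * h) + (c * e + d * g) + (c * f + d * h)) +
          ((a + c) * (g + h) + (b + d) * (e + f)) ≡ (a + b + c + d) * (e + f + g + h)
    lem = solve-∀

  n₂₂≤size : ∀ X → n₂₂ X ≤ size X
  n₂₂≤size (matℕ a b c d) = m≤n+m d (a + b + c)

  0<n₂₂ : ∀ bs → 0 < n₂₂ (convergents bs)
  0<n₂₂ []       = s≤s z≤n
  0<n₂₂ (b ∷ bs) = <-≤-trans (*-mono-≤ (1≤value b) (0<n₂₂ bs)) (m≤n+m _ _)
    where
    1≤value : ∀ b → 1 ≤ digit b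
    1≤value one = s≤s z≤n
    1≤value two = s≤s z≤n

  coprime-convergents : ∀ bs → Coprime (n₁₂ (convergents bs)) (n₂₂ (convergents bs))
  coprime-convergents [] (_ , d∣1) = ∣1⇒≡1 d∣1
  coprime-convergents (b ∷ bs) {d} (d∣w , d∣y+bw) = coprime-convergents bs
    (∣m+n∣m⇒∣n (subst (d ∣_) (+-comm _ (digit b * n₂₂ (convergents bs))) d∣y+bw) (∣n⇒∣m*n (digit b) d∣w) , d∣w)

  digits : List Digit → List ℕ
  digits = map digit

  digits-positive : ∀ bs → All NonZero (digits bs)
  digits-positive []         = []
  digits-positive (one ∷ bs) = _ ∷ digits-positive bs
  digits-positive (two ∷ bs) = _ ∷ digits-positive bs

  digits≤2 : ∀ bs → All (_≤ 2) (digits bs)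
  digits≤2 []         = []
  digits≤2 (one ∷ bs) = s≤s z≤n ∷ digits≤2 bs
  digits≤2 (two ∷ bs) = ≤-refl ∷ digits≤2 bs

  -- Normalised fractions carry a gcd that does not compute for variables, so identities between
  -- them are checked by cross multiplication on unnormalised ones.
  /-toℚᵘ : ∀ n d .{{_ : NonZero d}} → ℚ.toℚᵘ (n ℚ./ d) ℚᵘ.≃ n ℚᵘ./ d
  /-toℚᵘ n d@(suc _) = ℚ.toℚᵘ-fromℚᵘ (n ℚᵘ./ d)

  /-+ : ∀ b n d .{{_ : NonZero d}} → ((ℤ.+ b) ℚ./ 1) ℚ.+ ((ℤ.+ n) ℚ./ d) ≡ (ℤ.+ (n + b * d)) ℚ./ d
  /-+ b n d@(suc _) = ℚ.toℚᵘ-injective (begin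
    ℚ.toℚᵘ (((ℤ.+ b) ℚ./ 1) ℚ.+ ((ℤ.+ n) ℚ./ d))                ≈⟨ ℚ.toℚᵘ-homo-+ ((ℤ.+ b) ℚ./ 1) ((ℤ.+ n) ℚ./ d) ⟩
    ℚ.toℚᵘ ((ℤ.+ b) ℚ./ 1) ℚᵘ.+ ℚ.toℚᵘ ((ℤ.+ n) ℚ./ d)      ≈⟨ ℚᵘ.+-cong (/-toℚᵘ (ℤ.+ b) 1) (/-toℚᵘ (ℤ.+ n) d) ⟩
    ((ℤ.+ b) ℚᵘ./ 1) ℚᵘ.+ ((ℤ.+ n) ℚᵘ./ d)                      ≈⟨ ℚᵘ.*≡* cross ⟩
    (ℤ.+ (n + b * d)) ℚᵘ./ d                                ≈⟨ ℚᵘ.≃-sym (/-toℚᵘ (ℤ.+ (n + b * d)) d) ⟩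
    ℚ.toℚᵘ ((ℤ.+ (n + b * d)) ℚ./ d)                        ∎)
    where
    open ℚᵘ.≃-Reasoning
    cross : (ℤ.+ b ℤ.* ℤ.+ d ℤ.+ ℤ.+ n ℤ.* ℤ.+ 1) ℤ.* ℤ.+ d ≡ ℤ.+ (n + b * d) ℤ.* ℤ.+ (1 * d)
    cross = trans (lem (ℤ.+ b) (ℤ.+ n) (ℤ.+ d))
      (cong₂ ℤ._*_ (sym (trans (ℤ.pos-+ n (b * d)) (cong (λ t → ℤ.+ n ℤ.+ t) (ℤ.pos-* b d)))) (cong ℤ.+_ (sym (*-identityˡ d))))
      where
      lem : ∀ b n d → (b ℤ.* d ℤ.+ n ℤ.* ℤ.+ 1) ℤ.* d ≡ (n ℤ.+ b ℤ.* d) ℤ.* d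
      lem = ℤSolver.solve-∀

  /-inverse : ∀ n d .{{_ : NonZero n}} .{{_ : NonZero d}} → ((ℤ.+ d) ℚ./ n) ℚ.* ((ℤ.+ n) ℚ./ d) ≡ 1ℚ
  /-inverse n@(suc _) d@(suc _) = ℚ.toℚᵘ-injective (begin
    ℚ.toℚᵘ (((ℤ.+ d) ℚ./ n) ℚ.* ((ℤ.+ n) ℚ./ d))            ≈⟨ ℚ.toℚᵘ-homo-* ((ℤ.+ d) ℚ./ n) ((ℤ.+ n) ℚ./ d) ⟩
    ℚ.toℚᵘ ((ℤ.+ d) ℚ./ n) ℚᵘ.* ℚ.toℚᵘ ((ℤ.+ n) ℚ./ d)      ≈⟨ ℚᵘ.*-cong (/-toℚᵘ (ℤ.+ d) n) (/-toℚᵘ (ℤ.+ n) d) ⟩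
    ((ℤ.+ d) ℚᵘ./ n) ℚᵘ.* ((ℤ.+ n) ℚᵘ./ d)                      ≈⟨ ℚᵘ.*≡* (lem (ℤ.+ d) (ℤ.+ n)) ⟩
    ℚ.toℚᵘ 1ℚ ∎)
    where
    open ℚᵘ.≃-Reasoning
    lem : ∀ d n → d ℤ.* n ℤ.* ℤ.+ 1 ≡ ℤ.+ 1 ℤ.* (n ℤ.* d)
    lem = ℤSolver.solve-∀

  reciprocal : ∀ x y .{{_ : ℚ.NonZero x}} → y ℚ.* x ≡ 1ℚ → y ≡ 1/ x
  reciprocal x y yx≡1 = begin
    y                      ≡⟨ ℚ.*-identityʳ y ⟨
    y ℚ.* 1ℚ               ≡⟨ cong (y ℚ.*_) (ℚ.*-inverseʳ x) ⟨
    y ℚ.* (x ℚ.* 1/ x)     ≡⟨ ℚ.*-assoc y x (1/ x) ⟨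
    (y ℚ.* x) ℚ.* 1/ x     ≡⟨ cong (ℚ._* 1/ x) yx≡1 ⟩
    1ℚ ℚ.* 1/ x            ≡⟨ ℚ.*-identityˡ (1/ x) ⟩
    1/ x                   ∎
    where open ≡-Reasoning

  n₂₂≢0 : ∀ bs → NonZero (n₂₂ (convergents bs))
  n₂₂≢0 bs = >-nonZero (0<n₂₂ bs)

  value-step : ∀ b nz ds ps n d .{{_ : NonZero d}} .{{_ : NonZero (n + b * d)}} → (ℤ.+ n) ℚ./ d ≡ value ds ps →
               (ℤ.+ d) ℚ./ (n + b * d) ≡ value (b ∷ ds) (nz ∷ ps)
  value-step b nz ds ps n d eq = reciprocal x _ {{ℚ.pos⇒nonZero x {{completeQuotient-pos b ds nz ps}}}} (begin
    ((ℤ.+ d) ℚ./ (n + b * d)) ℚ.* x                             ≡⟨ cong (((ℤ.+ d) ℚ./ (n + b * d)) ℚ.*_) x≡ ⟩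
    ((ℤ.+ d) ℚ./ (n + b * d)) ℚ.* ((ℤ.+ (n + b * d)) ℚ./ d)     ≡⟨ /-inverse (n + b * d) d ⟩
    1ℚ                                                          ∎)
    where
    open ≡-Reasoning
    x = completeQuotient b ds ps
    x≡ : x ≡ (ℤ.+ (n + b * d)) ℚ./ d
    x≡ = trans (cong (((ℤ.+ b) ℚ./ 1) ℚ.+_) (sym eq)) (/-+ b n d)

  value-convergents : ∀ bs → ((ℤ.+ n₁₂ (convergents bs)) ℚ./ n₂₂ (convergents bs)) {{n₂₂≢0 bs}} ≡
                      value (digits bs) (digits-positive bs)
  value-convergents []         = refl
  value-convergents (one ∷ bs) = value-step 1 _ (digits bs) (digits-positive bs) (n₁₂ (convergents bs)) (n₂₂ (convergents bs))
                                   {{n₂₂≢0 bs}} {{n₂₂≢0 (one ∷ bs)}} (value-convergents bs)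
  value-convergents (two ∷ bs) = value-step 2 _ (digits bs) (digits-positive bs) (n₁₂ (convergents bs)) (n₂₂ (convergents bs))
                                   {{n₂₂≢0 bs}} {{n₂₂≢0 (two ∷ bs)}} (value-convergents bs)

  0<n₁₂ : ∀ bs → 0 < n₁₂ (convergents (bs ++ two ∷ []))
  0<n₁₂ []       = s≤s z≤n
  0<n₁₂ (b ∷ bs) = 0<n₂₂ (bs ++ two ∷ [])

  n₁₂<n₂₂ : ∀ bs → n₁₂ (convergents (bs ++ two ∷ [])) < n₂₂ (convergents (bs ++ two ∷ []))
  n₁₂<n₂₂ []         = s≤s (s≤s z≤n)
  n₁₂<n₂₂ (one ∷ bs) = +-mono-≤ (0<n₁₂ bs) (≤-reflexive (sym (*-identityˡ _)))
  n₁₂<n₂₂ (two ∷ bs) = +-mono-≤ (0<n₁₂ bs) (m≤m+n _ _)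

  last-two : ∀ bs → Any (2 ≤_) (last (digits (bs ++ two ∷ [])))
  last-two []           = just ≤-refl
  last-two (b ∷ [])     = just ≤-refl
  last-two (b ∷ c ∷ bs) = last-two (c ∷ bs)

  Admissible : ℕ → ℕ → Set
  Admissible p bound =
    Σ[ q ∈ ℕ ] Σ[ q≢0 ∈ NonZero q ] Σ[ a ∈ ℕ ]
      (0 < a × a < q × gcd a q ≡ 1 × p ∣ q × q ≤ bound ×
       (Σ[ bs ∈ List ℕ ] (IsRegularCF a q {{q≢0}} bs × All (_≤ 2) bs)))

  -- The final letter 2 makes the expansion regular and gives a < q even when it is the only letter.
  admissible : ∀ {p bound} bs → p ∣ n₂₂ (convergents (bs ++ two ∷ [])) →
               n₂₂ (convergents (bs ++ two ∷ [])) ≤ bound → Admissible p bound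
  admissible bs p∣q q≤bound =
    n₂₂ (convergents w) , n₂₂≢0 w , n₁₂ (convergents w) ,
    0<n₁₂ bs , n₁₂<n₂₂ bs , coprime⇒gcd≡1 (coprime-convergents w) , p∣q , q≤bound ,
    digits w ,
    record { positive = digits-positive w ; last≥2 = last-two bs ; equation = value-convergents w } ,
    digits≤2 w
    where
    w = bs ++ two ∷ []

  admissible-mono : ∀ {p b b′} → b ≤ b′ → Admissible p b → Admissible p b′
  admissible-mono b≤ (q , q≢0 , a , 0<a , a<q , coprime , p∣q , q≤ , cf) =
    q , q≢0 , a , 0<a , a<q , coprime , p∣q , ≤-trans q≤ b≤ , cf

-- Counting words with entries of bounded size

module Stopping where

  open Counting
  open Words
  open import Data.Nat.Base
  open import Data.Nat.Properties
  open import Data.Nat.Tactic.RingSolver using (solve-∀)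
  open import Data.List.Properties using (length-map; length-++; foldl-∷ʳ; ∷-injectiveʳ)
  open import Data.List.Reverse using (Reverse; reverseView; _∶_∶ʳ_; [])
  open import Data.List.Relation.Binary.Disjoint.Propositional using (Disjoint)

  Pair : Set
  Pair = Digit × Digit

  -- The state (x , y) is the bottom row (q′ , q) of the matrix of a word.
  State : Set
  State = ℕ × ℕ

  append : Digit → State → State
  append b (x , y) = y , x + digit b * y

  step : State → Pair → State
  step s (b , b′) = append b′ (append b s)

  -- A substitute for the denominator y. The sum of 1 / y over the two successors of a state can
  -- decrease: at (1 , 1) it passes from 1 to 1/2 + 1/3. With 3x + 5y the sum of the inverses
  -- increases at every state, which is the inequality `weights`.
  weight : State → ℕ
  weight (x , y) = 3 * x + 5 * y

  -- Words are cut where the weight first exceeds N, so that they have comparable size instead of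
  -- equal length. The second argument is fuel; each pair of letters at least doubles the weight.
  grow : ℕ → ℕ → State → List (List Pair)
  grow N zero    s = [] ∷ []
  grow N (suc n) s with N <? weight s
  ... | yes _ = [] ∷ []
  ... | no _  = branch (one , one) ++ branch (one , two) ++ branch (two , one) ++ branch (two , two)
    where
    branch : Pair → List (List Pair)
    branch d = map (d ∷_) (grow N n (step s d))

  abstract

    num den : ℕ
    num = 201
    den = 200

    0<den : 0 < den
    0<den = s≤s z≤n

    den≤num : den ≤ num
    den≤num = n≤1+n 200

    -- (201 / 200)^140 is slightly above 2: after 70 pairs of letters the sum of inverse weights has
    -- at least doubled.
    doubling : 2 * (den * den) ^ 70 ≤ (num * num) ^ 70
    doubling = ≤ᵇ⇒≤ (2 * (200 * 200) ^ 70) ((201 * 201) ^ 70) _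

    weights : ∀ x y → num * ((3 * y + 5 * (x + 1 * y)) * (3 * y + 5 * (x + 2 * y))) ≤
                      den * (3 * x + 5 * y) * ((3 * y + 5 * (x + 1 * y)) + (3 * y + 5 * (x + 2 * y)))
    weights x y = ≤-trans (m≤m+n _ _) (≤-reflexive (sym (expand x y)))
      where
      expand : ∀ x y → 200 * (3 * x + 5 * y) * ((3 * y + 5 * (x + 1 * y)) + (3 * y + 5 * (x + 2 * y))) ≡
               201 * ((3 * y + 5 * (x + 1 * y)) * (3 * y + 5 * (x + 2 * y))) + (975 * (x * x) + 1495 * (x * y) + 96 * (y * y))
      expand = solve-∀

  Λ D : ℕ
  Λ = num * num
  D = den * den

  instance
    den≢0 : NonZero den
    den≢0 = >-nonZero 0<den
    D≢0 : NonZero D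
    D≢0 = m*n≢0 den den

  D≤Λ : D ≤ Λ
  D≤Λ = *-mono-≤ den≤num den≤num

  -- The inequality 1/(5x+8y) + 1/(5x+13y) ≥ (201/200) / (3x+5y) makes the sum
  -- of the inverse weights grow by a factor 201/200 with every letter.
  branching : ∀ s {r t₁ t₂} .{{_ : NonZero (proj₂ s)}} →
              r ≤ t₁ * weight (append one s) → r ≤ t₂ * weight (append two s) →
              num * r ≤ den * (t₁ + t₂) * weight s
  branching s@(x , y) {r} {t₁} {t₂} r≤₁ r≤₂ = *-cancelʳ-≤ _ _ (z₁ * z₂) {{m*n≢0 z₁ z₂ {{z₁≢0}} {{z₂≢0}}}} (begin
    num * r * (z₁ * z₂)                                ≡⟨ eq₁ num r (z₁ * z₂) ⟩
    r * (num * (z₁ * z₂))                              ≤⟨ *-monoʳ-≤ r (weights x y) ⟩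
    r * (den * z * (z₁ + z₂))                          ≡⟨ eq₂ den r z z₁ z₂ ⟩
    den * z * (r * z₂ + r * z₁)                        ≤⟨ *-monoʳ-≤ (den * z) (+-mono-≤ (*-monoˡ-≤ z₂ r≤₁) (*-monoˡ-≤ z₁ r≤₂)) ⟩
    den * z * (t₁ * z₁ * z₂ + t₂ * z₂ * z₁)            ≡⟨ eq₃ den z t₁ t₂ z₁ z₂ ⟩
    den * (t₁ + t₂) * z * (z₁ * z₂)                    ∎)
    where
    open ≤-Reasoning
    z = weight s
    z₁ = weight (append one s)
    z₂ = weight (append two s)
    weight≢0 : ∀ b → NonZero (weight (append b s))
    weight≢0 b = >-nonZero (<-≤-trans (>-nonZero⁻¹ y) (≤-trans (m≤m+n y (2 * y)) (m≤m+n (3 * y) _)))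
    z₁≢0 = weight≢0 one
    z₂≢0 = weight≢0 two
    eq₁ : ∀ n r w → n * r * w ≡ r * (n * w)
    eq₁ = solve-∀
    eq₂ : ∀ n r z z₁ z₂ → r * (n * z * (z₁ + z₂)) ≡ n * z * (r * z₂ + r * z₁)
    eq₂ = solve-∀
    eq₃ : ∀ n z t₁ t₂ z₁ z₂ → n * z * (t₁ * z₁ * z₂ + t₂ * z₂ * z₁) ≡ n * (t₁ + t₂) * z * (z₁ * z₂)
    eq₃ = solve-∀

  y≢0-append : ∀ b s → NonZero (proj₂ s) → NonZero (proj₂ (append b s))
  y≢0-append one (x , suc y) _ = >-nonZero (<-≤-trans (s≤s z≤n) (m≤n+m (1 * suc y) x))
  y≢0-append two (x , suc y) _ = >-nonZero (<-≤-trans (s≤s z≤n) (m≤n+m (2 * suc y) x))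

  weight-append-≤ : ∀ b s → weight (append b s) ≤ 3 * weight s
  weight-append-≤ one (x , y) = ≤-trans (m≤m+n _ (4 * x + 7 * y)) (≤-reflexive (eq x y))
    where
    eq : ∀ x y → 3 * y + 5 * (x + 1 * y) + (4 * x + 7 * y) ≡ 3 * (3 * x + 5 * y)
    eq = solve-∀
  weight-append-≤ two (x , y) = ≤-trans (m≤m+n _ (4 * x + 2 * y)) (≤-reflexive (eq x y))
    where
    eq : ∀ x y → 3 * y + 5 * (x + 2 * y) + (4 * x + 2 * y) ≡ 3 * (3 * x + 5 * y)
    eq = solve-∀

  weight-step-≤ : ∀ s d → weight (step s d) ≤ 9 * weight s
  weight-step-≤ s (b , b′) = ≤-trans (weight-append-≤ b′ (append b s))
    (≤-trans (*-monoʳ-≤ 3 (weight-append-≤ b s)) (≤-reflexive (sym (*-assoc 3 3 (weight s)))))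

  weight-append-one : ∀ b s → weight (append one s) ≤ weight (append b s)
  weight-append-one one s       = ≤-refl
  weight-append-one two (x , y) = +-monoʳ-≤ (3 * y) (*-monoʳ-≤ 5 (+-monoʳ-≤ x (*-monoˡ-≤ y (n≤1+n 1))))

  2*weight≤ : ∀ s d → 2 * weight s ≤ weight (step s d)
  2*weight≤ s@(x , y) (b , b′) = ≤-trans (≤-trans (m≤m+n _ (2 * x + 3 * y)) (≤-reflexive (eq x y)))
    (≤-trans (mono b) (weight-append-one b′ (append b s)))
    where
    eq : ∀ x y → 2 * (3 * x + 5 * y) + (2 * x + 3 * y) ≡ 3 * (x + 1 * y) + 5 * (y + 1 * (x + 1 * y))
    eq = solve-∀
    mono : ∀ b → weight (append one (append one s)) ≤ weight (append one (append b s))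
    mono one = ≤-refl
    mono two = +-mono-≤ (*-monoʳ-≤ 3 le) (*-monoʳ-≤ 5 (+-monoʳ-≤ y (*-monoʳ-≤ 1 le)))
      where
      le : x + 1 * y ≤ x + 2 * y
      le = +-monoʳ-≤ x (*-monoˡ-≤ y (n≤1+n 1))

  branching₂ : ∀ s {r} (t : Pair → ℕ) → NonZero (proj₂ s) → (∀ d → r ≤ t d * weight (step s d)) →
               Λ * r ≤ D * (t (one , one) + (t (one , two) + (t (two , one) + t (two , two)))) * weight s
  branching₂ s {r} t y≢0 r≤ = begin
    Λ * r                 ≡⟨ *-assoc num num r ⟩
    num * (num * r)           ≤⟨ branching s {num * r} {den * (t (one , one) + t (one , two))} {den * (t (two , one) + t (two , two))} {{y≢0}} (inner one) (inner two) ⟩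
    den * (den * (t (one , one) + t (one , two)) + den * (t (two , one) + t (two , two))) * weight s
                              ≡⟨ eq den (t (one , one)) (t (one , two)) (t (two , one)) (t (two , two)) (weight s) ⟩
    D * (t (one , one) + (t (one , two) + (t (two , one) + t (two , two)))) * weight s ∎
    where
    open ≤-Reasoning
    inner : ∀ b → num * r ≤ den * (t (b , one) + t (b , two)) * weight (append b s)
    inner b = branching (append b s) {r} {t (b , one)} {t (b , two)} {{y≢0-append b s y≢0}} (r≤ (b , one)) (r≤ (b , two))
    eq : ∀ n t₁ t₂ t₃ t₄ z → n * (n * (t₁ + t₂) + n * (t₃ + t₄)) * z ≡ n * n * (t₁ + (t₂ + (t₃ + t₄))) * z
    eq = solve-∀

  -- Each leaf has weight above N, so the number of leaves is at least N times the sum of their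
  -- inverse weights, and this sum gains a factor Λ / D with every pair. A pair multiplies the
  -- weight by at most 9, so 9^k * weight s ≤ 9 * N guarantees k pairs before a leaf.
  length-grow : ∀ N n s k → NonZero (proj₂ s) → N < 2 ^ n * weight s → 9 ^ k * weight s ≤ 9 * N →
                Λ ^ k * N ≤ D ^ k * length (grow N n s) * weight s
  length-grow N n s k y≢0 fuel bound = go n s k y≢0 fuel bound
    where
    leaf : ∀ k z → N < z → 9 ^ k * z ≤ 9 * N → Λ ^ k * N ≤ D ^ k * 1 * z
    leaf zero    z N<z _  = ≤-trans (≤-reflexive (*-identityˡ N)) (≤-trans (<⇒≤ N<z) (≤-reflexive (sym (*-identityˡ z))))
    leaf (suc k) z N<z le = contradiction (*-monoʳ-< 9 N<z) (≤⇒≯ (≤-trans (*-monoʳ-≤ 9 (m≤n*m z (9 ^ k) {{m^n≢0 9 k}}))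
      (≤-trans (≤-reflexive (sym (*-assoc 9 (9 ^ k) z))) le)))

    go : ∀ n s k → NonZero (proj₂ s) → N < 2 ^ n * weight s → 9 ^ k * weight s ≤ 9 * N →
         Λ ^ k * N ≤ D ^ k * length (grow N n s) * weight s
    go zero s k _ fuel bound = leaf k (weight s) (≤-trans fuel (≤-reflexive (*-identityˡ _))) bound
    go (suc n) s k y≢0 fuel bound with N <? weight s
    ... | yes N<z = leaf k (weight s) N<z bound
    ... | no N≮z  = ≤-trans (by k bound) (≤-reflexive (cong (λ l → D ^ k * l * weight s) (sym lengths)))
      where
      T : Pair → ℕ
      T d = length (grow N n (step s d))
      ΣT = T (one , one) + (T (one , two) + (T (two , one) + T (two , two)))
      branch : Pair → List (List Pair)
      branch d = map (d ∷_) (grow N n (step s d))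
      |branch| : ∀ d → length (branch d) ≡ T d
      |branch| d = length-map (d ∷_) (grow N n (step s d))
      lengths : length (branch (one , one) ++ branch (one , two) ++ branch (two , one) ++ branch (two , two)) ≡ ΣT
      lengths = trans (length-++ (branch (one , one))) (cong₂ _+_ (|branch| (one , one))
        (trans (length-++ (branch (one , two))) (cong₂ _+_ (|branch| (one , two))
          (trans (length-++ (branch (two , one))) (cong₂ _+_ (|branch| (two , one)) (|branch| (two , two)))))))
      IH : ∀ k d → 9 ^ k * weight (step s d) ≤ 9 * N → Λ ^ k * N ≤ D ^ k * T d * weight (step s d)
      IH k d = go n (step s d) k (y≢0-append (proj₂ d) (append (proj₁ d) s) (y≢0-append (proj₁ d) s y≢0))
        (<-≤-trans fuel (≤-trans (≤-reflexive (eq (2 ^ n) (weight s))) (*-monoʳ-≤ (2 ^ n) (2*weight≤ s d))))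
        where
        eq : ∀ u z → 2 * u * z ≡ u * (2 * z)
        eq = solve-∀
      by : ∀ k → 9 ^ k * weight s ≤ 9 * N → Λ ^ k * N ≤ D ^ k * ΣT * weight s
      -- The guaranteed pairs are used up although the weight is still at most N. It suffices that a
      -- further pair does not decrease the sum, by D ≤ Λ.
      by zero    _     = *-cancelˡ-≤ D (begin
        D * (1 * N)             ≤⟨ *-monoˡ-≤ (1 * N) D≤Λ ⟩
        Λ * (1 * N)             ≤⟨ branching₂ s T y≢0 (λ d → ≤-trans (IH 0 d (≤-trans (≤-reflexive (*-identityˡ _))
                                         (≤-trans (weight-step-≤ s d) (*-monoʳ-≤ 9 (≮⇒≥ N≮z)))))
                                         (≤-reflexive (cong (_* weight (step s d)) (*-identityˡ (T d))))) ⟩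
        D * ΣT * weight s       ≡⟨ eq ΣT (weight s) ⟩
        D * (1 * ΣT * weight s) ∎)
        where
        open ≤-Reasoning
        eq : ∀ t z → D * t * z ≡ D * (1 * t * z)
        eq t z = trans (*-assoc D t z) (cong (λ u → D * (u * z)) (sym (*-identityˡ t)))
      by (suc k) bound = begin
        Λ * Λ ^ k * N                  ≡⟨ *-assoc Λ (Λ ^ k) N ⟩
        Λ * (Λ ^ k * N)                ≤⟨ branching₂ s (λ d → D ^ k * T d) y≢0 (λ d → IH k d
                                                    (≤-trans (*-monoʳ-≤ (9 ^ k) (weight-step-≤ s d))
                                                    (≤-trans (≤-reflexive (eq₁ (9 ^ k) (weight s))) bound))) ⟩
        D * (Dᵏ * T (one , one) + (Dᵏ * T (one , two) + (Dᵏ * T (two , one) + Dᵏ * T (two , two)))) * weight s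
                                               ≡⟨ eq₂ D Dᵏ (T (one , one)) (T (one , two)) (T (two , one)) (T (two , two)) (weight s) ⟩
        D * Dᵏ * ΣT * weight s             ∎
        where
        open ≤-Reasoning
        Dᵏ = D ^ k
        eq₁ : ∀ u z → u * (9 * z) ≡ 9 * u * z
        eq₁ = solve-∀
        eq₂ : ∀ u v a b c d z → u * (v * a + (v * b + (v * c + v * d))) * z ≡ u * v * (a + (b + (c + d))) * z
        eq₂ = solve-∀

  run : State → List Pair → State
  run = foldl step

  weight-grow : ∀ N n s {w} → weight s ≤ 9 * N → w ∈ grow N n s → weight (run s w) ≤ 9 * N
  weight-grow N zero    s z≤ (here refl) = z≤
  weight-grow N (suc n) s z≤ w∈ with N <? weight s
  weight-grow N (suc n) s z≤ (here refl) | yes _ = z≤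
  weight-grow N (suc n) s {w} z≤ w∈ | no N≮z = cases (∈-++⁻ (branch (one , one)) w∈)
    where
    branch : Pair → List (List Pair)
    branch d = map (d ∷_) (grow N n (step s d))
    in-branch : ∀ d → w ∈ branch d → weight (run s w) ≤ 9 * N
    in-branch d w∈ with w′ , w′∈ , refl ← ∈-map⁻ (d ∷_) w∈ =
      weight-grow N n (step s d) (≤-trans (weight-step-≤ s d) (*-monoʳ-≤ 9 (≮⇒≥ N≮z))) w′∈
    cases : w ∈ branch (one , one) ⊎ w ∈ branch (one , two) ++ branch (two , one) ++ branch (two , two) → weight (run s w) ≤ 9 * N
    cases (inj₁ w∈) = in-branch (one , one) w∈
    cases (inj₂ w∈) with ∈-++⁻ (branch (one , two)) w∈
    ... | inj₁ w∈ = in-branch (one , two) w∈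
    ... | inj₂ w∈ with ∈-++⁻ (branch (two , one)) w∈
    ...   | inj₁ w∈ = in-branch (two , one) w∈
    ...   | inj₂ w∈ = in-branch (two , two) w∈

  grow-unique : ∀ N n s → Unique (grow N n s)
  grow-unique N zero    s = [] ∷ []
  grow-unique N (suc n) s with N <? weight s
  ... | yes _ = [] ∷ []
  ... | no _  = Unique.++⁺ (branch! (one , one)) (Unique.++⁺ (branch! (one , two)) (Unique.++⁺ (branch! (two , one)) (branch! (two , two))
      (disjoint λ ())) (disjoint₂ (λ ()) (λ ()))) (disjoint₃ (λ ()) (λ ()) (λ ()))
    where
    branch : Pair → List (List Pair)
    branch d = map (d ∷_) (grow N n (step s d))
    branch! : ∀ d → Unique (branch d)
    branch! d = Unique.map⁺ ∷-injectiveʳ (grow-unique N n (step s d))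
    disjoint : ∀ {d d′} → d ≢ d′ → Disjoint (branch d) (branch d′)
    disjoint {d} {d′} d≢d′ (w∈ , w∈′) with _ , _ , refl ← ∈-map⁻ (d ∷_) w∈ with _ , _ , refl ← ∈-map⁻ (d′ ∷_) w∈′ = d≢d′ refl
    disjoint₂ : ∀ {d d₁ d₂} → d ≢ d₁ → d ≢ d₂ → Disjoint (branch d) (branch d₁ ++ branch d₂)
    disjoint₂ {d₁ = d₁} ≢₁ ≢₂ (w∈ , w∈′) with ∈-++⁻ (branch d₁) w∈′
    ... | inj₁ w∈₁ = disjoint ≢₁ (w∈ , w∈₁)
    ... | inj₂ w∈₂ = disjoint ≢₂ (w∈ , w∈₂)
    disjoint₃ : ∀ {d d₁ d₂ d₃} → d ≢ d₁ → d ≢ d₂ → d ≢ d₃ → Disjoint (branch d) (branch d₁ ++ branch d₂ ++ branch d₃)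
    disjoint₃ {d₁ = d₁} ≢₁ ≢₂ ≢₃ (w∈ , w∈′) with ∈-++⁻ (branch d₁) w∈′
    ... | inj₁ w∈₁ = disjoint ≢₁ (w∈ , w∈₁)
    ... | inj₂ w∈₂ = disjoint₂ ≢₂ ≢₃ (w∈ , w∈₂)

  -- After an even number of letters the state (x , y) satisfies x < y, and the
  -- last two letters are recovered from it by division with remainder.
  Reachable : State → Set
  Reachable (x , y) = x < y

  append-reachable : ∀ b s → Reachable s → 0 < proj₁ (append b s) × proj₁ (append b s) ≤ proj₂ (append b s)
  append-reachable one (x , y) x<y = ≤-<-trans z≤n x<y , ≤-trans (≤-reflexive (sym (*-identityˡ y))) (m≤n+m (1 * y) x)
  append-reachable two (x , y) x<y = ≤-<-trans z≤n x<y , ≤-trans (m≤m+n y _) (m≤n+m (2 * y) x)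

  step-reachable : ∀ s d → Reachable s → Reachable (step s d)
  step-reachable s (b , b′) r = go b′ (proj₁ (append-reachable b s r))
    where
    go : ∀ b′ {X Y} → 0 < X → Y < X + digit b′ * Y
    go one {Y = Y} 0<X = +-mono-≤ 0<X (≤-reflexive (sym (*-identityˡ Y)))
    go two {Y = Y} 0<X = +-mono-≤ 0<X (m≤m+n Y _)

  run-reachable : ∀ s w → Reachable s → Reachable (run s w)
  run-reachable s []      r = r
  run-reachable s (d ∷ w) r = run-reachable (step s d) w (step-reachable s d r)

  quotient-< : ∀ {x x′ y} b b′ → x < y → x′ < y → x + digit b * y ≡ x′ + digit b′ * y → b ≡ b′ × x ≡ x′
  quotient-< {y = y} one one _ _ eq = refl , +-cancelʳ-≡ (1 * y) _ _ eq
  quotient-< {y = y} two two _ _ eq = refl , +-cancelʳ-≡ (2 * y) _ _ eq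
  quotient-< {x} {x′} {y} one two x<y _ eq = contradiction eq (<⇒≢ (<-≤-trans (+-monoˡ-< (1 * y) x<y) (m≤n+m (2 * y) x′)))
  quotient-< {x} {x′} {y} two one _ x′<y eq = contradiction (sym eq) (<⇒≢ (<-≤-trans (+-monoˡ-< (1 * y) x′<y) (m≤n+m (2 * y) x)))

  -- After an odd number of letters the two coordinates may coincide, as in (1 , 1), so the last
  -- letter of a pair is read off with remainders in (0 , y] and the first one with remainders in [0
  -- , y).
  quotient-≤ : ∀ {x x′ y} b b′ → 0 < x → x ≤ y → 0 < x′ → x′ ≤ y →
               x + digit b * y ≡ x′ + digit b′ * y → b ≡ b′ × x ≡ x′
  quotient-≤ {y = y} one one _ _ _ _ eq = refl , +-cancelʳ-≡ (1 * y) _ _ eq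
  quotient-≤ {y = y} two two _ _ _ _ eq = refl , +-cancelʳ-≡ (2 * y) _ _ eq
  quotient-≤ {x} {x′} {y} one two _ x≤y 0<x′ _ eq =
    contradiction eq (<⇒≢ (≤-<-trans (+-monoˡ-≤ (1 * y) x≤y) (+-monoˡ-< (2 * y) 0<x′)))
  quotient-≤ {x} {x′} {y} two one 0<x _ _ x′≤y eq =
    contradiction (sym eq) (<⇒≢ (≤-<-trans (+-monoˡ-≤ (1 * y) x′≤y) (+-monoˡ-< (2 * y) 0<x)))

  step-injective : ∀ s s′ d d′ → Reachable s → Reachable s′ → step s d ≡ step s′ d′ → s ≡ s′ × d ≡ d′
  step-injective s@(x , y) s′@(x′ , y′) (b₁ , b₂) (b₁′ , b₂′) r r′ eq
    with append-reachable b₁ s r | append-reachable b₁′ s′ r′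
  ... | 0<y , y≤X | 0<y′ , y′≤X with cong proj₁ eq
  ...   | X≡ with quotient-≤ {y} {y′} b₂ b₂′ 0<y y≤X 0<y′ (subst (y′ ≤_) (sym X≡) y′≤X)
                    (trans (cong proj₂ eq) (cong (λ X → y′ + digit b₂′ * X) (sym X≡)))
  ...     | refl , refl with quotient-< b₁ b₁′ r r′ X≡
  ...       | refl , refl = refl , refl

  -- Pairs are read off from the end of the word. The vanishing first coordinate of the initial
  -- state signals when to stop, since every nonempty word makes it positive.
  run-injective : ∀ s → Reachable s → proj₁ s ≡ 0 → ∀ w w′ → run s w ≡ run s w′ → w ≡ w′
  run-injective s r s₀ w w′ = go (reverseView w) (reverseView w′)
    where
    0<step : ∀ s d → Reachable s → 0 < proj₁ (step s d)
    0<step s (b , b′) r = let 0<X , X≤Y = append-reachable b s r in <-≤-trans 0<X X≤Y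
    go : ∀ {w w′} → Reverse w → Reverse w′ → run s w ≡ run s w′ → w ≡ w′
    go [] [] _ = refl
    go [] (w′ ∶ _ ∶ʳ d′) eq = contradiction (trans (sym s₀) (cong proj₁ (trans eq (foldl-∷ʳ step s d′ w′))))
      (<⇒≢ (0<step (run s w′) d′ (run-reachable s w′ r)))
    go (w ∶ _ ∶ʳ d) [] eq = contradiction (trans (sym s₀) (cong proj₁ (trans (sym eq) (foldl-∷ʳ step s d w))))
      (<⇒≢ (0<step (run s w) d (run-reachable s w r)))
    go (w ∶ rw ∶ʳ d) (w′ ∶ rw′ ∶ʳ d′) eq =
      let s≡ , d≡ = step-injective (run s w) (run s w′) d d′ (run-reachable s w r) (run-reachable s w′ r)
                      (trans (sym (foldl-∷ʳ step s d w)) (trans eq (foldl-∷ʳ step s d′ w′)))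
      in cong₂ _∷ʳ_ (go rw rw′ s≡) d≡

  letters : List Pair → List Digit
  letters []            = []
  letters ((b , b′) ∷ w) = b ∷ b′ ∷ letters w

  infixl 7 _◃_
  _◃_ : State → Matℕ → State
  (x , y) ◃ matℕ a b c d = x * a + y * c , x * b + y * d

  append-◃ : ∀ b s X → append b s ◃ X ≡ s ◃ prepend b X
  append-◃ b (x , y) (matℕ e f g h) = cong₂ _,_ (lem x y (digit b) e g) (lem x y (digit b) f h)
    where
    lem : ∀ x y b e g → y * e + (x + b * y) * g ≡ x * g + y * (e + b * g)
    lem = solve-∀

  run-◃ : ∀ s w → run s w ≡ s ◃ convergents (letters w)
  run-◃ (x , y) [] = cong₂ _,_ (lem₁ x y) (lem₂ x y)
    where
    lem₁ : ∀ x y → x ≡ x * 1 + y * 0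
    lem₁ = solve-∀
    lem₂ : ∀ x y → y ≡ x * 0 + y * 1
    lem₂ = solve-∀
  run-◃ s ((b , b′) ∷ w) = trans (run-◃ (step s (b , b′)) w)
    (trans (append-◃ b′ (append b s) (convergents (letters w))) (append-◃ b s _))

  run-bottom : ∀ w → run (0 , 1) w ≡ (n₂₁ (convergents (letters w)) , n₂₂ (convergents (letters w)))
  run-bottom w = trans (run-◃ (0 , 1) w) (cong₂ _,_ (*-identityˡ _) (*-identityˡ _))

  -- The top row of the matrix of a nonempty word is bounded by its bottom row.
  size-≤ : ∀ w → size (convergents (letters w)) ≤ 2 * (n₂₁ (convergents (letters w)) + n₂₂ (convergents (letters w)))
  size-≤ [] = ≤-refl
  size-≤ ((b , b′) ∷ w) with convergents (letters w)
  ... | matℕ x y z u = ≤-trans (≤-reflexive (+-assoc (X + Y) _ _)) (≤-trans (+-monoˡ-≤ _ (+-mono-≤ (bound b z X) (bound b u Y)))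
        (≤-reflexive (cong (S +_) (sym (+-identityʳ S)))))
    where
    X = x + digit b′ * z
    Y = y + digit b′ * u
    S = z + digit b * X + (u + digit b * Y)
    bound : ∀ b z X → X ≤ z + digit b * X
    bound one z X = ≤-trans (≤-reflexive (sym (*-identityˡ X))) (m≤n+m (1 * X) z)
    bound two z X = ≤-trans (m≤m+n X _) (m≤n+m (2 * X) z)

-- From subsets of SL₂ to denominators divisible by p

module Reach (p : ℕ) (p-prime : Prime p) where

  open Counting
  open Words
  open Stopping
  open PrimeField p p-prime hiding (_*_; _-_; _+_; -_)
  module 𝔽 = PrimeField p p-prime
  open Solver using (solve; _⊜_; _⊕_; _⊗_; _⊖_; #_)
  open SL2 p p-prime
  open Geometry p p-prime
  open Growth p p-prime using (tripling⇒large)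
  open Gowers p p-prime using (mixing; matrices; ∈-matrices; matrices-length)
  open Ruzsa _≟ᴳ_ _∙_ e _⁻¹ SL₂-isGroup
  open import Data.Nat.Base hiding (_⊔_)
  open import Data.Nat.Properties hiding (_≟_)
  open import Data.Nat.Tactic.RingSolver using (solve-∀)
  open import Data.Integer.Base using () renaming (+_ to pos)
  import Data.Integer.Properties as ℤ
  open import Data.Fin.Base as Fin using (Fin; toℕ)
  import Data.Fin.Properties as Fin
  import Data.List.Base as List
  open import Data.List.Properties using (length-map; ++-assoc)
  open import Data.List.Relation.Unary.Any.Properties using (lookup-index)
  open import Data.List.Relation.Unary.Unique.DecPropositional.Properties _≟ᴳ_ using (deduplicate-!)

  open Group group using (assoc; identityˡ; identityʳ; inverseˡ)
  open GroupProperties group using (∙-cancelˡ; ∙-cancelʳ; inverseʳ-unique)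

  ⟪_⟫ : ℕ → F
  ⟪ n ⟫ = ⟦ pos n ⟧

  reduce : Matℕ → Mat
  reduce (matℕ a b c d) = mat ⟪ a ⟫ ⟪ b ⟫ ⟪ c ⟫ ⟪ d ⟫

  reduce-⊠ : ∀ X Y → reduce (X ⊠ Y) ≡ reduce X ⊛ reduce Y
  reduce-⊠ (matℕ a b c d) (matℕ e f g h) = mat-≡ (lem a e b g) (lem a f b h) (lem c e d g) (lem c f d h)
    where
    ⟪*⟫ : ∀ x y → ⟪ x * y ⟫ ≡ ⟪ x ⟫ 𝔽.* ⟪ y ⟫
    ⟪*⟫ x y = trans (cong ⟦_⟧ (ℤ.pos-* x y)) (⟦⟧-* (pos x) (pos y))
    lem : ∀ x y z w → ⟪ x * y + z * w ⟫ ≡ (⟪ x ⟫ 𝔽.* ⟪ y ⟫) 𝔽.+ (⟪ z ⟫ 𝔽.* ⟪ w ⟫)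
    lem x y z w = trans (cong ⟦_⟧ (ℤ.pos-+ (x * y) (z * w)))
      (trans (⟦⟧-+ (pos (x * y)) (pos (z * w))) (cong₂ 𝔽._+_ (⟪*⟫ x y) (⟪*⟫ z w)))

  abstract
    det-pair : ∀ b b′ → det (reduce (convergents (b ∷ b′ ∷ []))) ≡ 1#
    det-pair one one = solve 0 (# 1 ⊗ # 2 ⊖ # 1 ⊗ # 1 ⊜ # 1) refl
    det-pair one two = solve 0 (# 1 ⊗ # 3 ⊖ # 2 ⊗ # 1 ⊜ # 1) refl
    det-pair two one = solve 0 (# 1 ⊗ # 3 ⊖ # 1 ⊗ # 2 ⊜ # 1) refl
    det-pair two two = solve 0 (# 1 ⊗ # 5 ⊖ # 2 ⊗ # 2 ⊜ # 1) refl

  pairElement : Pair → SL₂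
  pairElement (b , b′) = sl (reduce (convergents (b ∷ b′ ∷ []))) (det-pair b b′)

  -- Reduction modulo p forgets the size of the integral matrix, so a word over g is carried along.
  -- The sum of the entries serves as size because it is submultiplicative.
  record Lifts (S : ℕ) (g : SL₂) : Set where
    constructor lifts
    field
      word     : List Digit
      reduced  : matrix g ≡ reduce (convergents word)
      bounded  : size (convergents word) ≤ S

  lifts-∙ : ∀ {S T g h} → Lifts S g → Lifts T h → Lifts (S * T) (g ∙ h)
  lifts-∙ {g = g} {h} (lifts v v≡ v≤) (lifts w w≡ w≤) = lifts (v ++ w)
    (trans (matrix-∙ g h) (trans (cong₂ _⊛_ v≡ w≡)
      (trans (sym (reduce-⊠ (convergents v) (convergents w))) (cong reduce (sym (convergents-++ v w))))))
    (≤-trans (≤-reflexive (cong size (convergents-++ v w)))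
      (≤-trans (size-⊠ (convergents v) (convergents w)) (*-mono-≤ v≤ w≤)))

  lifts-mono : ∀ {S T g} → S ≤ T → Lifts S g → Lifts T g
  lifts-mono S≤T (lifts w w≡ w≤) = lifts w w≡ (≤-trans w≤ S≤T)

  lifts-pair : ∀ d → Lifts 10 (pairElement d)
  lifts-pair d@(b , b′) = lifts (b ∷ b′ ∷ []) refl (bound b b′)
    where
    bound : ∀ b b′ → size (convergents (b ∷ b′ ∷ [])) ≤ 10
    bound one one = ≤ᵇ⇒≤ 5 10 _
    bound one two = ≤ᵇ⇒≤ 7 10 _
    bound two one = ≤ᵇ⇒≤ 7 10 _
    bound two two = ≤ᵇ⇒≤ 10 10 _

  lifts-e : Lifts 2 e
  lifts-e = lifts [] matrix-e ≤-refl

  element : List Pair → SL₂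
  element []      = e
  element (d ∷ w) = pairElement d ∙ element w

  matrix-element : ∀ w → matrix (element w) ≡ reduce (convergents (letters w))
  matrix-element []            = matrix-e
  matrix-element (d@(b , b′) ∷ w) = trans (matrix-∙ (pairElement d) (element w))
    (trans (cong (reduce (convergents (b ∷ b′ ∷ [])) ⊛_) (matrix-element w))
      (trans (sym (reduce-⊠ (convergents (b ∷ b′ ∷ [])) (convergents (letters w))))
        (cong reduce (sym (convergents-++ (b ∷ b′ ∷ []) (letters w))))))

  g₂₂ : SL₂
  g₂₂ = pairElement (two , two)

  matrix-∙-g₂₂ : ∀ {g} v → matrix g ≡ reduce (convergents v) →
                 matrix (g ∙ g₂₂) ≡ reduce (convergents ((v ++ two ∷ []) ++ two ∷ []))
  matrix-∙-g₂₂ {g} v v≡ = trans (matrix-∙ g g₂₂) (trans (cong (_⊛ reduce (convergents (two ∷ two ∷ []))) v≡)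
    (trans (sym (reduce-⊠ (convergents v) (convergents (two ∷ two ∷ []))))
      (cong reduce (trans (sym (convergents-++ v (two ∷ two ∷ []))) (cong convergents (sym (++-assoc v (two ∷ []) (two ∷ []))))))))

  size-snoc : ∀ v {S} → size (convergents v) ≤ S → size (convergents (v ++ two ∷ [])) ≤ S * 4
  size-snoc v v≤ = ≤-trans (≤-reflexive (cong size (convergents-++ v (two ∷ []))))
    (≤-trans (size-⊠ (convergents v) (convergents (two ∷ []))) (*-monoˡ-≤ 4 v≤))

  lifts⇒admissible₂₂ : ∀ {S g} → Lifts S g → m₂₂ (matrix (g ∙ g₂₂)) ≡ 0# → Admissible p (S * 4 * 4)
  lifts⇒admissible₂₂ (lifts v v≡ v≤) eq = admissible (v ++ two ∷ [])
    (⟦⟧≡0⇒∣ (trans (cong m₂₂ (sym (matrix-∙-g₂₂ v v≡))) eq))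
    (≤-trans (n₂₂≤size (convergents ((v ++ two ∷ []) ++ two ∷ []))) (size-snoc (v ++ two ∷ []) (size-snoc v v≤)))

  -- The lower left entry of the matrix of a word is the lower right entry of
  -- the matrix of the word without its last letter.
  lifts⇒admissible₂₁ : ∀ {S g} → Lifts S g → m₂₁ (matrix (g ∙ g₂₂)) ≡ 0# → Admissible p (S * 4)
  lifts⇒admissible₂₁ (lifts v v≡ v≤) eq = admissible v
    (⟦⟧≡0⇒∣ (trans (cong ⟪_⟫ shift) (trans (cong m₂₁ (sym (matrix-∙-g₂₂ v v≡))) eq)))
    (≤-trans (n₂₂≤size (convergents (v ++ two ∷ []))) (size-snoc v v≤))
    where
    w = v ++ two ∷ []
    lem : ∀ c d → d ≡ c * 0 + d * 1
    lem = solve-∀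
    shift : n₂₂ (convergents w) ≡ n₂₁ (convergents (w ++ two ∷ []))
    shift = trans (lem (n₂₁ (convergents w)) (n₂₂ (convergents w)))
      (cong n₂₁ (sym (convergents-++ w (two ∷ []))))

  module _ where

    private
      twos : ℕ → SL₂
      twos n = element (replicate n (two , two))

      twos-+ : ∀ m n → twos (m + n) ≡ twos m ∙ twos n
      twos-+ zero    n = sym (identityˡ (twos n))
      twos-+ (suc m) n = trans (cong (g₂₂ ∙_) (twos-+ m n)) (sym (assoc g₂₂ (twos m) (twos n)))

      lifts-twos : ∀ n → Lifts (10 ^ suc n) (twos n)
      lifts-twos zero    = lifts-mono (≤ᵇ⇒≤ 2 10 _) lifts-e
      lifts-twos (suc n) = lifts-∙ (lifts-pair (two , two)) (lifts-twos n)

      position : ℕ → Fin (length matrices)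
      position n = index (∈-matrices (matrix (twos n)))

      position-injective : ∀ m n → position m ≡ position n → twos m ≡ twos n
      position-injective m n eq = matrix-injective (trans (lookup-index (∈-matrices (matrix (twos m))))
        (trans (cong (lookup matrices) eq) (sym (lookup-index (∈-matrices (matrix (twos n)))))))

      -- Cancelling `twos m` shows that g₂₂ to the power k + 1 is the identity, whose lower left
      -- entry is 0.
      twos-period : ∀ m k → twos m ≡ twos (suc m + k) → m₂₁ (matrix (twos k ∙ g₂₂)) ≡ 0#
      twos-period m k eq = trans (cong (m₂₁ ∘ matrix) closes) (cong m₂₁ matrix-e)
        where
        g₂₂∙≡e : g₂₂ ∙ twos k ≡ e
        g₂₂∙≡e = ∙-cancelˡ (twos m) _ _ (trans (sym (twos-+ m (suc k)))
          (trans (cong twos (+-suc m k)) (trans (sym eq) (sym (identityʳ (twos m))))))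
        closes : twos k ∙ g₂₂ ≡ e
        closes = trans (cong (_∙ g₂₂) (inverseʳ-unique g₂₂ (twos k) g₂₂∙≡e)) (inverseˡ g₂₂)

    -- The powers of the matrix of [2, 2] modulo p are periodic.
    small-prime : Admissible p (10 ^ (p * (p * (p * p))) * 4)
    small-prime = collide (Fin.pigeonhole (n<1+n (length matrices)) (position ∘ toℕ))
      where
      collide : (∃₂ λ (i j : Fin (suc (length matrices))) → i Fin.< j × position (toℕ i) ≡ position (toℕ j)) →
                Admissible p (10 ^ (p * (p * (p * p))) * 4)
      collide (i , j , i<j , eq) =
        let k , i+k≡j = m≤n⇒∃[o]m+o≡n i<j
            k<p⁴ : suc k ≤ p * (p * (p * p))
            k<p⁴ = ≤-trans (s≤s (m≤n+m k (toℕ i))) (≤-trans (≤-reflexive i+k≡j)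
                     (≤-trans (s≤s⁻¹ (Fin.toℕ<n j)) (≤-reflexive matrices-length)))
        in admissible-mono (*-monoˡ-≤ 4 (^-monoʳ-≤ 10 k<p⁴))
             (lifts⇒admissible₂₁ (lifts-twos k) (twos-period (toℕ i) k
               (trans (position-injective (toℕ i) (toℕ j) eq) (cong twos (sym i+k≡j)))))

  abstract
    pair-one-one : pairElement (one , one) ≡ g₀
    pair-one-one = matrix-injective refl

    pair-one-two : pairElement (one , two) ≡ g₀ ∙ U 1#
    pair-one-two = matrix-injective (trans (mat-≡
      (solve 0 (# 1 ⊜ # 1 ⊗ # 1 ⊕ # 1 ⊗ # 0) refl)
      (solve 0 (# 2 ⊜ # 1 ⊗ # 1 ⊕ # 1 ⊗ # 1) refl)
      (solve 0 (# 1 ⊜ # 1 ⊗ # 1 ⊕ # 2 ⊗ # 0) refl)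
      (solve 0 (# 3 ⊜ # 1 ⊗ # 1 ⊕ # 2 ⊗ # 1) refl))
      (sym (matrix-∙ g₀ (U 1#))))

    pair-two-one : pairElement (two , one) ≡ L 1# ∙ g₀
    pair-two-one = matrix-injective (trans (mat-≡
      (solve 0 (# 1 ⊜ # 1 ⊗ # 1 ⊕ # 0 ⊗ # 1) refl)
      (solve 0 (# 1 ⊜ # 1 ⊗ # 1 ⊕ # 0 ⊗ # 2) refl)
      (solve 0 (# 2 ⊜ # 1 ⊗ # 1 ⊕ # 1 ⊗ # 1) refl)
      (solve 0 (# 3 ⊜ # 1 ⊗ # 1 ⊕ # 1 ⊗ # 2) refl))
      (sym (matrix-∙ (L 1#) g₀)))

  -- The words grown up to weight N < p / 9 have distinct reductions.
  module InitialSet (N : ℕ) (0<N : 0 < N) (9N<p : 9 * N < p) where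

    W : List (List Pair)
    W = grow N N (0 , 1)

    -- The words grown up to a large weight are all long. The identity and the words 1 1, 1 2, 2 1,
    -- by which conjugates of `g₀` are reached, are therefore added by hand.
    seeds : List SL₂
    seeds = e ∷ pairElement (one , one) ∷ pairElement (one , two) ∷ pairElement (two , one) ∷ map element W

    A₀ : List SL₂
    A₀ = deduplicate _≟ᴳ_ seeds

    A₀! : Unique A₀
    A₀! = deduplicate-! seeds

    private
      seed : ∀ {g} → g ∈ seeds → g ∈ A₀
      seed = ∈-deduplicate⁺ _≟ᴳ_

      2≤p : 2 ≤ p
      2≤p = ≤-trans (*-mono-≤ (≤ᵇ⇒≤ 2 9 _) 0<N) (<⇒≤ 9N<p)

      weight≤ : ∀ {w} → w ∈ W → weight (run (0 , 1) w) ≤ 9 * N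
      weight≤ = weight-grow N N (0 , 1) (≤-trans (≤ᵇ⇒≤ 5 9 _) (*-monoʳ-≤ 9 0<N))

      n₂₁≤ : ∀ {w} → w ∈ W → n₂₁ (convergents (letters w)) ≤ 9 * N
      n₂₁≤ {w} w∈ = ≤-trans (≤-reflexive (sym (cong proj₁ (run-bottom w))))
        (≤-trans (m≤n*m _ 3) (≤-trans (m≤m+n (3 * proj₁ (run (0 , 1) w)) _) (weight≤ w∈)))

      n₂₂≤ : ∀ {w} → w ∈ W → n₂₂ (convergents (letters w)) ≤ 9 * N
      n₂₂≤ {w} w∈ = ≤-trans (≤-reflexive (sym (cong proj₂ (run-bottom w))))
        (≤-trans (m≤n*m _ 5) (≤-trans (m≤n+m _ (3 * proj₁ (run (0 , 1) w))) (weight≤ w∈)))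

      element-injective : ∀ {v w} → v ∈ W → w ∈ W → element v ≡ element w → v ≡ w
      element-injective {v} {w} v∈ w∈ eq = run-injective (0 , 1) (s≤s z≤n) refl v w
        (trans (run-bottom v) (trans (cong₂ _,_
          (⟦⟧-injective (≤-<-trans (n₂₁≤ v∈) 9N<p) (≤-<-trans (n₂₁≤ w∈) 9N<p) (cong m₂₁ same))
          (⟦⟧-injective (≤-<-trans (n₂₂≤ v∈) 9N<p) (≤-<-trans (n₂₂≤ w∈) 9N<p) (cong m₂₂ same)))
          (sym (run-bottom w))))
        where
        same : reduce (convergents (letters v)) ≡ reduce (convergents (letters w))
        same = trans (sym (matrix-element v)) (trans (cong matrix eq) (matrix-element w))

    |W|≤|A₀| : length W ≤ length A₀
    |W|≤|A₀| = length-≤-injection _≟ᴳ_ (grow-unique N N (0 , 1)) element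
      (λ w∈ → seed (there (there (there (there (∈-map⁺ element w∈)))))) element-injective

    e∈A₀ : e ∈ A₀
    e∈A₀ = seed (here refl)

    g₀∈A₀ : g₀ ∈ A₀
    g₀∈A₀ = seed (there (here (sym pair-one-one)))

    g₀U∈A₀ : g₀ ∙ U 1# ∈ A₀
    g₀U∈A₀ = seed (there (there (here (sym pair-one-two))))

    Lg₀∈A₀ : L 1# ∙ g₀ ∈ A₀
    Lg₀∈A₀ = seed (there (there (there (here (sym pair-two-one)))))

    lifts-A₀ : ∀ {g} → g ∈ A₀ → Lifts (5 * p) g
    lifts-A₀ {g} g∈ = lifts-seed (∈-deduplicate⁻ _≟ᴳ_ seeds g∈)
      where
      10≤5p : 10 ≤ 5 * p
      10≤5p = *-monoʳ-≤ 5 2≤p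
      lifts-pair′ : ∀ d → g ≡ pairElement d → Lifts (5 * p) g
      lifts-pair′ d refl = lifts-mono 10≤5p (lifts-pair d)
      lifts-element : ∀ {w} → w ∈ W → Lifts (5 * p) (element w)
      lifts-element {w} w∈ = lifts (letters w) (matrix-element w) (begin
        size (convergents (letters w))    ≤⟨ size-≤ w ⟩
        2 * (n₂₁ (convergents (letters w)) + n₂₂ (convergents (letters w)))
                                          ≤⟨ *-monoʳ-≤ 2 (+-mono-≤ (≤-trans (n₂₁≤ w∈) (<⇒≤ 9N<p)) (≤-trans (n₂₂≤ w∈) (<⇒≤ 9N<p))) ⟩
        2 * (p + p)                       ≤⟨ m≤m+n (2 * (p + p)) p ⟩
        2 * (p + p) + p                   ≡⟨ eq p ⟩
        5 * p                             ∎)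
        where
        open ≤-Reasoning
        eq : ∀ x → 2 * (x + x) + x ≡ 5 * x
        eq = solve-∀
      lifts-seed : g ∈ seeds → Lifts (5 * p) g
      lifts-seed (here refl)                            = lifts-mono (≤-trans (≤ᵇ⇒≤ 2 10 _) 10≤5p) lifts-e
      lifts-seed (there (here eq))                      = lifts-pair′ (one , one) eq
      lifts-seed (there (there (here eq)))              = lifts-pair′ (one , two) eq
      lifts-seed (there (there (there (here eq))))      = lifts-pair′ (two , one) eq
      lifts-seed (there (there (there (there g∈)))) =
        let w , w∈ , g≡ = ∈-map⁻ element g∈ in subst (Lifts (5 * p)) (sym g≡) (lifts-element w∈)

  module Iteration (2≢0 : 2# ≢ 0#) (5≢0 : 5# ≢ 0#)
    (A₀ : List SL₂) (A₀! : Unique A₀) (e∈A₀ : e ∈ A₀)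
    (g₀∈A₀ : g₀ ∈ A₀) (g₀U∈A₀ : g₀ ∙ U 1# ∈ A₀) (Lg₀∈A₀ : L 1# ∙ g₀ ∈ A₀)
    (S : ℕ) (1≤S : 1 ≤ S) (lifts-A₀ : ∀ {g} → g ∈ A₀ → Lifts S g)
    (K : ℕ) {{K≢0 : NonZero K}} (large : 4 * K ^ 21 * p * 16 ≤ length A₀)
    (J : ℕ) (p⁴<K^J : p * (p * (p * p)) < K ^ J) (K<p : 2 * (576 * (K ^ 21 * (K ^ 3 * K ^ 3))) ^ 3 < p) where

    private
      instance
        S≢0 : NonZero S
        S≢0 = >-nonZero 1≤S

    A : ℕ → List SL₂
    A zero    = A₀
    A (suc j) = A j · (A j · A j)

    A! : ∀ j → Unique (A j)
    A! zero    = A₀!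
    A! (suc j) = ·-unique (A j) (A j · A j)

    private
      e∈A : ∀ j → e ∈ A j
      e∈A zero    = e∈A₀
      e∈A (suc j) = subst (_∈ A (suc j)) (trans (identityˡ _) (identityˡ e)) (∈-·⁺ (e∈A j) (∈-·⁺ (e∈A j) (e∈A j)))

      ∈-A : ∀ j {g} → g ∈ A₀ → g ∈ A j
      ∈-A zero    g∈ = g∈
      ∈-A (suc j) g∈ = subst (_∈ A (suc j)) (trans (identityˡ _) (identityˡ _)) (∈-·⁺ (e∈A j) (∈-·⁺ (e∈A j) (∈-A j g∈)))

      lifts-A : ∀ j {g} → g ∈ A j → Lifts (S ^ (3 ^ j)) g
      lifts-A zero    g∈ = lifts-mono (≤-reflexive (sym (*-identityʳ S))) (lifts-A₀ g∈)
      lifts-A (suc j) g∈ =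
        let a , x , a∈ , x∈ , g≡ = ∈-·⁻ (A j) (A j · A j) g∈
            b , c , b∈ , c∈ , x≡ = ∈-·⁻ (A j) (A j) x∈
        in subst (Lifts (S ^ (3 ^ suc j))) (sym (trans g≡ (cong (a ∙_) x≡)))
             (lifts-mono (≤-reflexive cube) (lifts-∙ (lifts-A j a∈) (lifts-∙ (lifts-A j b∈) (lifts-A j c∈))))
        where
        T = S ^ (3 ^ j)
        cube : T * (T * T) ≡ S ^ (3 * 3 ^ j)
        cube = trans (cong (λ t → T * (T * t)) (sym (*-identityʳ T)))
          (trans (^-*-assoc S (3 ^ j) 3) (cong (S ^_) (*-comm (3 ^ j) 3)))

      |A|≤p⁴ : ∀ j → length (A j) ≤ p * (p * (p * p))
      |A|≤p⁴ j = ≤-trans (length-≤-injection _≟ᴹ_ (A! j) matrix (λ {g} _ → ∈-matrices (matrix g)) (λ _ _ → matrix-injective))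
        (≤-reflexive matrices-length)

      Tripling : ℕ → Set
      Tripling j = j < J × length (A (suc j)) ≤ K * length (A j)

      grow-or-stop : ∀ n → n ≤ J → ∃ Tripling ⊎ K ^ n ≤ length (A n)
      grow-or-stop zero    _   = inj₂ (∈-length (e∈A 0))
      grow-or-stop (suc n) n<J with grow-or-stop n (<⇒≤ n<J)
      ... | inj₁ found = inj₁ found
      ... | inj₂ Kⁿ≤ with length (A (suc n)) ≤? K * length (A n)
      ...   | yes small = inj₁ (n , n<J , small)
      ...   | no  ¬small = inj₂ (≤-trans (*-monoʳ-≤ K Kⁿ≤) (<⇒≤ (≰⇒> ¬small)))

      stops : ∃ Tripling
      stops with grow-or-stop J ≤-refl
      ... | inj₁ found = found
      ... | inj₂ K^J≤  = contradiction (≤-trans K^J≤ (|A|≤p⁴ J)) (<⇒≱ p⁴<K^J)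

      j = proj₁ stops
      a = length (A j)

      a-large : 4 * K ^ 21 * p * 16 ≤ a
      a-large = ≤-trans large (⊆⇒≤ A₀! (∈-A j))

      M = 576 * (K ^ 21 * (K ^ 3 * K ^ 3))

      p³≤Ma : p * p * p ≤ M * a
      p³≤Ma = tripling⇒large 2≢0 5≢0 (A j) (A! j) (e∈A j) (∈-A j g₀∈A₀) (∈-A j g₀U∈A₀) (∈-A j Lg₀∈A₀)
        K (proj₂ (proj₂ stops)) a-large

      -- Translation by `g₂₂` preserves the cardinality and lets the word for a b c end in 2 2.
      C : List SL₂
      C = map (_∙ g₂₂) (A j)

      C! : Unique C
      C! = Unique.map⁺ (∙-cancelʳ g₂₂ _ _) (A! j)

      mixing-size : 2 * (p * p * p * p * p * (p * p * p)) < a * a * length C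
      mixing-size = subst (λ c → 2 * (p * p * p * p * p * (p * p * p)) < a * a * c) (sym (length-map (_∙ g₂₂) (A j)))
        (cube-bound p M a p³≤Ma K<p)
        where
        -- Cubing q³ ≤ m a gives q⁹ ≤ m³ a³, and a³ ≤ 2 q⁸ would then imply q ≤ 2 m³.
        cube-bound : ∀ q m a → q * q * q ≤ m * a → 2 * m ^ 3 < q → 2 * (q * q * q * q * q * (q * q * q)) < a * a * a
        cube-bound q m a q³≤ma m<q = ≰⇒> λ a³≤ → <⇒≱ m<q (*-cancelʳ-≤ _ _ (q * q * q * q * q * (q * q * q)) {{q⁸≢0}} (begin
          q * (q * q * q * q * q * (q * q * q))             ≡⟨ eq₁ q ⟩
          q * q * q * (q * q * q) * (q * q * q)             ≤⟨ *-mono-≤ (*-mono-≤ q³≤ma q³≤ma) q³≤ma ⟩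
          m * a * (m * a) * (m * a)                         ≡⟨ eq₂ m a ⟩
          m ^ 3 * (a * a * a)                               ≤⟨ *-monoʳ-≤ (m ^ 3) a³≤ ⟩
          m ^ 3 * (2 * (q * q * q * q * q * (q * q * q)))   ≡⟨ eq₃ (m ^ 3) (q * q * q * q * q * (q * q * q)) ⟩
          2 * m ^ 3 * (q * q * q * q * q * (q * q * q))     ∎))
          where
          open ≤-Reasoning
          q≢0 : NonZero q
          q≢0 = >-nonZero (≤-<-trans z≤n m<q)
          q⁸≢0 : NonZero (q * q * q * q * q * (q * q * q))
          q⁸≢0 = subst NonZero (eq₀ q) (m^n≢0 q 8 {{q≢0}})
            where
            eq₀ : ∀ q → q * (q * (q * (q * (q * (q * (q * (q * 1))))))) ≡ q * q * q * q * q * (q * q * q)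
            eq₀ = solve-∀
          eq₁ : ∀ q → q * (q * q * q * q * q * (q * q * q)) ≡ q * q * q * (q * q * q) * (q * q * q)
          eq₁ = solve-∀
          eq₂ : ∀ m a → m * a * (m * a) * (m * a) ≡ m * (m * (m * 1)) * (a * a * a)
          eq₂ = solve-∀
          eq₃ : ∀ m r → m * (2 * r) ≡ 2 * m * r
          eq₃ = solve-∀

    large-prime : Admissible p (S ^ (3 ^ suc J) * 4 * 4)
    large-prime = from-mixing (mixing (A j) (A j) C (A! j) (A! j) C! mixing-size)
      where
      T = S ^ (3 ^ j)
      from-mixing : (∃ λ a → ∃ λ b → ∃ λ c → a ∈ A j × b ∈ A j × c ∈ C × m₂₂ (matrix ((a ∙ b) ∙ c)) ≡ 0#) →
                    Admissible p (S ^ (3 ^ suc J) * 4 * 4)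
      from-mixing (a , b , c , a∈ , b∈ , c∈ , eq) =
        let c′ , c′∈ , c≡ = ∈-map⁻ (_∙ g₂₂) c∈
        in admissible-mono (*-monoˡ-≤ 4 (*-monoˡ-≤ 4 size≤))
             (lifts⇒admissible₂₂ (lifts-∙ (lifts-∙ (lifts-A j a∈) (lifts-A j b∈)) (lifts-A j c′∈))
               (trans (cong (m₂₂ ∘ matrix) (trans (assoc (a ∙ b) c′ g₂₂) (cong ((a ∙ b) ∙_) (sym c≡)))) eq))
        where
        size≤ : T * T * T ≤ S ^ (3 ^ suc J)
        size≤ = ≤-trans (≤-reflexive (trans (eq₀ T) (trans (^-*-assoc S (3 ^ j) 3) (cong (S ^_) (*-comm (3 ^ j) 3)))))
          (^-monoʳ-≤ S (^-monoʳ-≤ 3 (s≤s (<⇒≤ (proj₁ (proj₂ stops))))))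
          where
          eq₀ : ∀ t → t * t * t ≡ t * (t * (t * 1))
          eq₀ = solve-∀

-- Choice of the parameters and the final constants

module PolynomialBound where

  open import Defs
  open Words using (Admissible; admissible-mono)
  open Stopping
  open import Data.Nat.Base
  open import Data.Nat.Properties
  open import Data.Nat.DivMod using (_/_; _%_; m≡m%n+[m/n]*n; m%n<n)
  open import Data.Nat.Tactic.RingSolver using (solve-∀)

  n<2^n : ∀ n → n < 2 ^ n
  n<2^n zero    = s≤s z≤n
  n<2^n (suc n) = ≤-trans (+-mono-≤ (≤-trans (s≤s z≤n) (n<2^n n)) (n<2^n n))
    (≤-reflexive (cong (2 ^ n +_) (sym (+-identityʳ (2 ^ n)))))

  ^-distribʳ-* : ∀ m n o → (m * n) ^ o ≡ m ^ o * n ^ o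
  ^-distribʳ-* m n zero    = refl
  ^-distribʳ-* m n (suc o) = trans (cong (m * n *_) (^-distribʳ-* m n o)) (exchange m n (m ^ o) (n ^ o))
    where
    exchange : ∀ a b c d → a * b * (c * d) ≡ a * c * (b * d)
    exchange = solve-∀

  -- With K = 2ᵏ, words of weight up to p / 9 already number at least p K²⁷ if
  -- p ≥ threshold k, while p < threshold (k + 1) is bounded by a power of K.
  -- (The exponent is opaque because powers of 2 must not be unfolded.)
  abstract
    exponent : ℕ → ℕ
    exponent k = k * 5880 + 3645

    -- The surplus wanted is 2^(21k + 13): K²¹ = 2^(21k) is lost to tripling, and 2¹³ exceeds 4 · 18
    -- · 16 · 5 = 5760. Each doubling takes 70 pairs, so m = (21k + 13) · 70 pairs are needed, and
    -- 9^(m + 1) ≤ 2^(4 (m + 1)) has to stay below p.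
    exponent-weight : ∀ k → 4 * suc ((k * 21 + 13) * 70) < exponent k
    exponent-weight k = ≤-reflexive (lem k)
      where
      lem : ∀ k → suc (4 * suc ((k * 21 + 13) * 70)) ≡ k * 5880 + 3645
      lem = solve-∀

    exponent-K : ∀ k → suc ((k * 27 + 10) * 3) < exponent k
    exponent-K k = ≤-trans (≤-reflexive (lem k)) (+-mono-≤ (*-monoʳ-≤ k (≤ᵇ⇒≤ 81 5880 _)) (≤ᵇ⇒≤ 32 3645 _))
      where
      lem : ∀ k → suc (suc ((k * 27 + 10) * 3)) ≡ k * 81 + 32
      lem = solve-∀

    -- 15405 = 2 · 5880 + 3645. This gives p < K^15405, so that p⁴ < K^J for J = 15405 · 4,
    -- independently of p.
    exponent-suc : ∀ {k} → 1 ≤ k → exponent (suc k) ≤ k * 15405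
    exponent-suc {k} = bound 5880 3645 k
      where
      bound : ∀ c d k → 1 ≤ k → suc k * c + d ≤ k * (c + (c + d))
      bound c d k 1≤k = ≤-trans (≤-reflexive (lem c d k))
        (≤-trans (+-monoʳ-≤ (k * c) (*-monoˡ-≤ (c + d) 1≤k)) (≤-reflexive (sym (*-distribˡ-+ k c (c + d)))))
        where
        lem : ∀ c d k → suc k * c + d ≡ k * c + 1 * (c + d)
        lem = solve-∀

    n≤exponent : ∀ n → n ≤ exponent (suc n)
    n≤exponent = bound 5880 3645
      where
      bound : ∀ c d .{{_ : NonZero c}} n → n ≤ suc n * c + d
      bound c d n = ≤-trans (n≤1+n n) (≤-trans (m≤m*n (suc n) c) (m≤m+n (suc n * c) d))

    5≤exponent : ∀ k → 5 ≤ exponent k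
    5≤exponent k = ≤-trans (≤ᵇ⇒≤ 5 3645 _) (m≤n+m 3645 (k * 5880))

  threshold : ℕ → ℕ
  threshold k = 2 ^ exponent k

  -- Both bounds on p matter: the lower one leaves room for the powers of K that are lost, the upper
  -- one keeps K above a fixed power of p. The search descends from k = p, for which the upper bound
  -- holds since p < 2^p.
  locate : ∀ p → threshold 1 ≤ p → ∃ λ k → 1 ≤ k × threshold k ≤ p × p < threshold (suc k)
  locate p lo = search p (<-≤-trans (n<2^n p) (^-monoʳ-≤ 2 (n≤exponent p)))
    where
    search : ∀ n → p < threshold (suc n) → ∃ λ k → 1 ≤ k × threshold k ≤ p × p < threshold (suc k)
    search zero    hi = contradiction lo (<⇒≱ hi)
    search (suc n) hi with threshold (suc n) ≤? p
    ... | yes le = suc n , s≤s z≤n , le , hi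
    ... | no nle = search n (≰⇒> nle)

  module Large (p : ℕ) (p-prime : Prime p) (k : ℕ) (1≤k : 1 ≤ k)
    (lo : threshold k ≤ p) (hi : p < threshold (suc k)) where

    private
      n = k * 21 + 13
      m = n * 70
      K = 2 ^ k

      -- The largest N with 9 N < p, as the weights of the grown words reach at most 9 N.
      N = pred p / 9

      p≡ : p ≡ suc (pred p)
      p≡ = sym (suc-pred p {{>-nonZero (<-≤-trans (≤-trans (s≤s z≤n) (n<2^n (exponent k))) lo)}})

      pred-p≡ : pred p ≡ pred p % 9 + N * 9
      pred-p≡ = m≡m%n+[m/n]*n (pred p) 9

      9N<p : 9 * N < p
      9N<p = ≤-trans (s≤s (≤-trans (≤-reflexive (*-comm 9 N)) (≤-trans (m≤n+m (N * 9) (pred p % 9)) (≤-reflexive (sym pred-p≡)))))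
        (≤-reflexive (sym p≡))

      p≤9[N+1] : p ≤ 9 * suc N
      p≤9[N+1] = ≤-trans (≤-reflexive (trans p≡ (cong suc pred-p≡)))
        (≤-trans (+-monoˡ-≤ (N * 9) (m%n<n (pred p) 9)) (≤-reflexive (*-comm (suc N) 9)))

      9^m≤N : 9 ^ m ≤ N
      9^m≤N = s≤s⁻¹ (≰⇒> λ sucN≤ → <⇒≱ (<-≤-trans power< lo) (≤-trans p≤9[N+1] (*-monoʳ-≤ 9 sucN≤)))
        where
        power< : 9 * 9 ^ m < threshold k
        power< = ≤-<-trans (≤-trans (^-monoˡ-≤ (suc m) {9} {16} (≤ᵇ⇒≤ 9 16 _)) (≤-reflexive (^-*-assoc 2 4 (suc m))))
          (^-monoʳ-< 2 (s≤s (s≤s z≤n)) (exponent-weight k))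

      0<N : 0 < N
      0<N = ≤-trans (m^n>0 9 m) 9^m≤N

      p≤18N : p ≤ 18 * N
      p≤18N = ≤-trans p≤9[N+1] (≤-trans (*-monoʳ-≤ 9 (+-monoˡ-≤ N 0<N)) (≤-reflexive (lem N)))
        where
        lem : ∀ n → 9 * (n + n) ≡ 18 * n
        lem = solve-∀

      |W| = length (grow N N (0 , 1))

      2ⁿN≤5|W| : 2 ^ n * N ≤ |W| * 5
      2ⁿN≤5|W| = *-cancelˡ-≤ (D ^ m) {{m^n≢0 D m}} (begin
        D ^ m * (2 ^ n * N)            ≡⟨ exchange (D ^ m) (2 ^ n) N ⟩
        2 ^ n * D ^ m * N              ≤⟨ *-monoˡ-≤ N 2ⁿDᵐ≤Λᵐ ⟩
        Λ ^ m * N                      ≤⟨ length-grow N N (0 , 1) m _ fuel weight-bound ⟩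
        D ^ m * |W| * 5                ≡⟨ *-assoc (D ^ m) |W| 5 ⟩
        D ^ m * (|W| * 5)              ∎)
        where
        open ≤-Reasoning
        exchange : ∀ a b c → a * (b * c) ≡ b * a * c
        exchange = solve-∀
        2ⁿDᵐ≤Λᵐ : 2 ^ n * D ^ m ≤ Λ ^ m
        2ⁿDᵐ≤Λᵐ = begin
          2 ^ n * D ^ (n * 70)     ≡⟨ cong (λ t → 2 ^ n * D ^ t) (*-comm n 70) ⟩
          2 ^ n * D ^ (70 * n)     ≡⟨ cong (2 ^ n *_) (sym (^-*-assoc D 70 n)) ⟩
          2 ^ n * (D ^ 70) ^ n     ≡⟨ sym (^-distribʳ-* 2 (D ^ 70) n) ⟩
          (2 * D ^ 70) ^ n         ≤⟨ ^-monoˡ-≤ n doubling ⟩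
          (Λ ^ 70) ^ n             ≡⟨ ^-*-assoc Λ 70 n ⟩
          Λ ^ (70 * n)             ≡⟨ cong (Λ ^_) (*-comm 70 n) ⟩
          Λ ^ (n * 70)             ∎
        fuel : N < 2 ^ N * 5
        fuel = <-≤-trans (n<2^n N) (m≤m*n (2 ^ N) 5)
        weight-bound : 9 ^ m * 5 ≤ 9 * N
        weight-bound = ≤-trans (*-mono-≤ 9^m≤N (≤ᵇ⇒≤ 5 9 _)) (≤-reflexive (*-comm N 9))

      2^[ki] : ∀ i → K ^ i ≡ 2 ^ (k * i)
      2^[ki] i = ^-*-assoc 2 k i

      large : 4 * K ^ 21 * p * 16 ≤ |W|
      large = *-cancelʳ-≤ _ _ 5 (begin
        4 * K ^ 21 * p * 16 * 5             ≤⟨ *-monoˡ-≤ 5 (*-monoˡ-≤ 16 (*-monoʳ-≤ (4 * K ^ 21) p≤18N)) ⟩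
        4 * K ^ 21 * (18 * N) * 16 * 5      ≡⟨ lem (K ^ 21) N ⟩
        K ^ 21 * 5760 * N                   ≤⟨ *-monoˡ-≤ N (*-monoʳ-≤ (K ^ 21) (≤ᵇ⇒≤ 5760 8192 _)) ⟩
        K ^ 21 * 2 ^ 13 * N                 ≡⟨ cong (λ t → t * 2 ^ 13 * N) (2^[ki] 21) ⟩
        2 ^ (k * 21) * 2 ^ 13 * N           ≡⟨ cong (_* N) (sym (^-distribˡ-+-* 2 (k * 21) 13)) ⟩
        2 ^ n * N                           ≤⟨ 2ⁿN≤5|W| ⟩
        |W| * 5                             ∎)
        where
        open ≤-Reasoning
        lem : ∀ a n → 4 * a * (18 * n) * 16 * 5 ≡ a * 5760 * n
        lem = solve-∀

      K-small : 2 * (576 * (K ^ 21 * (K ^ 3 * K ^ 3))) ^ 3 < p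
      K-small = <-≤-trans (≤-<-trans (begin
        2 * (576 * (K ^ 21 * (K ^ 3 * K ^ 3))) ^ 3
          ≡⟨ cong (λ t → 2 * (576 * t) ^ 3) (trans (cong (K ^ 21 *_) (sym (^-distribˡ-+-* K 3 3))) (sym (^-distribˡ-+-* K 21 6))) ⟩
        2 * (576 * K ^ 27) ^ 3
          ≤⟨ *-monoʳ-≤ 2 (^-monoˡ-≤ 3 (≤-trans (≤-reflexive (*-comm 576 (K ^ 27))) (*-mono-≤ (≤-reflexive (2^[ki] 27)) (≤ᵇ⇒≤ 576 1024 _)))) ⟩
        2 * (2 ^ (k * 27) * 2 ^ 10) ^ 3
          ≡⟨ cong (λ t → 2 * t ^ 3) (sym (^-distribˡ-+-* 2 (k * 27) 10)) ⟩
        2 * (2 ^ (k * 27 + 10)) ^ 3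
          ≡⟨ cong (2 *_) (^-*-assoc 2 (k * 27 + 10) 3) ⟩
        2 ^ suc ((k * 27 + 10) * 3) ∎)
        (^-monoʳ-< 2 (s≤s (s≤s z≤n)) (exponent-K k))) lo
        where
        open ≤-Reasoning

      p<2^[15405k] : p < 2 ^ (k * 15405)
      p<2^[15405k] = <-≤-trans hi (^-monoʳ-≤ 2 (exponent-suc 1≤k))

      p⁴<K^ : ∀ J → 15405 * 4 ≤ J → p * (p * (p * p)) < K ^ J
      p⁴<K^ J J-large = <-≤-trans (*-mono-< p< (*-mono-< p< (*-mono-< p< p<))) (begin
        T * (T * (T * T))                  ≡⟨ cong (λ t → T * (T * (T * t))) (sym (*-identityʳ T)) ⟩
        T ^ 4                              ≡⟨ ^-*-assoc 2 (k * 15405) 4 ⟩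
        2 ^ (k * 15405 * 4)                ≡⟨ cong (2 ^_) (*-assoc k 15405 4) ⟩
        2 ^ (k * (15405 * 4))              ≤⟨ ^-monoʳ-≤ 2 (*-monoʳ-≤ k J-large) ⟩
        2 ^ (k * J)                        ≡⟨ sym (2^[ki] J) ⟩
        K ^ J                              ∎)
        where
        open ≤-Reasoning
        T = 2 ^ (k * 15405)
        p< = p<2^[15405k]

      5<p : 5 < p
      5<p = <-≤-trans (≤-<-trans (5≤exponent k) (n<2^n (exponent k))) lo

    open PrimeField p p-prime using (⟦small⟧≢0)

    large-prime : ∀ J → 15405 * 4 ≤ J → Admissible p ((5 * p) ^ (3 ^ suc J) * 4 * 4)
    large-prime J J-large = Reach.Iteration.large-prime p p-prime
      (⟦small⟧≢0 2 (≤-trans (≤ᵇ⇒≤ 3 5 _) (<⇒≤ 5<p)) (s≤s z≤n)) (⟦small⟧≢0 5 5<p (s≤s z≤n))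
      A₀ A₀! e∈A₀ g₀∈A₀ g₀U∈A₀ Lg₀∈A₀ (5 * p) (≤-trans (≤-trans (s≤s z≤n) (<⇒≤ 5<p)) (m≤n*m p 5)) lifts-A₀
      K {{m^n≢0 2 k}} (≤-trans large |W|≤|A₀|) J (p⁴<K^ J J-large) K-small
      where
      open Reach.InitialSet p p-prime N 0<N 9N<p

  -- `J` and `P` are variables so that powers such as 3^(suc J) stay symbolic. The exponent C comes
  -- from the large primes; for the remaining ones, p ≤ P turns the bound 10^(p⁴) * 4 into the
  -- constant Y.
  bounded : ∀ J P → 15405 * 4 ≤ J → threshold 1 ≤ P →
            ∃[ C ] ∃[ C₀ ] 0 < C × 0 < C₀ × (∀ p → Prime p → Admissible p (C₀ * p ^ C))
  bounded J P J-large P-large =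
    C , C₀ , m^n>0 3 (suc J) , ≤-trans (m^n>0 5 C) (≤-trans (m≤m*n (5 ^ C) 4) (≤-trans (m≤m*n _ 4) (m≤m+n _ _))) , by-size
    where
    C = 3 ^ suc J
    X = 5 ^ C * 4 * 4
    Y = 10 ^ (P * (P * (P * P))) * 4
    C₀ = X + Y

    by-size : ∀ p → Prime p → Admissible p (C₀ * p ^ C)
    by-size p p-prime with threshold 1 ≤? p
    ... | yes lo = let k , 1≤k , lo′ , hi = locate p lo in
      admissible-mono (begin
        (5 * p) ^ C * 4 * 4       ≡⟨ cong (λ t → t * 4 * 4) (^-distribʳ-* 5 p C) ⟩
        5 ^ C * p ^ C * 4 * 4     ≡⟨ exchange (5 ^ C) (p ^ C) ⟩
        X * p ^ C                 ≤⟨ *-monoˡ-≤ (p ^ C) (m≤m+n X Y) ⟩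
        C₀ * p ^ C                ∎)
        (Large.large-prime p p-prime k 1≤k lo′ hi J J-large)
      where
      open ≤-Reasoning
      exchange : ∀ a b → a * b * 4 * 4 ≡ a * 4 * 4 * b
      exchange = solve-∀
    ... | no ¬lo = admissible-mono (begin
        10 ^ (p * (p * (p * p))) * 4   ≤⟨ *-monoˡ-≤ 4 (^-monoʳ-≤ 10 (*-mono-≤ p≤P (*-mono-≤ p≤P (*-mono-≤ p≤P p≤P)))) ⟩
        Y                              ≤⟨ m≤n+m Y X ⟩
        C₀                             ≤⟨ m≤m*n C₀ (p ^ C) {{m^n≢0 p C {{prime⇒nonZero p-prime}}}} ⟩
        C₀ * p ^ C                     ∎)
        (Reach.small-prime p p-prime)
      where
      open ≤-Reasoning
      p≤P : p ≤ P
      p≤P = ≤-trans (<⇒≤ (≰⇒> ¬lo)) P-large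

open import Defs
open import Data.Nat.Base using (_*_; _^_; _≤_; _<_)
open import Data.Nat.Properties using (≤-refl)
open import Data.Nat.Divisibility using (_∣_)
open import Data.Nat.GCD using (gcd)

theorem2 : ∃[ C ] ∃[ C₀ ] 0 < C × 0 < C₀ ×
    (∀ (p : ℕ) → Prime p →
    Σ[ q ∈ ℕ ] Σ[ q≢0 ∈ NonZero q ] Σ[ a ∈ ℕ ]
    (0 < a × a < q × gcd a q ≡ 1 × p ∣ q × q ≤ C₀ * p ^ C ×
    (Σ[ bs ∈ List ℕ ] (IsRegularCF a q {{q≢0}} bs × All (_≤ 2) bs))))
theorem2 = PolynomialBound.bounded (15405 * 4) (PolynomialBound.threshold 1) ≤-refl ≤-refl
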